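{- For every $r$-tuple of partitions $(\lambda^{(1)}|\cdots|\lambda^{(r)})$, $$\mathcal{S}_{(\lambda^{(1)}|\cdots|\lambda^{(r)})}(X_1|\cdots|X_r)=\sum_{\sigma\in\mathcal{L}(\lambda^{(1)}|\cdots|\lambda^{(r)})}x^{\sigma}.$$
   Context: Isobaric divided differences: for variables $x,y$, $\xi_{x,y}(f)=\frac{xf(x,y)-yf(y,x)}{x-y}$, and $\xi_i=\xi_{x_i,x_{i+1}}$ on $\mathbb{Q}[x_1,\dots,x_n]$. Key polynomials: for $\alpha\in\mathbb{Z}_{\ge0}^n$, $\mathcal{K}_\alpha(x_1,\dots,x_n)$ are the unique polynomials with $\mathcal{K}_\alpha=x^\alpha$ if $\alpha_1\ge\cdots\ge\alpha_n$, and $\mathcal{K}_{s_i\alpha}=\xi_i\mathcal{K}_\alpha$ whenever $\alpha_i>\alpha_{i+1}$ ($s_i\alpha$ swaps entries $i,i+1$). Compositions are finite sequences of nonnegative integers, $*$ is concatenation, $0^m$ is a string of $m$ zeros; for a partition $\lambda$, $\ell(\lambda)$ is its number of nonzero parts and $\mathrm{rev}(\lambda)=(\lambda_{\ell(\lambda)},\dots,\lambda_1)$. For $n_i\ge\ell(\lambda^{(i)})$ put $\mathcal{S}^{(n_1|\cdots|n_r)}_{(\lambda^{(1)}|\cdots|\lambda^{(r)})}=\mathcal{K}_{\gamma}(x_{1,1},\dots,x_{1,n_1},\dots,x_{r,1},\dots,x_{r,n_r})$ with $\gamma=(0^{n_1-\ell(\lambda^{(1)})}*\mathrm{rev}(\lambda^{(1)}))*\cdots*(0^{n_r-\ell(\lambda^{(r)})}*\mathrm{rev}(\lambda^{(r)}))$.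 The multi-symmetric Schur function $\mathcal{S}_{(\lambda^{(1)}|\cdots|\lambda^{(r)})}(X_1|\cdots|X_r)$, $X_i=\{x_{i,1},x_{i,2},\dots\}$, is the limit of these polynomials as $n_1,\dots,n_r\to\infty$ (each monomial coefficient eventually stabilizes). Diagrams: for a composition $\mu=(\mu_1,\dots,\mu_n)$, $dg'(\mu)=\{(i,j):1\le i\le n,1\le j\le\mu_i\}$ (column $i$ has height $\mu_i$) and $\widehat{dg}(\mu)=dg'(\mu)\cup\{(i,0):1\le i\le n\}$ (basement row). Two distinct boxes attack if they are in the same row, or they are in consecutive rows and the box in the lower row is strictly to the right of the box in the upper row. For a labeling $\tau$ of $\widehat{dg}(\mu)$ by a totally ordered set, a co-inversion triple is a triple of boxes $(u,v,w)$ with $u=(i,j)$, $j\ge1$, $w=(i,j-1)$ the box directly below $u$, and either (Type 1) $v=(i',j-1)$ with $i'>i$ and $\mu_{i'}<\mu_i$, or (Type 2) $v=(i',j)$ with $i'<i$ and $\mu_{i'}\le\mu_i$, such that $\tau(u)<\tau(v)<\tau(w)$ or $\tau(v)<\tau(w)<\tau(u)$ or $\tau(w)<\tau(u)<\tau(v)$. Alphabet: labels $k_j$ ($k\ge1$, $1\le j\le r$) and basement symbols $\omega_j+k$ ($k\ge0$, $1\le j\le r$), totally ordered so that within index $j$: $a_j<b_j$ iff $a<b$, every $a_j<\omega_j+k$, $\omega_j+k<\omega_j+k'$ iff $k<k'$; and every element with index $j$ is smaller than every element with index $j'>j$. Let $\mathcal{L}(\lambda^{(1)}|\cdots|\lambda^{(r)})$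 be the set of maps $\sigma$ from $dg'(\mathrm{rev}(\lambda^{(1)})*\cdots*\mathrm{rev}(\lambda^{(r)}))$ to $\{k_j\}$ such that the extension $\sigma^\star$ to $\widehat{dg}$, defined on basement boxes by $\sigma^\star(\ell(\lambda^{(1)})+\cdots+\ell(\lambda^{(i-1)})+j,0)=\omega_i+j-1$ ($1\le j\le\ell(\lambda^{(i)})$), is non-attacking (attacking boxes have distinct labels), weakly decreasing upwards in each column, and has no co-inversion triples. The weight is $x^\sigma=\prod_{j}\prod_{k}x_{j,k}^{|\sigma^{ -1}(k_j)|}$. -}

module Defs where

open import Data.Nat using (ℕ; zero; suc; _≤_; _<_; _≥_; _∸_; _≟_)
open import Data.Fin using (Fin; toℕ)
import Data.Fin as Fin
open import Data.List using (List; []; _∷_; length; map; concat; replicate; reverse; _++_; upTo; allFin; zipWith)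
open import Data.List.Relation.Unary.All using (All)
open import Data.List.Relation.Unary.Linked using (Linked)
open import Data.Product using (_×_; _,_; proj₁; proj₂)
open import Data.Sum using (_⊎_)
open import Data.Maybe using (Maybe; just; nothing)
open import Data.Integer using (+_)
open import Data.Rational using (ℚ; 0ℚ; 1ℚ; _-_; _/_)
open import Relation.Binary.PropositionalEquality using (_≡_; _≢_)
open import Relation.Nullary using (¬_; yes; no)

at : List ℕ → ℕ → ℕ
at []       _       = 0
at (x ∷ xs) zero    = x
at (x ∷ xs) (suc i) = at xs i

nth : {A : Set} → List A → ℕ → Maybe A
nth []       _       = nothing
nth (x ∷ xs) zero    = just x
nth (x ∷ xs) (suc i) = nth xs i

swapAt : List ℕ → ℕ → List ℕ
swapAt (a ∷ b ∷ xs) zero    = b ∷ a ∷ xs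
swapAt (a ∷ xs)     (suc i) = a ∷ swapAt xs i
swapAt xs           _       = xs

decAt : ℕ → List ℕ → List ℕ
decAt i       []       = []
decAt zero    (x ∷ xs) = (x ∸ 1) ∷ xs
decAt (suc i) (x ∷ xs) = x ∷ decAt i xs

-- Polynomials (formal power series) over ℚ in n variables x_0..x_{n-1},
-- represented by their coefficient function on exponent vectors
-- (lists of length n; values at other lengths are irrelevant).

Coeffs : Set
Coeffs = List ℕ → ℚ

mulVar : ℕ → Coeffs → Coeffs
mulVar i f e with at e i
... | zero  = 0ℚ
... | suc _ = f (decAt i e)

swapPoly : ℕ → Coeffs → Coeffs
swapPoly i f e = f (swapAt e i)

-- A family K indexed by compositions α (K α is a polynomial in length α
-- variables) satisfying the defining properties of key polynomials:
--  * K α = x^α when α is weakly decreasing;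
--  * K (s_i α) = ξ_i (K α) whenever α_i > α_{i+1}, where g = ξ_i f is
--    expressed (division-free, uniquely since ℚ[[x]] is a domain) as
--      (x_i - x_{i+1}) g = x_i f - x_{i+1} (s_i f).
IsKeyFamily : (List ℕ → Coeffs) → Set
IsKeyFamily K =
  (∀ α → Linked _≥_ α → ∀ e → length e ≡ length α →
     (e ≡ α → K α e ≡ 1ℚ) × (e ≢ α → K α e ≡ 0ℚ))
  ×
  (∀ α i → suc i < length α → at α (suc i) < at α i →
   ∀ e → length e ≡ length α →
     mulVar i (K (swapAt α i)) e - mulVar (suc i) (K (swapAt α i)) e
       ≡ mulVar i (K α) e - mulVar (suc i) (swapPoly i (K α)) e)

IsPartition : List ℕ → Set
IsPartition λ′ = Linked _≥_ λ′ × All (λ p → 1 ≤ p) λ′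

concatFin : {A : Set} (r : ℕ) → (Fin r → List A) → List A
concatFin r f = concat (map f (allFin r))

gamma : (r : ℕ) → (Fin r → List ℕ) → (Fin r → ℕ) → List ℕ
gamma r lam n = concatFin r (λ j → replicate (n j ∸ length (lam j)) 0 ++ reverse (lam j))

-- exponent vector of the monomial m in the variables
-- x_{1,1..n_1}, ..., x_{r,1..n_r}; (m j) lists the exponents of
-- x_{j,1}, x_{j,2}, ... (missing entries = 0)
expo : (r : ℕ) → (Fin r → List ℕ) → (Fin r → ℕ) → List ℕ
expo r m n = concatFin r (λ j → map (at (m j)) (upTo (n j)))

-- Alphabet: lab k j  is  k_j  ;  om j c  is  ω_j + c

data Sym (r : ℕ) : Set where
  lab : ℕ → Fin r → Sym r
  om  : Fin r → ℕ → Sym r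

index : {r : ℕ} → Sym r → Fin r
index (lab _ j) = j
index (om j _)  = j

data _≺_ {r : ℕ} : Sym r → Sym r → Set where
  idx< : {a b : Sym r} → toℕ (index a) < toℕ (index b) → a ≺ b
  ll   : {k k′ : ℕ} {j : Fin r} → k < k′ → lab k j ≺ lab k′ j
  lo   : {k c : ℕ} {j : Fin r} → lab k j ≺ om j c
  oo   : {c c′ : ℕ} {j : Fin r} → c < c′ → om j c ≺ om j c′

_≼_ : {r : ℕ} → Sym r → Sym r → Set
a ≼ b = a ≺ b ⊎ a ≡ b

-- Fillings.  A labeling σ of dg'(μ) is a list of columns; column i is
-- the list of its labels from row 1 upwards; a label (k , j) means k_j.

Label : ℕ → Set
Label r = ℕ × Fin r

Filling : ℕ → Set
Filling r = List (List (Label r))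

shapeOf : (r : ℕ) → (Fin r → List ℕ) → List ℕ
shapeOf r lam = concatFin r (λ j → reverse (lam j))

basement : (r : ℕ) → (Fin r → List ℕ) → List (Sym r)
basement r lam = concatFin r (λ j → map (om j) (upTo (length (lam j))))

extend : {r : ℕ} → List (Sym r) → Filling r → List (List (Sym r))
extend base σ = zipWith _∷_ base (map (map (λ p → lab (proj₁ p) (proj₂ p))) σ)

-- label of box (column c, row h), 0-based column, row 0 = basement
boxLabel : {A : Set} → List (List A) → ℕ → ℕ → Maybe A
boxLabel τ c h with nth τ c
... | nothing  = nothing
... | just col = nth col h

Attacks : ℕ × ℕ → ℕ × ℕ → Set
Attacks (c , h) (c′ , h′) =
  (h ≡ h′ × c ≢ c′) ⊎ (h′ ≡ suc h × c′ < c)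

NonAttacking : {r : ℕ} → List (List (Sym r)) → Set
NonAttacking τ = ∀ c h c′ h′ a b →
  boxLabel τ c h ≡ just a → boxLabel τ c′ h′ ≡ just b →
  Attacks (c , h) (c′ , h′) → a ≢ b

WeaklyDecreasingUp : {r : ℕ} → List (List (Sym r)) → Set
WeaklyDecreasingUp τ = ∀ c h a b →
  boxLabel τ c (suc h) ≡ just a → boxLabel τ c h ≡ just b → a ≼ b

CoinvOrder : {r : ℕ} → Sym r → Sym r → Sym r → Set
CoinvOrder u v w = (u ≺ v × v ≺ w) ⊎ (v ≺ w × w ≺ u) ⊎ (w ≺ u × u ≺ v)

NoCoinversionTriples : {r : ℕ} → List ℕ → List (List (Sym r)) → Set
NoCoinversionTriples μ τ = ∀ i i′ h u v w →
  boxLabel τ i (suc h) ≡ just u →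
  boxLabel τ i h ≡ just w →
  ( (i < i′ × at μ i′ < at μ i × boxLabel τ i′ h ≡ just v)
  ⊎ (i′ < i × at μ i′ ≤ at μ i × boxLabel τ i′ (suc h) ≡ just v) ) →
  ¬ CoinvOrder u v w

InL : (r : ℕ) → (Fin r → List ℕ) → Filling r → Set
InL r lam σ =
  map length σ ≡ shapeOf r lam ×
  All (All (λ p → 1 ≤ proj₁ p)) σ ×
  NonAttacking τ × WeaklyDecreasingUp τ × NoCoinversionTriples (shapeOf r lam) τ
  where τ = extend (basement r lam) σ

countLabel : {r : ℕ} → ℕ → Fin r → Filling r → ℕ
countLabel {r} k j σ = go (concat σ)
  where
  go : List (Label r) → ℕ
  go [] = 0
  go ((k′ , j′) ∷ xs) with k′ ≟ k | j′ Fin.≟ j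
  ... | yes _ | yes _ = suc (go xs)
  ... | _     | _     = go xs

-- x^σ = the monomial m  (m j lists exponents of x_{j,1}, x_{j,2}, ...)
HasWeight : {r : ℕ} → Filling r → (Fin r → List ℕ) → Set
HasWeight σ m = ∀ j k → countLabel (suc k) j σ ≡ at (m j) k

toℚ : ℕ → ℚ
toℚ n = (+ n) / 1

{-# OPTIONS --safe #-}

-- Fillings are built row by row. Over an increasing basement, the defining conditions say that the
-- labels of a row increase along any two columns of weakly increasing height and that a column which
-- has passed to the right of the label of a shorter column further right stays there in the next row.
-- For a row w let F w be the generating series of the fillings above w, and let s exchange the labels
-- p and p+1. By induction on the number of rows, summing over the orbits {w , s w}, one shows that
-- F w + F (s w) is symmetric in x_p and x_{p+1}, and that F w is x_{p+1} times a symmetric series if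
-- w contains p+1 and if p is absent or sits further right in a shorter column. A second induction on
-- rows exchanges two adjacent columns: if T₂ is the series of a composition with an ascent at p over
-- the basement 1, …, n, then T₂ = T + T′, where T belongs to the composition with the ascent exchanged
-- and T′ to the same columns with the basement labels p and p+1 exchanged. Here T₂ and x_p T′ are
-- symmetric, so ξ_p T = ξ_p T₂ - ξ_p T′ = T₂. As a weakly decreasing composition has only the filling
-- by constant columns, fillings over 1, …, n compute the key polynomials.
--
-- When the n_j are large, a filling of given weight uses no label near the basement; the symbols k_j
-- and ω_j + c are then ordered as the positions of their variables, and empty columns impose nothing.

module Submission where

open import Defs
import Algebra.Properties.CommutativeSemigroup
open import Data.Empty using (⊥; ⊥-elim)
open import Data.Fin using (Fin; zero; suc; toℕ; fromℕ<)
import Data.Fin as Fin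
import Data.Fin.Properties as Finₚ
import Data.Integer as ℤ
import Data.Integer.Properties as ℤₚ
open import Data.List using (List; []; _∷_; length; _++_; upTo; applyUpTo; mapMaybe; replicate; reverse; allFin; concat)
import Data.List as List
open import Data.List.Membership.Propositional using (_∈_)
open import Data.List.Membership.Propositional.Properties using (∈-++⁺ˡ; ∈-++⁺ʳ; ∈-++⁻; ∈-map⁺; ∈-map⁻)
open import Data.List.Membership.Propositional.Properties.WithK using (unique∧set⇒bag)
open import Data.List.Properties
  using (length-++; length-map; map-tabulate; map-cong; map-applyUpTo; length-applyUpTo; map-∘; length-upTo;
         length-reverse; length-replicate; ∷-injectiveˡ; ∷-injectiveʳ)
import Data.List.Properties as Listₚ
open import Data.List.Relation.Binary.BagAndSetEquality using (∼bag⇒↭)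
open import Data.List.Relation.Binary.Permutation.Propositional.Properties using (↭-length)
open import Data.List.Relation.Unary.All using (All; []; _∷_)
import Data.List.Relation.Unary.All as All
import Data.List.Relation.Unary.All.Properties as Allₚ
open import Data.List.Relation.Unary.AllPairs using (AllPairs; []; _∷_)
open import Data.List.Relation.Unary.Any using (here; there)
import Data.List.Relation.Unary.Any.Properties as Anyₚ
open import Data.List.Relation.Unary.Linked using (Linked; []; [-]; _∷_)
open import Data.List.Relation.Unary.Unique.Propositional using (Unique)
import Data.List.Relation.Unary.Unique.Propositional.Properties as Uniqueₚ
open import Data.Maybe using (Maybe; just; nothing)
import Data.Maybe as Maybe
open import Data.Maybe.Properties using (just-injective)
open import Data.Nat using (ℕ; zero; suc; _+_; _*_; _∸_; _≤_; _<_; _≥_; z≤n; s≤s; _≟_; pred; _≤?_; _<?_)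
open import Data.Nat.Induction using (<-wellFounded)
open import Data.Nat.Properties
open import Data.Nat.Tactic.RingSolver using (solve-∀)
open import Data.Product using (_×_; _,_; proj₁; proj₂; ∃-syntax)
open import Data.Rational using (ℚ; 0ℚ; _-_; toℚᵘ)
import Data.Rational as ℚ
import Data.Rational.Properties as ℚₚ
import Data.Rational.Unnormalised as ℚᵘ
import Data.Rational.Unnormalised.Properties as ℚᵘₚ
open import Data.Sum using (_⊎_; inj₁; inj₂)
import Data.Sum as Sum
open import Data.Unit using (⊤; tt)
open import Data.Vec using (Vec; []; _∷_; lookup; map; toList; fromList; zipWith; _[_]≔_)
import Data.Vec as Vec
open import Data.Vec.Properties
  using (lookup-map; length-toList; lookup-replicate; lookup-zipWith; lookup∘update; lookup∘update′;
         toList∘fromList; toList-injective; cast-is-id)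
open import Data.Vec.Relation.Binary.Pointwise.Extensional using (ext; Pointwise-≡⇒≡)
open import Function using (_∘_; id)
open import Function.Bundles using (_⇔_; mk⇔; Equivalence)
open import Induction.WellFounded using (Acc; acc)
open import Relation.Binary.Definitions using (tri<; tri≈; tri>)
open import Relation.Binary.PropositionalEquality
open import Relation.Nullary using (¬_; yes; no; Dec; ¬?; _×-dec_; _→-dec_; _⊎-dec_)
import Algebra.Properties.AbelianGroup ℚₚ.+-0-abelianGroup as ℚ+
open Algebra.Properties.CommutativeSemigroup +-commutativeSemigroup using (interchange)

-- The induction on rows cannot run on orbit sums alone. If a row contains p but not p + 1, a row
-- may be allowed above it although the exchanged row is not allowed above the exchanged one. This
-- has two causes: the column of p would have to increase, or a taller column further left would no
-- longer clear the label of that column. In both cases one of the two upper rows carries p + 1 in a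
-- column that lies left of, and is taller than, any column carrying p. Its series F then has x_p F
-- symmetric, and this corrects the orbit sum; hence the statement on single rows beside the one on
-- orbits. Symmetry of x_p F is also what the conclusion needs: it says that the numerator x_p F -
-- x_{p+1} s F of ξ_p F vanishes, so ξ_p kills T′, while ξ_p fixes the symmetric T₂. All series have
-- coefficients in ℕ. Averages over orbits become sums in which every row occurs twice, followed by
-- a cancellation of 2, and relations with a difference are stated as equalities of sums.

sw : ℕ → ℕ → ℕ
sw zero    zero          = 1
sw zero    (suc zero)    = 0
sw zero    (suc (suc x)) = suc (suc x)
sw (suc p) zero          = zero
sw (suc p) (suc x)       = suc (sw p x)

sw-invol : ∀ p x → sw p (sw p x) ≡ x
sw-invol zero    zero          = refl
sw-invol zero    (suc zero)    = refl
sw-invol zero    (suc (suc x)) = refl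
sw-invol (suc p) zero          = refl
sw-invol (suc p) (suc x)       = cong suc (sw-invol p x)

sw-p : ∀ p → sw p p ≡ suc p
sw-p zero    = refl
sw-p (suc p) = cong suc (sw-p p)

sw-suc : ∀ p → sw p (suc p) ≡ p
sw-suc zero    = refl
sw-suc (suc p) = cong suc (sw-suc p)

sw-other : ∀ p {x} → x ≢ p → x ≢ suc p → sw p x ≡ x
sw-other zero    {zero}        x≢ _  = ⊥-elim (x≢ refl)
sw-other zero    {suc zero}    _  x≢ = ⊥-elim (x≢ refl)
sw-other zero    {suc (suc x)} _  _  = refl
sw-other (suc p) {zero}        _  _  = refl
sw-other (suc p) {suc x}       n m   = cong suc (sw-other p (λ q → n (cong suc q)) (λ q → m (cong suc q)))

sw≡p : ∀ p {x} → sw p x ≡ p → x ≡ suc p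
sw≡p p {x} q = trans (sym (sw-invol p x)) (trans (cong (sw p) q) (sw-p p))

sw≡suc : ∀ p {x} → sw p x ≡ suc p → x ≡ p
sw≡suc p {x} q = trans (sym (sw-invol p x)) (trans (cong (sw p) q) (sw-suc p))

sw-injective : ∀ p {x y} → sw p x ≡ sw p y → x ≡ y
sw-injective p {x} {y} q = trans (sym (sw-invol p x)) (trans (cong (sw p) q) (sw-invol p y))

-- Only the pair p, p + 1 itself is reversed. This and the next three lemmas isolate the exceptional
-- configuration of each kind of inequality; these configurations become the hypotheses of
-- `valid-swapped`, `step-target` and `step-both`.
sw-< : ∀ p {a b} → a < b → ¬ (a ≡ p × b ≡ suc p) → sw p a < sw p b
sw-< zero    {zero}        {suc zero}    l n = ⊥-elim (n (refl , refl))
sw-< zero    {zero}        {suc (suc b)} l n = s≤s (s≤s z≤n)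
sw-< zero    {suc zero}    {suc zero}    (s≤s ()) n
sw-< zero    {suc zero}    {suc (suc b)} l n = s≤s z≤n
sw-< zero    {suc (suc a)} {suc zero}    (s≤s ()) n
sw-< zero    {suc (suc a)} {suc (suc b)} l n = l
sw-< (suc p) {zero}        {suc b}       l n = s≤s z≤n
sw-< (suc p) {suc a}       {suc b} (s≤s l) n = s≤s (sw-< p l λ (u , v) → n (cong suc u , cong suc v))

sw-<ʳ : ∀ p {a b} → a < b → ¬ (a ≡ p × b ≡ suc p) → a < sw p b
sw-<ʳ zero    {zero}        {suc zero}    l n = ⊥-elim (n (refl , refl))
sw-<ʳ zero    {zero}        {suc (suc b)} l n = s≤s z≤n
sw-<ʳ zero    {suc a}       {suc zero}    (s≤s ()) n
sw-<ʳ zero    {suc a}       {suc (suc b)} l n = l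
sw-<ʳ (suc p) {zero}        {suc b}       l n = s≤s z≤n
sw-<ʳ (suc p) {suc a}       {suc b} (s≤s l) n = s≤s (sw-<ʳ p l λ (u , v) → n (cong suc u , cong suc v))

sw-≤ˡ : ∀ p {w a} → w ≤ a → ¬ (w ≡ p × a ≡ p) → sw p w ≤ a
sw-≤ˡ p {w} {a} l n = ≮⇒≥ λ q → <⇒≱ (subst (a <_) (sw-invol p w)
  (sw-<ʳ p q λ (u , v) → n (sw≡suc p v , u))) l

sw-≤ : ∀ p {w a} → w ≤ a → ¬ (w ≡ p × a ≡ suc p) → sw p w ≤ sw p a
sw-≤ p {w} {a} l n with w ≟ a
... | yes refl = ≤-refl
... | no  w≢a  = <⇒≤ (sw-< p (≤∧≢⇒< l w≢a) n)

-- Exponent vectors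

swapAt-∷ : ∀ x e p → swapAt (x ∷ e) (suc p) ≡ x ∷ swapAt e p
swapAt-∷ x []      p = refl
swapAt-∷ x (y ∷ e) p = refl

at-swapAt : ∀ p e i → suc p < length e → at (swapAt e p) i ≡ at e (sw p i)
at-swapAt zero    (x ∷ y ∷ e) zero          l = refl
at-swapAt zero    (x ∷ y ∷ e) (suc zero)    l = refl
at-swapAt zero    (x ∷ y ∷ e) (suc (suc i)) l = refl
at-swapAt (suc p) (x ∷ y ∷ e) zero          l = refl
at-swapAt (suc p) (x ∷ y ∷ e) (suc i) (s≤s l) = at-swapAt p (y ∷ e) i l
at-swapAt zero    (x ∷ [])    i       (s≤s ())
at-swapAt (suc p) (x ∷ [])    i       (s≤s ())

decAt-swapAt : ∀ p e i → suc p < length e → decAt i (swapAt e p) ≡ swapAt (decAt (sw p i) e) p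
decAt-swapAt zero    (x ∷ y ∷ e) zero          l = refl
decAt-swapAt zero    (x ∷ y ∷ e) (suc zero)    l = refl
decAt-swapAt zero    (x ∷ y ∷ e) (suc (suc i)) l = refl
decAt-swapAt (suc p) (x ∷ y ∷ e) zero          l = refl
decAt-swapAt (suc p) (x ∷ y ∷ e) (suc i) (s≤s l) = 
  trans (cong (x ∷_) (decAt-swapAt p (y ∷ e) i l)) (sym (swapAt-∷ x (decAt (sw p i) (y ∷ e)) p))
decAt-swapAt zero    (x ∷ [])    i       (s≤s ())
decAt-swapAt (suc p) (x ∷ [])    i       (s≤s ())

length-swapAt : ∀ e p → length (swapAt e p) ≡ length e
length-swapAt []          zero    = refl
length-swapAt []          (suc p) = refl
length-swapAt (x ∷ [])    zero    = refl
length-swapAt (x ∷ y ∷ e) zero    = refl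
length-swapAt (x ∷ e)     (suc p) = trans (cong length (swapAt-∷ x e p)) (cong suc (length-swapAt e p))

length-decAt : ∀ i e → length (decAt i e) ≡ length e
length-decAt zero    []      = refl
length-decAt (suc i) []      = refl
length-decAt zero    (x ∷ e) = refl
length-decAt (suc i) (x ∷ e) = cong suc (length-decAt i e)

at-decAt-≢ : ∀ i j e → i ≢ j → at (decAt i e) j ≡ at e j
at-decAt-≢ zero    j       []      n = refl
at-decAt-≢ (suc i) j       []      n = refl
at-decAt-≢ zero    zero    (x ∷ e) n = ⊥-elim (n refl)
at-decAt-≢ zero    (suc j) (x ∷ e) n = refl
at-decAt-≢ (suc i) zero    (x ∷ e) n = refl
at-decAt-≢ (suc i) (suc j) (x ∷ e) n = at-decAt-≢ i j e λ q → n (cong suc q)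

at-decAt-≡ : ∀ i e → at (decAt i e) i ≡ pred (at e i)
at-decAt-≡ zero    []          = refl
at-decAt-≡ (suc i) []          = refl
at-decAt-≡ zero    (zero ∷ e)  = refl
at-decAt-≡ zero    (suc x ∷ e) = refl
at-decAt-≡ (suc i) (x ∷ e)     = at-decAt-≡ i e

decAt-comm : ∀ i j e → decAt i (decAt j e) ≡ decAt j (decAt i e)
decAt-comm zero    zero    []      = refl
decAt-comm zero    (suc j) []      = refl
decAt-comm (suc i) zero    []      = refl
decAt-comm (suc i) (suc j) []      = refl
decAt-comm zero    zero    (x ∷ e) = refl
decAt-comm zero    (suc j) (x ∷ e) = refl
decAt-comm (suc i) zero    (x ∷ e) = refl
decAt-comm (suc i) (suc j) (x ∷ e) = cong (x ∷_) (decAt-comm i j e)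

-- Power series with coefficients in ℕ

Poly : Set
Poly = List ℕ → ℕ

infixl 6 _⊕_
_⊕_ : Poly → Poly → Poly
(f ⊕ g) e = f e + g e

guard : {A : Set} → A → A → ℕ → A
guard z v zero    = z
guard z v (suc _) = v

-- The zero of the target is a parameter: with `0` this multiplies a counting series by x_i, with
-- `[]` it acts on lists of fillings indexed by their content, so that an enumeration can follow the
-- same recursion as the count.
mulWith : {A : Set} → A → ℕ → (List ℕ → A) → List ℕ → A
mulWith z i f e = guard z (f (decAt i e)) (at e i)

mul : ℕ → Poly → Poly
mul = mulWith 0

swapped : ℕ → Poly → Poly
swapped p f e = f (swapAt e p)

guard-comm : {A : Set} (z v : A) (m n : ℕ) → guard z (guard z v m) n ≡ guard z (guard z v n) m
guard-comm z v zero    zero    = refl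
guard-comm z v zero    (suc n) = refl
guard-comm z v (suc m) zero    = refl
guard-comm z v (suc m) (suc n) = refl

mul-cong : ∀ i {f g : Poly} → f ≗ g → mul i f ≗ mul i g
mul-cong i q e = cong (λ v → guard 0 v (at e i)) (q (decAt i e))

mul-0 : ∀ i → mul i (λ _ → 0) ≗ (λ _ → 0)
mul-0 i e with at e i
... | zero  = refl
... | suc _ = refl

mul-⊕ : ∀ i f g → mul i (f ⊕ g) ≗ mul i f ⊕ mul i g
mul-⊕ i f g e with at e i
... | zero  = refl
... | suc _ = refl

mul-comm : ∀ i j f → mul i (mul j f) ≗ mul j (mul i f)
mul-comm i j f e with i ≟ j
... | yes refl = refl
... | no i≢j rewrite at-decAt-≢ i j e i≢j | at-decAt-≢ j i e (λ q → i≢j (sym q)) | decAt-comm i j e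
  = guard-comm 0 (f (decAt j (decAt i e))) (at e j) (at e i)

mul-swapped : ∀ p i f e → suc p < length e → mul i f (swapAt e p) ≡ mul (sw p i) (swapped p f) e
mul-swapped p i f e l = cong₂ (λ a b → guard 0 (f a) b) (decAt-swapAt p e i l) (at-swapAt p e i l)

m+m-injective : ∀ {m n} → m + m ≡ n + n → m ≡ n
m+m-injective {zero}  {zero}  q = refl
m+m-injective {suc m} {suc n} q rewrite +-suc m m | +-suc n n =
  cong suc (m+m-injective (suc-injective (suc-injective q)))

-- Series symmetric in two adjacent variables

Symm : ℕ → Poly → Set
Symm p f = ∀ e → suc p < length e → f (swapAt e p) ≡ f e

module _ {p : ℕ} where

  Symm-cong : ∀ {f g} → f ≗ g → Symm p f → Symm p g
  Symm-cong q s e l = trans (sym (q (swapAt e p))) (trans (s e l) (q e))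

  Symm-0 : Symm p (λ _ → 0)
  Symm-0 e l = refl

  Symm-⊕ : ∀ {f g} → Symm p f → Symm p g → Symm p (f ⊕ g)
  Symm-⊕ s t e l = cong₂ _+_ (s e l) (t e l)

  Symm-cancelʳ : ∀ {f g} → Symm p (f ⊕ g) → Symm p g → Symm p f
  Symm-cancelʳ {f} {g} s t e l = +-cancelʳ-≡ (g e) _ _
    (trans (cong (f (swapAt e p) +_) (sym (t e l))) (s e l))

  Symm-half : ∀ {f} → Symm p (f ⊕ f) → Symm p f
  Symm-half {f} s e l = m+m-injective (s e l)

  length-decAt-< : ∀ i e → suc p < length e → suc p < length (decAt i e)
  length-decAt-< i e l = subst (suc p <_) (sym (length-decAt i e)) l

  swap-mul : ∀ {f} i → Symm p f → ∀ e → suc p < length e → mul i f (swapAt e p) ≡ mul (sw p i) f e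
  swap-mul {f} i s e l = trans (mul-swapped p i f e l)
    (cong (λ v → guard 0 v (at e (sw p i))) (s (decAt (sw p i) e) (length-decAt-< (sw p i) e l)))

  Symm-X⊕Y : ∀ {f} → Symm p f → Symm p (mul p f ⊕ mul (suc p) f)
  Symm-X⊕Y {f} s e l = trans (cong₂ _+_
      (trans (swap-mul p s e l) (cong (λ j → mul j f e) (sw-p p)))
      (trans (swap-mul (suc p) s e l) (cong (λ j → mul j f e) (sw-suc p))))
    (+-comm (mul (suc p) f e) (mul p f e))

  Symm-XY : ∀ {f} → Symm p f → Symm p (mul p (mul (suc p) f))
  Symm-XY {f} s e l =
    trans (mul-swapped p p (mul (suc p) f) e l)
    (trans (cong (λ j → mul j (swapped p (mul (suc p) f)) e) (sw-p p))
    (trans (cong (λ v → guard 0 v (at e (suc p)))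
       (trans (swap-mul (suc p) s (decAt (suc p) e) (length-decAt-< (suc p) e l))
              (cong (λ j → mul j f (decAt (suc p) e)) (sw-suc p))))
     (mul-comm (suc p) p f e)))

  Symm-mul-0 : ∀ i → Symm p (mul i (λ _ → 0))
  Symm-mul-0 i = Symm-cong (λ e → sym (mul-0 i e)) Symm-0

-- Columns of height 0 carry no label; the entry of as in such a column is ignored.

mulRowWith : {A : Set} → A → ∀ {L} → Vec ℕ L → Vec ℕ L → (List ℕ → A) → List ℕ → A
mulRowWith z []           []       f = f
mulRowWith z (zero ∷ hs)  (a ∷ as) f = mulRowWith z hs as f
mulRowWith z (suc h ∷ hs) (a ∷ as) f = mulWith z a (mulRowWith z hs as f)

mulRow : ∀ {L} → Vec ℕ L → Vec ℕ L → Poly → Poly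
mulRow = mulRowWith 0

-- Entries in columns of height 0 are left alone: `Σbox` fixes them to 0, and the exchange has to
-- permute the rows over which it sums.
act₁ : ℕ → ℕ → ℕ → ℕ
act₁ p zero    a = a
act₁ p (suc h) a = sw p a

act : ∀ {L} → ℕ → Vec ℕ L → Vec ℕ L → Vec ℕ L
act p = zipWith (act₁ p)

Alive : ∀ {L} → Vec ℕ L → Fin L → Set
Alive hs c = 1 ≤ lookup hs c

lookup-act : ∀ {L} p (hs as : Vec ℕ L) c → Alive hs c → lookup (act p hs as) c ≡ sw p (lookup as c)
lookup-act p hs as c al rewrite lookup-zipWith (act₁ p) c hs as with lookup hs c | al
... | suc h | _ = refl

act-p : ∀ {L} p (hs as : Vec ℕ L) {c} → Alive hs c → lookup as c ≡ p → lookup (act p hs as) c ≡ suc p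
act-p p hs as al q = trans (lookup-act p hs as _ al) (trans (cong (sw p) q) (sw-p p))

act-suc : ∀ {L} p (hs as : Vec ℕ L) {c} → Alive hs c → lookup as c ≡ suc p → lookup (act p hs as) c ≡ p
act-suc p hs as al q = trans (lookup-act p hs as _ al) (trans (cong (sw p) q) (sw-suc p))

act-invol : ∀ {L} p (hs as : Vec ℕ L) → act p hs (act p hs as) ≡ as
act-invol p []           []       = refl
act-invol p (zero ∷ hs)  (a ∷ as) = cong (a ∷_) (act-invol p hs as)
act-invol p (suc h ∷ hs) (a ∷ as) = cong₂ _∷_ (sw-invol p a) (act-invol p hs as)

act-id : ∀ {L} p (hs as : Vec ℕ L) →
  (∀ c → Alive hs c → lookup as c ≢ p × lookup as c ≢ suc p) → act p hs as ≡ as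
act-id p []           []       n = refl
act-id p (zero ∷ hs)  (a ∷ as) n = cong (a ∷_) (act-id p hs as λ c → n (suc c))
act-id p (suc h ∷ hs) (a ∷ as) n =
  cong₂ _∷_ (sw-other p (proj₁ (n zero (s≤s z≤n))) (proj₂ (n zero (s≤s z≤n)))) (act-id p hs as λ c → n (suc c))

mulRow-cong : ∀ {L} (hs as : Vec ℕ L) {f g} → f ≗ g → mulRow hs as f ≗ mulRow hs as g
mulRow-cong []           []       q = q
mulRow-cong (zero ∷ hs)  (a ∷ as) q = mulRow-cong hs as q
mulRow-cong (suc h ∷ hs) (a ∷ as) q = mul-cong a (mulRow-cong hs as q)

mulRow-⊕ : ∀ {L} (hs as : Vec ℕ L) f g → mulRow hs as (f ⊕ g) ≗ mulRow hs as f ⊕ mulRow hs as g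
mulRow-⊕ []           []       f g e = refl
mulRow-⊕ (zero ∷ hs)  (a ∷ as) f g e = mulRow-⊕ hs as f g e
mulRow-⊕ (suc h ∷ hs) (a ∷ as) f g e =
  trans (mul-cong a (mulRow-⊕ hs as f g) e) (mul-⊕ a (mulRow hs as f) (mulRow hs as g) e)

mulRow-mul : ∀ {L} (hs as : Vec ℕ L) i f → mulRow hs as (mul i f) ≗ mul i (mulRow hs as f)
mulRow-mul []           []       i f e = refl
mulRow-mul (zero ∷ hs)  (a ∷ as) i f e = mulRow-mul hs as i f e
mulRow-mul (suc h ∷ hs) (a ∷ as) i f e =
  trans (mul-cong a (mulRow-mul hs as i f) e) (mul-comm a i (mulRow hs as f) e)

mulRow-pull : ∀ {L} (hs as : Vec ℕ L) c f → Alive hs c →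
  mulRow hs as f ≗ mul (lookup as c) (mulRow (hs [ c ]≔ 0) as f)
mulRow-pull (suc h ∷ hs) (a ∷ as) zero    f al e = refl
mulRow-pull (zero ∷ hs)  (a ∷ as) (suc c) f al e = mulRow-pull hs as c f al e
mulRow-pull (suc h ∷ hs) (a ∷ as) (suc c) f al e =
  trans (mul-cong a (mulRow-pull hs as c f al) e) (mul-comm a (lookup as c) (mulRow (hs [ c ]≔ 0) as f) e)

mulRow-swapped : ∀ {L} p (hs as : Vec ℕ L) f e → suc p < length e →
  mulRow hs as f (swapAt e p) ≡ mulRow hs (act p hs as) (swapped p f) e
mulRow-swapped p []           []       f e l = refl
mulRow-swapped p (zero ∷ hs)  (a ∷ as) f e l = mulRow-swapped p hs as f e l
mulRow-swapped p (suc h ∷ hs) (a ∷ as) f e l = trans (mul-swapped p a (mulRow hs as f) e l)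
  (cong (λ v → guard 0 v (at e (sw p a)))
    (mulRow-swapped p hs as f (decAt (sw p a) e) (length-decAt-< {p} (sw p a) e l)))

-- Symmetry, and later the evaluation of sorted compositions, is known only for exponent vectors of
-- suitable length. Hence a congruence relative to a property that survives lowering an exponent.
mulRow-cong-on : (P : List ℕ → Set) → (∀ i e → P e → P (decAt i e)) → ∀ {L} (hs as : Vec ℕ L) {f g : Poly} →
  (∀ e → P e → f e ≡ g e) → ∀ e → P e → mulRow hs as f e ≡ mulRow hs as g e
mulRow-cong-on P dec []           []       h e l = h e l
mulRow-cong-on P dec (zero ∷ hs)  (a ∷ as) h e l = mulRow-cong-on P dec hs as h e l
mulRow-cong-on P dec (suc _ ∷ hs) (a ∷ as) h e l = cong (λ v → guard 0 v (at e a))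
  (mulRow-cong-on P dec hs as h (decAt a e) (dec a e l))

Symm-mulRow : ∀ {L} p (hs as : Vec ℕ L) {f} →
  (∀ c → Alive hs c → lookup as c ≢ p × lookup as c ≢ suc p) → Symm p f → Symm p (mulRow hs as f)
Symm-mulRow p hs as {f} n s e l = trans (mulRow-swapped p hs as f e l)
  (trans (cong (λ v → mulRow hs v (swapped p f) e) (act-id p hs as n))
         (mulRow-cong-on (λ e → suc p < length e) (length-decAt-< {p}) hs as s e l))

-- Sums over rows of labels

Σ< : ℕ → (ℕ → ℕ) → ℕ
Σ< zero    F = 0
Σ< (suc N) F = Σ< N F + F N

Σ<-cong : ∀ N {F H : ℕ → ℕ} → (∀ a → F a ≡ H a) → Σ< N F ≡ Σ< N H
Σ<-cong zero    q = refl
Σ<-cong (suc N) q = cong₂ _+_ (Σ<-cong N q) (q N)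

Σ<-cong-< : ∀ N {F H : ℕ → ℕ} → (∀ a → a < N → F a ≡ H a) → Σ< N F ≡ Σ< N H
Σ<-cong-< zero    q = refl
Σ<-cong-< (suc N) q = cong₂ _+_ (Σ<-cong-< N λ a l → q a (m<n⇒m<1+n l)) (q N ≤-refl)

Σ<-0 : ∀ N → Σ< N (λ _ → 0) ≡ 0
Σ<-0 zero    = refl
Σ<-0 (suc N) = trans (+-identityʳ _) (Σ<-0 N)

Σ<-+ : ∀ N F H → Σ< N (λ a → F a + H a) ≡ Σ< N F + Σ< N H
Σ<-+ zero    F H = refl
Σ<-+ (suc N) F H = trans (cong (_+ (F N + H N)) (Σ<-+ N F H)) (interchange (Σ< N F) (Σ< N H) (F N) (H N))

Σ<-swap : ∀ p N F → suc p < N → Σ< N (λ a → F (sw p a)) ≡ Σ< N F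
Σ<-swap p (suc N) F (s≤s l) with suc p ≟ N
... | yes refl = trans
  (cong₂ _+_ (cong₂ _+_ (Σ<-cong-< p λ a a<p → cong F (sw-other p (<⇒≢ a<p) (<⇒≢ (m<n⇒m<1+n a<p))))
                        (cong F (sw-p p))) (cong F (sw-suc p)))
  (trans (+-assoc (Σ< p F) _ _) (trans (cong (Σ< p F +_) (+-comm (F (suc p)) (F p))) (sym (+-assoc (Σ< p F) _ _))))
... | no ne = cong₂ _+_ (Σ<-swap p N F (≤∧≢⇒< l ne))
  (cong F (sw-other p (λ { refl → <⇒≱ l ≤-refl }) (λ q → ne (sym q))))

-- The fixed entry 0 in columns of height 0 makes every row occur exactly once.
Σbox : ∀ {L} → ℕ → Vec ℕ L → (Vec ℕ L → ℕ) → ℕ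
Σbox N []           F = F []
Σbox N (zero ∷ hs)  F = Σbox N hs (λ ws → F (0 ∷ ws))
Σbox N (suc h ∷ hs) F = Σ< N (λ a → Σbox N hs (λ ws → F (a ∷ ws)))

Σbox-cong : ∀ {L} N (hs : Vec ℕ L) {F H : Vec ℕ L → ℕ} → (∀ ws → F ws ≡ H ws) → Σbox N hs F ≡ Σbox N hs H
Σbox-cong N []           q = q []
Σbox-cong N (zero ∷ hs)  q = Σbox-cong N hs (λ ws → q (0 ∷ ws))
Σbox-cong N (suc h ∷ hs) q = Σ<-cong N (λ a → Σbox-cong N hs (λ ws → q (a ∷ ws)))

Σbox-0 : ∀ {L} N (hs : Vec ℕ L) → Σbox N hs (λ _ → 0) ≡ 0
Σbox-0 N []           = refl
Σbox-0 N (zero ∷ hs)  = Σbox-0 N hs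
Σbox-0 N (suc h ∷ hs) = trans (Σ<-cong N λ a → Σbox-0 N hs) (Σ<-0 N)

Σbox-+ : ∀ {L} N (hs : Vec ℕ L) F H → Σbox N hs (λ w → F w + H w) ≡ Σbox N hs F + Σbox N hs H
Σbox-+ N []           F H = refl
Σbox-+ N (zero ∷ hs)  F H = Σbox-+ N hs _ _
Σbox-+ N (suc h ∷ hs) F H = trans (Σ<-cong N λ a → Σbox-+ N hs _ _) (Σ<-+ N _ _)

Σbox-act : ∀ {L} p N (hs : Vec ℕ L) F → suc p < N → Σbox N hs (λ ws → F (act p hs ws)) ≡ Σbox N hs F
Σbox-act p N []           F l = refl
Σbox-act p N (zero ∷ hs)  F l = Σbox-act p N hs (λ ws → F (0 ∷ ws)) l
Σbox-act p N (suc h ∷ hs) F l = trans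
  (Σ<-cong N λ a → Σbox-act p N hs (λ ws → F (sw p a ∷ ws)) l)
  (Σ<-swap p N (λ a → Σbox N hs (λ ws → F (a ∷ ws))) l)

ΣPoly : ∀ {L} → ℕ → Vec ℕ L → (Vec ℕ L → Poly) → Poly
ΣPoly N hs F e = Σbox N hs (λ ws → F ws e)

mul-Σ : ∀ {L} N (hs : Vec ℕ L) i F → mul i (ΣPoly N hs F) ≗ ΣPoly N hs (λ ws → mul i (F ws))
mul-Σ N hs i F e with at e i
... | zero  = sym (Σbox-0 N hs)
... | suc _ = refl

Symm-Σ : ∀ {L} p N (hs : Vec ℕ L) F → (∀ ws → Symm p (F ws)) → Symm p (ΣPoly N hs F)
Symm-Σ p N hs F s e l = Σbox-cong N hs λ ws → s ws e l

-- Exchanging p and p + 1 permutes the rows, so the sum over all w of F w + F (s w) is twice the sum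
-- of F, and 2 can be cancelled.
Symm-Σ-orbits : ∀ {L} p N (hs : Vec ℕ L) F → suc p < N →
  (∀ ws → Symm p (F ws ⊕ F (act p hs ws))) → Symm p (ΣPoly N hs F)
Symm-Σ-orbits p N hs F l s = Symm-half (Symm-cong
  (λ e → trans (Σbox-+ N hs _ _) (cong (Σbox N hs (λ ws → F ws e) +_) (Σbox-act p N hs (λ ws → F ws e) l)))
  (Symm-Σ p N hs _ s))

-- Columns of height at least k are the ones that carry a label in the row considered:
-- k = 1 for the source row of a step, k = 2 for its target row.

ValidF : ∀ {L} → ℕ → (Fin L → ℕ) → (Fin L → ℕ) → Set
ValidF k h a = ∀ c d → c Fin.< d → k ≤ h c → k ≤ h d → a c ≢ a d × (h c ≤ h d → a c < a d)

StepF : ∀ {L} → (Fin L → ℕ) → (Fin L → ℕ) → (Fin L → ℕ) → Set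
StepF h a w = (∀ c → 2 ≤ h c → w c ≤ a c)
  × (∀ c d → c Fin.< d → 1 ≤ h d → h d < h c → a d < a c → a d < w c)

valid-distinct : ∀ {L k} {h a : Fin L → ℕ} → ValidF k h a → ∀ {c d} → k ≤ h c → k ≤ h d → a c ≡ a d → c ≡ d
valid-distinct V {c} {d} kc kd q with Finₚ.<-cmp c d
... | tri< c<d _ _ = ⊥-elim (proj₁ (V c d c<d kc kd) q)
... | tri≈ _ e _ = e
... | tri> _ _ d<c = ⊥-elim (proj₁ (V d c d<c kd kc) (sym q))

-- Validity and steps under the exchange of two adjacent labels

Swapped : ∀ {L} → ℕ → ℕ → (Fin L → ℕ) → (Fin L → ℕ) → (Fin L → ℕ) → Set
Swapped p k h a b = ∀ c → k ≤ h c → b c ≡ sw p (a c)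

swapped-sym : ∀ {L p k} {h a b : Fin L → ℕ} → Swapped p k h a b → Swapped p k h b a
swapped-sym {p = p} s c al = trans (sym (sw-invol p _)) (cong (sw p) (sym (s c al)))

swapped-p : ∀ {L p k} {h a b : Fin L → ℕ} → Swapped p k h a b → ∀ {c} → k ≤ h c → a c ≡ p → b c ≡ suc p
swapped-p {p = p} s al q = trans (s _ al) (trans (cong (sw p) q) (sw-p p))

swapped-suc : ∀ {L p k} {h a b : Fin L → ℕ} → Swapped p k h a b → ∀ {c} → k ≤ h c → a c ≡ suc p → b c ≡ p
swapped-suc {p = p} s al q = trans (s _ al) (trans (cong (sw p) q) (sw-suc p))

-- By `sw-<` a required inequality is lost only where p stands left of p + 1 in a column that is not
-- taller; the last hypothesis excludes this.
valid-swapped : ∀ {L p k} {h a b : Fin L → ℕ} → Swapped p k h a b → ValidF k h a →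
  (∀ c d → c Fin.< d → k ≤ h c → k ≤ h d → h c ≤ h d → a c ≡ p → a d ≡ suc p → ⊥) → ValidF k h b
valid-swapped {p = p} s V n c d c<d kc kd rewrite s c kc | s d kd =
  (λ q → proj₁ (V c d c<d kc kd) (sw-injective p q)) ,
  (λ le → sw-< p (proj₂ (V c d c<d kc kd) le) λ (u , v) → n c d c<d kc kd le u v)

-- With the lower row fixed, the exchange falsifies an inequality in two situations only: a p
-- directly above p becomes p + 1, or a p + 1 that just clears p becomes p.
step-target : ∀ {L p} {h a w v : Fin L → ℕ} → Swapped p 2 h w v → StepF h a w →
  (∀ c → 2 ≤ h c → w c ≡ p → a c ≡ p → ⊥) →
  (∀ c d → c Fin.< d → 1 ≤ h d → h d < h c → a d < a c → a d ≡ p → w c ≡ suc p → ⊥) →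
  StepF h a v
step-target {p = p} {a = a} {v = v} s (S₁ , S₂) n₁ n₂ =
  (λ c kc → subst (_≤ a c) (sym (s c kc)) (sw-≤ˡ p (S₁ c kc) λ (u , v) → n₁ c kc u v)) ,
  (λ c d c<d kd hd<hc q → subst (a d <_) (sym (s c (≤-trans (s≤s kd) hd<hc)))
     (sw-<ʳ p (S₂ c d c<d kd hd<hc q) λ (u , v) → n₂ c d c<d kd hd<hc q u v))

-- The first and third hypotheses exclude the inequalities between p and p + 1 that would be
-- reversed. The second supplies the inequality for pairs of columns on which the passing condition
-- is vacuous before the exchange and becomes active by it.
step-both : ∀ {L p} {h a b w v : Fin L → ℕ} → Swapped p 1 h a b → Swapped p 2 h w v → StepF h a w →
  (∀ c → 2 ≤ h c → w c ≡ p → a c ≡ suc p → ⊥) →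
  (∀ c d → c Fin.< d → 1 ≤ h d → h d < h c → a d ≡ suc p → a c ≡ p → b d < v c) →
  (∀ c d → c Fin.< d → 1 ≤ h d → h d < h c → a d < a c → b d < b c → a d ≡ p → w c ≡ suc p → ⊥) →
  StepF h b v
step-both {p = p} {h} {a} {b} {w} {v} sa sb (S₁ , S₂) n₁ n₂ n₃ =
  (λ c kc → subst₂ _≤_ (sym (sb c kc)) (sym (sa c (<⇒≤ kc))) (sw-≤ p (S₁ c kc) λ (u , v) → n₁ c kc u v)) ,
  second
  where
  second : ∀ c d → c Fin.< d → 1 ≤ h d → h d < h c → b d < b c → b d < v c
  second c d c<d kd hd<hc q with (a d ≟ suc p) ×-dec (a c ≟ p)
  ... | yes (u , v) = n₂ c d c<d kd hd<hc u v
  ... | no n = subst₂ _<_ (sym (sa d kd)) (sym (sb c (≤-trans (s≤s kd) hd<hc)))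
      (sw-< p (S₂ c d c<d kd hd<hc lt) λ (x , y) → n₃ c d c<d kd hd<hc lt q x y)
    where
    kc : 1 ≤ h c
    kc = ≤-trans kd (<⇒≤ hd<hc)
    lt : a d < a c
    lt = subst₂ _<_ (sym (swapped-sym {h = h} sa d kd)) (sym (swapped-sym {h = h} sa c kc))
      (sw-< p q λ (x , y) → n (sw≡p p (trans (sym (sa d kd)) x) , sw≡suc p (trans (sym (sa c kc)) y)))

-- Over such a row the series F below is x_{p+1} times a series symmetric in x_p and x_{p+1}.
Dominant : ∀ {L} → ℕ → ℕ → (Fin L → ℕ) → (Fin L → ℕ) → Fin L → Set
Dominant p k h a c = k ≤ h c × a c ≡ suc p × (∀ d → k ≤ h d → a d ≡ p → c Fin.< d × h d < h c)

>p : ∀ {p w a} → w ≤ a → w ≡ p → a ≢ p → a ≢ suc p → suc p < a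
>p w≤a refl n m = ≤∧≢⇒< (≤∧≢⇒< w≤a (λ q → n (sym q))) (λ q → m (sym q))

-- Suppose that e carries p in the upper row. If it carried p below, the dominance below applies.
-- Otherwise its lower label exceeds p + 1. Left of c this contradicts the order of the lower row
-- or, if e is taller than c, the rule that e stays beyond p + 1; right of c the order of the upper
-- row forces e to be shorter.
dominant-step : ∀ {L p} {h a w : Fin L → ℕ} {c} → ValidF 1 h a → Dominant p 1 h a c → StepF h a w →
  ValidF 2 h w → 2 ≤ h c → w c ≡ suc p → Dominant p 2 h w c
dominant-step {p = p} {h} {a} {w} {c} V (kc , ac , dom) (S₁ , S₂) V′ kc′ wc = kc′ , wc , go
  where
  go : ∀ e → 2 ≤ h e → w e ≡ p → c Fin.< e × h e < h c
  go e ke we with a e ≟ p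
  ... | yes ae = dom e (<⇒≤ ke) ae
  ... | no ae≢ with Finₚ.<-cmp c e
  ...   | tri≈ _ refl _ = ⊥-elim (1+n≢n (trans (sym wc) we))
  ...   | tri< c<e _ _ = c<e , ≰⇒> λ le → <-asym (subst₂ _<_ wc we (proj₂ (V′ c e c<e kc′ ke) le)) ≤-refl
  ...   | tri> _ _ e<c with h e ≤? h c
  ...     | yes le = ⊥-elim (<-asym (subst (a e <_) ac (proj₂ (V e c e<c (<⇒≤ ke) kc) le)) lt)
    where
    lt : suc p < a e
    lt = >p (S₁ e ke) we ae≢ (λ q → proj₁ (V e c e<c (<⇒≤ ke) kc) (trans q (sym ac)))
  ...     | no nle = ⊥-elim (<-asym (subst₂ _<_ ac we (S₂ e c e<c kc (≰⇒> nle) (subst (_< a e) (sym ac) lt))) ≤-refl)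
    where
    lt : suc p < a e
    lt = >p (S₁ e ke) we ae≢ (λ q → proj₁ (V e c e<c (<⇒≤ ke) kc) (trans q (sym ac)))

-- The column `c₀` acts as a barrier. A column left of it carrying p in the upper row would break
-- the order of the lower row or, if taller than `c₀`, fail to stay beyond p. A column right of it
-- is also right of c, and the order of the upper row makes it shorter than c.
blocked-dominant : ∀ {L p} {h a w : Fin L → ℕ} {c₀ c} → ValidF 1 h a → StepF h a w → ValidF 2 h w →
  1 ≤ h c₀ → a c₀ ≡ p → c Fin.< c₀ → h c₀ < h c → w c ≡ suc p → Dominant p 2 h w c
blocked-dominant {p = p} {h} {a} {w} {c₀} {c} V (S₁ , S₂) V′ k₀ ac₀ c<c₀ lt wc = kc , wc , go
  where
  kc : 2 ≤ h c
  kc = ≤-trans (s≤s k₀) lt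
  go : ∀ e → 2 ≤ h e → w e ≡ p → c Fin.< e × h e < h c
  go e ke we with Finₚ.<-cmp e c₀
  ... | tri≈ _ refl _ = c<c₀ , lt
  ... | tri> _ _ c₀<e = c<e , ≰⇒> λ le → <-asym (subst₂ _<_ wc we (proj₂ (V′ c e c<e kc ke) le)) ≤-refl
    where
    c<e : c Fin.< e
    c<e = Finₚ.<-trans c<c₀ c₀<e
  ... | tri< e<c₀ _ _ with h e ≤? h c₀
  ...   | yes le = ⊥-elim (<⇒≱ (subst (a e <_) ac₀ (proj₂ (V e c₀ e<c₀ (<⇒≤ ke) k₀) le)) (subst (_≤ a e) we (S₁ e ke)))
  ...   | no nle = ⊥-elim (<-irrefl (sym we) (subst (_< w e) ac₀ (S₂ e c₀ e<c₀ k₀ (≰⇒> nle) lt′)))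
    where
    lt′ : a c₀ < a e
    lt′ = ≤∧≢⇒< (subst (_≤ a e) (trans we (sym ac₀)) (S₁ e ke)) λ q → proj₁ (V e c₀ e<c₀ (<⇒≤ ke) k₀) (sym q)

-- Generating series of fillings, built row by row

Valid : ∀ {L} → Vec ℕ L → Vec ℕ L → Set
Valid hs as = ValidF 1 (lookup hs) (lookup as)

Step : ∀ {L} → Vec ℕ L → Vec ℕ L → Vec ℕ L → Set
Step hs as ws = StepF (lookup hs) (lookup as) (lookup ws)

abstract
  valid? : ∀ {L} (hs as : Vec ℕ L) → Dec (Valid hs as)
  valid? hs as = Finₚ.all? λ c → Finₚ.all? λ d →
    (c Finₚ.<? d) →-dec (1 ≤? lookup hs c) →-dec (1 ≤? lookup hs d) →-dec
    (¬? (lookup as c ≟ lookup as d) ×-dec ((lookup hs c ≤? lookup hs d) →-dec (lookup as c <? lookup as d)))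

  step? : ∀ {L} (hs as ws : Vec ℕ L) → Dec (Step hs as ws)
  step? hs as ws =
    (Finₚ.all? λ c → (2 ≤? lookup hs c) →-dec (lookup ws c ≤? lookup as c)) ×-dec
    (Finₚ.all? λ c → Finₚ.all? λ d → (c Finₚ.<? d) →-dec (1 ≤? lookup hs d) →-dec
      (lookup hs d <? lookup hs c) →-dec (lookup as d <? lookup as c) →-dec (lookup as d <? lookup ws c))

onlyIf : {A P : Set} → A → Dec P → A → A
onlyIf z (yes _) v = v
onlyIf z (no _)  v = z

χ : {P : Set} → Dec P → Poly → Poly
χ = onlyIf (λ _ → 0)

χ-yes : {P : Set} (d : Dec P) {f : Poly} → P → χ d f ≡ f
χ-yes (yes _) _ = refl
χ-yes (no ¬p) p = ⊥-elim (¬p p)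

χ-no : {P : Set} (d : Dec P) {f : Poly} → ¬ P → χ d f ≡ (λ _ → 0)
χ-no (yes p) ¬p = ⊥-elim (¬p p)
χ-no (no _) _ = refl

χ-cong : {P Q : Set} (d : Dec P) (d′ : Dec Q) {f : Poly} → (P → Q) → (Q → P) → χ d f ≡ χ d′ f
χ-cong (yes p) d′ pq qp = sym (χ-yes d′ (pq p))
χ-cong (no ¬p) d′ pq qp = sym (χ-no d′ λ q → ¬p (qp q))

Symm-χ : ∀ {p} {P : Set} (d : Dec P) {f} → Symm p f → Symm p (χ d f)
Symm-χ (yes _) s = s
Symm-χ (no _) s = λ _ _ → refl

-- The constant series 1, in any number of variables.
δ₀ : Poly
δ₀ []          = 1
δ₀ (zero ∷ e)  = δ₀ e
δ₀ (suc _ ∷ e) = 0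

Symm-δ₀ : ∀ p → Symm p δ₀
Symm-δ₀ zero    (zero ∷ zero ∷ e)   l = refl
Symm-δ₀ zero    (zero ∷ suc y ∷ e)  l = refl
Symm-δ₀ zero    (suc x ∷ zero ∷ e)  l = refl
Symm-δ₀ zero    (suc x ∷ suc y ∷ e) l = refl
Symm-δ₀ zero    (x ∷ [])            (s≤s ())
Symm-δ₀ (suc p) (zero ∷ e) (s≤s l) = trans (cong δ₀ (swapAt-∷ zero e p)) (Symm-δ₀ p e l)
Symm-δ₀ (suc p) (suc x ∷ e) (s≤s l) = cong δ₀ (swapAt-∷ (suc x) e p)

Bounded : ∀ {L} → ℕ → Vec ℕ L → Set
Bounded k hs = ∀ c → lookup hs c ≤ k

lower : ∀ {L} → Vec ℕ L → Vec ℕ L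
lower = map pred

-- G N k hs as counts, by content, the fillings with labels below N of the columns hs over the
-- basement as, when hs is bounded by k. The basement box counts in the height, so that height 1 is
-- an empty column and height 0 is no column. F N k hs as counts the labels of the basement, too.
G F : ∀ {L} → ℕ → ℕ → Vec ℕ L → Vec ℕ L → Poly
F N k hs as = mulRow hs as (G N k hs as)
G N zero    hs as = χ (valid? hs as) δ₀
G N (suc k) hs as = χ (valid? hs as) (ΣPoly N (lower hs) (λ ws → χ (step? hs as ws) (F N k (lower hs) ws)))

mulRow-0 : ∀ {L} (hs as : Vec ℕ L) → mulRow hs as (λ _ → 0) ≗ (λ _ → 0)
mulRow-0 []           []       e = refl
mulRow-0 (zero ∷ hs)  (a ∷ as) e = mulRow-0 hs as e
mulRow-0 (suc h ∷ hs) (a ∷ as) e = trans (mul-cong a (mulRow-0 hs as) e) (mul-0 a e)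

G-invalid : ∀ {L} N k {hs as : Vec ℕ L} → ¬ Valid hs as → G N k hs as ≡ (λ _ → 0)
G-invalid N zero    {hs} {as} n = χ-no (valid? hs as) n
G-invalid N (suc k) {hs} {as} n = χ-no (valid? hs as) n

F-invalid : ∀ {L} N k (hs as : Vec ℕ L) → ¬ Valid hs as → F N k hs as ≗ (λ _ → 0)
F-invalid N k hs as n e = trans (cong (λ f → mulRow hs as f e) (G-invalid N k n)) (mulRow-0 hs as e)

mulRow-labels : ∀ {L} (hs as bs : Vec ℕ L) f → (∀ c → Alive hs c → lookup as c ≡ lookup bs c) →
  mulRow hs as f ≗ mulRow hs bs f
mulRow-labels []           []       []       f q e = refl
mulRow-labels (zero ∷ hs)  (a ∷ as) (b ∷ bs) f q e = mulRow-labels hs as bs f (λ c → q (suc c)) e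
mulRow-labels (suc h ∷ hs) (a ∷ as) (b ∷ bs) f q e rewrite q zero (s≤s z≤n) =
  mul-cong b (mulRow-labels hs as bs f (λ c → q (suc c))) e

alive-erase : ∀ {L} (hs : Vec ℕ L) {c d} → Alive (hs [ c ]≔ 0) d → d ≢ c × Alive hs d
alive-erase hs {c} {d} al = d≢c , subst (1 ≤_) (lookup∘update′ d≢c hs 0) al
  where
  d≢c : d ≢ c
  d≢c refl = <⇒≢ al (sym (lookup∘update c hs 0))

lower-bounded : ∀ {L k} {hs : Vec ℕ L} → Bounded (suc k) hs → Bounded k (lower hs)
lower-bounded {hs = hs} fuel c rewrite lookup-map c pred hs = pred-mono-≤ (fuel c)

alive-lower : ∀ {L} {hs : Vec ℕ L} {c} → 2 ≤ lookup hs c → Alive (lower hs) c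
alive-lower {hs = hs} {c} k rewrite lookup-map c pred hs = pred-mono-≤ k

alive-lower⁻ : ∀ {L} {hs : Vec ℕ L} {c} → Alive (lower hs) c → 2 ≤ lookup hs c
alive-lower⁻ {hs = hs} {c} k rewrite lookup-map c pred hs with lookup hs c | k
... | suc h | k′ = s≤s k′

lower-≤ : ∀ {L} {hs : Vec ℕ L} {c d} → lookup hs c ≤ lookup hs d → lookup (lower hs) c ≤ lookup (lower hs) d
lower-≤ {hs = hs} {c} {d} q rewrite lookup-map c pred hs | lookup-map d pred hs = pred-mono-≤ q

lower-< : ∀ {L} {hs : Vec ℕ L} {c d} → Alive hs d → lookup hs d < lookup hs c → lookup (lower hs) d < lookup (lower hs) c
lower-< {hs = hs} {c} {d} al q rewrite lookup-map c pred hs | lookup-map d pred hs with lookup hs d | al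
... | suc _ | _ = pred-mono-≤ q

valid-lower : ∀ {L} {hs ws : Vec ℕ L} → Valid (lower hs) ws → ValidF 2 (lookup hs) (lookup ws)
valid-lower {hs = hs} V c d c<d kc kd with V c d c<d (alive-lower {hs = hs} kc) (alive-lower {hs = hs} kd)
... | n , m = n , λ le → m (lower-≤ {hs = hs} le)

Dom : ∀ {L} → ℕ → Vec ℕ L → Vec ℕ L → Fin L → Set
Dom p hs as = Dominant p 1 (lookup hs) (lookup as)

Absent : ∀ {L} → Vec ℕ L → Vec ℕ L → ℕ → Set
Absent hs as q = ∀ c → Alive hs c → lookup as c ≢ q

module _ {p : ℕ} {L : ℕ} where

  act-swapped : ∀ (hs as : Vec ℕ L) → Swapped p 1 (lookup hs) (lookup as) (lookup (act p hs as))
  act-swapped hs as c al = lookup-act p hs as c al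

  act-swapped′ : ∀ (hs ws : Vec ℕ L) → Swapped p 2 (lookup hs) (lookup ws) (lookup (act p (lower hs) ws))
  act-swapped′ hs ws c k = lookup-act p (lower hs) ws c (alive-lower {hs = hs} k)

  dom-lower : ∀ {hs ws : Vec ℕ L} {c} → Dominant p 2 (lookup hs) (lookup ws) c → Dom p (lower hs) ws c
  dom-lower {hs} (kc , wc , dom) = alive-lower {hs = hs} kc , wc , λ d al q →
    let c<d , lt = dom d (alive-lower⁻ {hs = hs} al) q in c<d , lower-< {hs = hs} (<⇒≤ (alive-lower⁻ {hs = hs} al)) lt

-- From the symmetries of G to those of F

module _ (p N : ℕ) {L : ℕ} where

  -- If x_p f is symmetric, it is divisible by x_{p+1} as well as by x_p, so f is x_{p+1} times a
  -- symmetric series. The form with x_p f avoids the division.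
  OrbitSymmetric DominantSymmetric : ℕ → Set
  OrbitSymmetric k = ∀ (hs as : Vec ℕ L) → Bounded k hs → Symm p (F N k hs as ⊕ F N k hs (act p hs as))
  DominantSymmetric k = ∀ (hs as : Vec ℕ L) c → Bounded k hs → Dom p hs as c → Symm p (mul p (F N k hs as))

  -- What the two statements on F require of G, sorted by the positions of p and p + 1 in the row.
  -- In `single` the monomials of the two rows differ by x_p against x_{p+1}; in `ordered` the
  -- exchanged row is invalid and contributes nothing; in `crossing` both rows are valid; in
  -- `crossed` the monomial of a dominant row contains the symmetric factor x_p x_{p+1} and one more
  -- factor x_p remains. `absent` serves both statements.
  record GSymmetries (k : ℕ) : Set where
    field
      absent : ∀ (hs as : Vec ℕ L) → Bounded k hs → Absent hs as p → Symm p (G N k hs as)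
      single : ∀ (hs as : Vec ℕ L) c → Valid hs as → Bounded k hs → Alive hs c → lookup as c ≡ p →
        Absent hs as (suc p) → Symm p (mul p (G N k hs as) ⊕ mul (suc p) (G N k hs (act p hs as)))
      ordered : ∀ (hs as : Vec ℕ L) c d → Valid hs as → Bounded k hs → Alive hs c → Alive hs d →
        lookup as c ≡ p → lookup as d ≡ suc p → c Fin.< d → lookup hs c ≤ lookup hs d → Symm p (G N k hs as)
      crossing : ∀ (hs as : Vec ℕ L) c d → Valid hs as → Bounded k hs → Alive hs c → Alive hs d →
        lookup as c ≡ p → lookup as d ≡ suc p → c Fin.< d → lookup hs d < lookup hs c →
        Symm p (G N k hs as ⊕ G N k hs (act p hs as))
      crossed : ∀ (hs as : Vec ℕ L) c d → Valid hs as → Bounded k hs → Dom p hs as c → Alive hs d →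
        lookup as d ≡ p → Symm p (mul p (G N k hs as))

  module _ (k : ℕ) (P : GSymmetries k) where
    open GSymmetries P

    act-valid : ∀ (hs as : Vec ℕ L) → Valid hs as →
      (∀ c d → c Fin.< d → Alive hs c → Alive hs d → lookup hs c ≤ lookup hs d →
        lookup as c ≡ p → lookup as d ≡ suc p → ⊥) → Valid hs (act p hs as)
    act-valid hs as = valid-swapped {h = lookup hs} (act-swapped hs as)

    rest-away : ∀ {hs as : Vec ℕ L} {c} → Valid hs as → Alive hs c → ∀ d → Alive (hs [ c ]≔ 0) d →
      lookup as d ≢ lookup as c
    rest-away {hs} {as} {c} V al d al′ q with alive-erase hs {c} {d} al′
    ... | d≢c , al″ = d≢c (valid-distinct {h = lookup hs} V al″ al q)

    zero-⊕ : ∀ (hs as bs : Vec ℕ L) → ¬ Valid hs as → ¬ Valid hs bs → Symm p (F N k hs as ⊕ F N k hs bs)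
    zero-⊕ hs as bs n m = Symm-cong (λ e → sym (cong₂ _+_ (F-invalid N k hs as n e) (F-invalid N k hs bs m e))) Symm-0

    orbit-symmetric-single : ∀ (hs as : Vec ℕ L) c → Bounded k hs → Alive hs c → lookup as c ≡ p →
        Absent hs as (suc p) → Symm p (F N k hs as ⊕ F N k hs (act p hs as))
    orbit-symmetric-single hs as c fuel al ac abs with valid? hs as
    -- Were the exchanged row valid, exchanging back would make the row itself valid; so both terms
    -- vanish.
    ... | no n = zero-⊕ hs as (act p hs as) n λ V → n (subst (Valid hs) (act-invol p hs as) (act-valid hs (act p hs as) V λ x y x<y alx aly le qx qy →
            abs x alx (sw≡p p (trans (sym (lookup-act p hs as x alx)) qx))))
    ... | yes V = Symm-cong eq (Symm-mulRow p hs′ as (λ d al′ →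
            (λ q → rest-away {hs} {as} V al d al′ (trans q (sym ac))) , abs d (proj₂ (alive-erase hs al′)))
            (single hs as c V fuel al ac abs))
      where
      hs′ = hs [ c ]≔ 0
      as′ = act p hs as
      same : ∀ d → Alive hs′ d → lookup as′ d ≡ lookup as d
      same d al′ with alive-erase hs al′
      ... | d≢c , al″ = trans (lookup-act p hs as d al″)
        (sw-other p (λ q → rest-away {hs} {as} V al d al′ (trans q (sym ac))) (abs d al″))
      eq : mulRow hs′ as (mul p (G N k hs as) ⊕ mul (suc p) (G N k hs as′)) ≗ (F N k hs as ⊕ F N k hs as′)
      eq e = trans (mulRow-⊕ hs′ as _ _ e) (cong₂ _+_
        (trans (mulRow-mul hs′ as p _ e)
          (sym (trans (mulRow-pull hs as c _ al e) (cong (λ i → mul i (mulRow hs′ as (G N k hs as)) e) ac))))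
        (trans (mulRow-mul hs′ as (suc p) _ e)
          (sym (trans (mulRow-pull hs as′ c _ al e)
            (trans (cong (λ i → mul i (mulRow hs′ as′ (G N k hs as′)) e)
                     (act-p p hs as al ac))
                   (mul-cong (suc p) (mulRow-labels hs′ as′ as _ same) e))))))

    module Both (hs as : Vec ℕ L) (c d : Fin L) (alc : Alive hs c) (ald : Alive hs d)
        (ac : lookup as c ≡ p) (ad : lookup as d ≡ suc p) (V : Valid hs as) where
      as′ = act p hs as
      hs₁ = hs [ c ]≔ 0
      hs₂ = hs₁ [ d ]≔ 0
      d≢c : d ≢ c
      d≢c refl = 1+n≢n (trans (sym ad) ac)
      ald₁ : Alive hs₁ d
      ald₁ = subst (1 ≤_) (sym (lookup∘update′ d≢c hs 0)) ald
      away : ∀ x → Alive hs₂ x → lookup as x ≢ p × lookup as x ≢ suc p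
      away x alx with alive-erase hs₁ {d} alx
      ... | x≢d , alx₁ with alive-erase hs {c} alx₁
      ...   | x≢c , alx₀ = (λ q → x≢c (valid-distinct {h = lookup hs} V alx₀ alc (trans q (sym ac)))) ,
                           (λ q → x≢d (valid-distinct {h = lookup hs} V alx₀ ald (trans q (sym ad))))
      mulRow-both : ∀ f → mulRow hs as f ≗ mul p (mul (suc p) (mulRow hs₂ as f))
      mulRow-both f e = trans (mulRow-pull hs as c f alc e)
        (trans (cong (λ i → mul i (mulRow hs₁ as f) e) ac) (mul-cong p {f = mulRow hs₁ as f} {g = mul (suc p) (mulRow hs₂ as f)} (λ e → trans (mulRow-pull hs₁ as d f ald₁ e)
          (cong (λ i → mul i (mulRow hs₂ as f) e) ad)) e))
      mulRow-both′ : ∀ f → mulRow hs as′ f ≗ mul p (mul (suc p) (mulRow hs₂ as f))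
      mulRow-both′ f e = trans (mulRow-pull hs as′ c f alc e)
        (trans (cong (λ i → mul i (mulRow hs₁ as′ f) e) (act-p p hs as alc ac))
        (trans (mul-cong (suc p) {f = mulRow hs₁ as′ f} {g = mul p (mulRow hs₂ as′ f)} (λ e → trans (mulRow-pull hs₁ as′ d f ald₁ e)
          (cong (λ i → mul i (mulRow hs₂ as′ f) e) (act-suc p hs as ald ad))) e)
        (trans (mul-comm (suc p) p (mulRow hs₂ as′ f) e) (mul-cong p (mul-cong (suc p)
          (mulRow-labels hs₂ as′ as f λ x alx → trans (lookup-act p hs as x (proj₂ (alive-erase hs (proj₂ (alive-erase hs₁ alx)))))
            (sw-other p (proj₁ (away x alx)) (proj₂ (away x alx))))) e))))

    orbit-symmetric-both : ∀ (hs as : Vec ℕ L) c d → Bounded k hs → Alive hs c → Alive hs d →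
        lookup as c ≡ p → lookup as d ≡ suc p → c Fin.< d → Symm p (F N k hs as ⊕ F N k hs (act p hs as))
    orbit-symmetric-both hs as c d fuel alc ald ac ad c<d with valid? hs as
    ... | no n = zero-⊕ hs as (act p hs as) n λ V → n (subst (Valid hs) (act-invol p hs as) (act-valid hs (act p hs as) V λ x y x<y alx aly le qx qy →
        Finₚ.<-asym x<y (subst₂ Fin._<_
          (valid-distinct {h = lookup hs} V alc aly (trans (lookup-act p hs as c alc) (trans (trans (cong (sw p) ac) (sw-p p)) (sym qy))))
          (valid-distinct {h = lookup hs} V ald alx (trans (lookup-act p hs as d ald) (trans (trans (cong (sw p) ad) (sw-suc p)) (sym qx))))
          c<d)))
    ... | yes V with lookup hs c ≤? lookup hs d
    ...   | yes le = Symm-⊕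
        (Symm-cong (λ e → sym (mulRow-both (G N k hs as) e))
           (Symm-XY (Symm-mulRow p hs₂ as away (ordered hs as c d V fuel alc ald ac ad c<d le))))
        -- The exchanged row has p + 1 left of p although the heights weakly increase, so it is
        -- invalid.
        (Symm-cong (λ e → sym (F-invalid N k hs as′ (λ V′ → <-asym ≤-refl (subst₂ _<_
            (act-p p hs as alc ac)
            (act-suc p hs as ald ad) (proj₂ (V′ c d c<d alc ald) le))) e)) Symm-0)
      where open Both hs as c d alc ald ac ad V
    ...   | no nle = Symm-cong (λ e → trans (mul-cong p (mul-cong (suc p) (mulRow-⊕ hs₂ as g g′)) e)
            (trans (mul-cong p (mul-⊕ (suc p) (R g) (R g′)) e) (trans (mul-⊕ p (mul (suc p) (R g)) (mul (suc p) (R g′)) e)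
              (cong₂ _+_ (sym (mulRow-both g e)) (sym (mulRow-both′ g′ e))))))
          (Symm-XY (Symm-mulRow p hs₂ as away (crossing hs as c d V fuel alc ald ac ad c<d (≰⇒> nle))))
      where
      open Both hs as c d alc ald ac ad V
      g = G N k hs as
      g′ = G N k hs as′
      R = mulRow hs₂ as

    Present? : ∀ (hs as : Vec ℕ L) q → Dec (∃[ c ] (Alive hs c × lookup as c ≡ q))
    Present? hs as q = Finₚ.any? λ c → (1 ≤? lookup hs c) ×-dec (lookup as c ≟ q)

    -- The orbit sum is the same for w and s w, so either row may represent the orbit.
    flip-act : ∀ (hs as : Vec ℕ L) → Symm p (F N k hs (act p hs as) ⊕ F N k hs (act p hs (act p hs as))) →
      Symm p (F N k hs as ⊕ F N k hs (act p hs as))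
    flip-act hs as s = Symm-cong (λ e → trans (+-comm (F N k hs (act p hs as) e) _)
      (cong (λ v → F N k hs v e + F N k hs (act p hs as) e) (act-invol p hs as))) s

    orbit-symmetric : OrbitSymmetric k
    orbit-symmetric hs as fuel with Present? hs as p | Present? hs as (suc p)
    ... | no n | no m = Symm-cong (λ e → cong (λ v → F N k hs as e + F N k hs v e) (sym (act-id p hs as away)))
        (Symm-⊕ s s)
      where
      away : ∀ c → Alive hs c → lookup as c ≢ p × lookup as c ≢ suc p
      away c al = (λ q → n (c , al , q)) , (λ q → m (c , al , q))
      s : Symm p (F N k hs as)
      s = Symm-mulRow p hs as away (absent hs as fuel λ c al → proj₁ (away c al))
    ... | yes (c , al , ac) | no m = orbit-symmetric-single hs as c fuel al ac λ d al′ q → m (d , al′ , q)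
    ... | no n | yes (d , al , ad) = flip-act hs as (orbit-symmetric-single hs (act p hs as) d fuel al
        (act-suc p hs as al ad)
        λ x alx q → n (x , alx , sw≡suc p (trans (sym (lookup-act p hs as x alx)) q)))
    ... | yes (c , alc , ac) | yes (d , ald , ad) with Finₚ.<-cmp c d
    ...   | tri< c<d _ _ = orbit-symmetric-both hs as c d fuel alc ald ac ad c<d
    ...   | tri≈ _ refl _ = ⊥-elim (1+n≢n (trans (sym ad) ac))
    ...   | tri> _ _ d<c = flip-act hs as (orbit-symmetric-both hs (act p hs as) d c fuel ald alc
        (act-suc p hs as ald ad)
        (act-p p hs as alc ac) d<c)

    dominant-symmetric : DominantSymmetric k
    dominant-symmetric hs as c fuel (alc , ac , dom) with valid? hs as
    ... | no n = Symm-cong (λ e → sym (mul-cong p (F-invalid N k hs as n) e)) (Symm-mul-0 p)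
    ... | yes V with Present? hs as p
    ...   | no m = Symm-cong (λ e → mul-cong p {f = mul (suc p) (mulRow hs₁ as (G N k hs as))} {g = F N k hs as}
              (λ e → trans (cong (λ i → mul i (mulRow hs₁ as (G N k hs as)) e) (sym ac))
              (sym (mulRow-pull hs as c (G N k hs as) alc e))) e)
            (Symm-XY (Symm-mulRow p hs₁ as (λ d al′ → (λ q → m (d , proj₂ (alive-erase hs al′) , q)) ,
               λ q → rest-away {hs} {as} V alc d al′ (trans q (sym ac)))
               (absent hs as fuel λ d al q → m (d , al , q))))
      where
      hs₁ = hs [ c ]≔ 0
    -- The row monomial supplies the symmetric factor x_p x_{p+1}; the additional x_p is absorbed by
    -- `crossed`.
    ...   | yes (d , ald , ad) = Symm-cong (λ e → trans (mul-cong p (mul-cong (suc p) (mulRow-mul hs₂ as p g)) e)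
              (mul-cong p {g = F N k hs as} (λ e → trans (mul-comm (suc p) p (mulRow hs₂ as g) e) (sym (mulRow-both g e))) e))
            (Symm-XY (Symm-mulRow p hs₂ as away (crossed hs as c d V fuel (alc , ac , dom) ald ad)))
      where
      open Both hs as d c ald alc ad ac V
      g = G N k hs as

-- Rows allowed above a given row, by the positions of p and p + 1

module _ (p : ℕ) {L : ℕ} where

  module RowStep (hs as : Vec ℕ L) (V : Valid hs as) where
    private
      h = lookup hs
      a = lookup as

    -- The columns c and d are the only ones carrying p and p + 1, and c is the taller, so no
    -- required inequality is reversed.
    crossing-valid : ∀ {b} → Swapped p 1 h a b → ∀ {c d} → Alive hs c → Alive hs d →
      a c ≡ p → a d ≡ suc p → h d < h c → ValidF 1 h b
    crossing-valid s {c} {d} alc ald ac ad lt = valid-swapped {h = h} s V λ x y x<y alx aly le qx qy →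
      <⇒≱ (subst₂ (λ i j → h i < h j) (valid-distinct {h = h} V ald aly (trans ad (sym qy)))
        (valid-distinct {h = h} V alc alx (trans ac (sym qx))) lt) le

    module _ {w v : Fin L → ℕ} (s : Swapped p 2 h w v) where

      -- Both obstructions of `step-target` involve a p in the lower row.
      absent-step : Absent hs as p → StepF h a w → StepF h a v
      absent-step n S = step-target {h = h} s S (λ c al _ q → n c (<⇒≤ al) q) (λ c d _ al _ _ q _ → n d al q)

      module _ {c d : Fin L} (alc : Alive hs c) (ald : Alive hs d) (ac : a c ≡ p) (ad : a d ≡ suc p) where

        private
          is-c : ∀ {x} → Alive hs x → a x ≡ p → x ≡ c
          is-c alx q = valid-distinct {h = h} V alx alc (trans q (sym ac))
          is-d : ∀ {x} → Alive hs x → a x ≡ suc p → x ≡ d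
          is-d alx q = valid-distinct {h = h} V alx ald (trans q (sym ad))

          -- A column x that has passed c has a label beyond p. If x is taller than d, its label
          -- differs from the p + 1 of d, so x has passed d too and must stay beyond p + 1 in the
          -- next row.
          passed : c Fin.< d → StepF h a w →
            (∀ x → x Fin.< c → Alive hs x → h c < h x → a c < a x → h x ≤ h d → ⊥) →
            ∀ x → x Fin.< c → h c < h x → a c < a x → w x ≡ suc p → ⊥
          passed c<d (S₁ , S₂) n x x<c hlt lt wx with h x ≤? h d
          ... | yes le = n x x<c (<⇒≤ (≤-trans (s≤s alc) hlt)) hlt lt le
          ... | no nle = <-irrefl (trans ad (sym wx)) (S₂ x d x<d ald (≰⇒> nle)
                  (≤∧≢⇒< (subst (_≤ a x) (sym ad) (subst (_< a x) ac lt))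
                    λ q → Finₚ.<⇒≢ x<d (valid-distinct {h = h} V (<⇒≤ (≤-trans (s≤s alc) hlt)) ald (sym q))))
            where
            x<d : x Fin.< d
            x<d = Finₚ.<-trans x<c c<d

        -- If c kept its p, the label of d would be squeezed to p + 1, and the exchanged upper row
        -- would be out of order on c and d. The other obstruction is excluded by `passed`.
        ordered-step : c Fin.< d → h c ≤ h d → ValidF 2 h w → ValidF 2 h v → StepF h a w → StepF h a v
        ordered-step c<d le V₁ V₂ S@(S₁ , S₂) = step-target {h = h} s S n₁ n₂
          where
          n₁ : ∀ x → 2 ≤ h x → w x ≡ p → a x ≡ p → ⊥
          n₁ x kx wx ax with is-c (<⇒≤ kx) ax
          ... | refl = <-asym (subst₂ _<_ (swapped-p {h = h} s kx wx)
                  (swapped-suc {h = h} s kd wd) (proj₂ (V₂ c d c<d kx kd) le)) ≤-refl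
            where
            kd = ≤-trans kx le
            wd : w d ≡ suc p
            wd = ≤-antisym (subst (w d ≤_) ad (S₁ d kd)) (subst (_< w d) wx (proj₂ (V₁ c d c<d kx kd) le))
          n₂ : ∀ x y → x Fin.< y → 1 ≤ h y → h y < h x → a y < a x → a y ≡ p → w x ≡ suc p → ⊥
          n₂ x y x<y aly lt q ay wx with is-c aly ay
          ... | refl = passed c<d S (λ z z<c alz _ lt′ le′ →
                  <⇒≱ (proj₂ (V z d (Finₚ.<-trans z<c c<d) alz ald) le′)
                  (subst (_≤ a z) (sym ad) (subst (_< a z) ac lt′))) x x<y lt q wx

        private
          crossing-blocked : c Fin.< d → h d < h c → StepF h a w →
            ∀ x y → x Fin.< y → 1 ≤ h y → h y < h x → a y < a x → a y ≡ p → w x ≡ suc p → ⊥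
          crossing-blocked c<d lt S x y x<y aly hlt q ay wx with is-c aly ay
          ... | refl = passed c<d S (λ z z<c alz _ lt′ le′ →
                  <-asym lt′ (proj₂ (V z c z<c alz alc) (<⇒≤ (≤-<-trans le′ lt)))) x x<y hlt q wx

        -- The two lower rows are taken together. If w has p in c, then v has p + 1 there, which is
        -- exactly what `b` demands: beyond its p in d and at most its p + 1 in c. If w is allowed
        -- above `a` with another label in c, then so is v; and what `b` allows passes to `a`.
        crossing-step : ∀ {b} → Swapped p 1 h a b → c Fin.< d → h d < h c → ValidF 2 h w →
          StepF h a w ⊎ StepF h b w → StepF h a v ⊎ StepF h b v
        crossing-step {b} sa c<d lt V₁ (inj₁ S) with w c ≟ p
        ... | no wc = inj₁ (step-target {h = h} s S
                (λ x kx wx ax → wc (subst (λ x → w x ≡ p) (is-c (<⇒≤ kx) ax) wx))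
                (crossing-blocked c<d lt S))
        ... | yes wc = inj₂ (step-both {h = h} sa s S
                (λ x kx wx ax → Finₚ.<⇒≢ c<d (trans (valid-distinct {h = h} V₁ kc kx (trans wc (sym wx))) (is-d (<⇒≤ kx) ax)))
                n₂
                λ x y x<y aly hlt q _ → crossing-blocked c<d lt S x y x<y aly hlt q)
          where
          kc : 2 ≤ h c
          kc = ≤-trans (s≤s ald) lt
          n₂ : ∀ x y → x Fin.< y → 1 ≤ h y → h y < h x → a y ≡ suc p → a x ≡ p → b y < v x
          n₂ x y x<y aly hlt ay ax with is-d aly ay | is-c (≤-trans aly (<⇒≤ hlt)) ax
          ... | refl | refl = subst₂ _<_ (sym (swapped-suc {h = h} sa aly ay))
                                (sym (swapped-p {h = h} s kc wc)) ≤-refl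
        crossing-step {b} sa c<d lt V₁ (inj₂ S@(S₁ , S₂)) = inj₁ (step-both {h = h} (swapped-sym {h = h} sa) s S
            (λ x kx wx bx → 1+n≢n (trans (sym wc) (trans (cong w (sym (is-c (<⇒≤ kx) (sw≡suc p (trans (sym (sa x (<⇒≤ kx))) bx))))) wx)))
            (λ x y x<y aly hlt by bx → ⊥-elim (Finₚ.<-asym c<d (subst₂ Fin._<_
               (is-d (≤-trans aly (<⇒≤ hlt)) (sw≡p p (trans (sym (sa x (≤-trans aly (<⇒≤ hlt)))) bx)))
               (is-c aly (sw≡suc p (trans (sym (sa y aly)) by))) x<y)))
            n₃)
          where
          kc : 2 ≤ h c
          kc = ≤-trans (s≤s ald) lt
          bc : b c ≡ suc p
          bc = swapped-p {h = h} sa alc ac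
          bd : b d ≡ p
          bd = swapped-suc {h = h} sa ald ad
          wc : w c ≡ suc p
          wc = ≤-antisym (subst (w c ≤_) bc (S₁ c kc))
                 (subst (_< w c) bd (S₂ c d c<d ald lt (subst₂ _<_ (sym bd) (sym bc) ≤-refl)))
          n₃ : ∀ x y → x Fin.< y → 1 ≤ h y → h y < h x → b y < b x → a y < a x → b y ≡ p → w x ≡ suc p → ⊥
          n₃ x y x<y aly hlt _ q by wx
            with is-d aly (sw≡p p (trans (sym (sa y aly)) by))
               | valid-distinct {h = h} V₁ (≤-trans (s≤s aly) hlt) kc (trans wx (sym wc))
          ... | refl | refl = <-asym q (subst₂ _<_ (sym ac) (sym ad) ≤-refl)

      module _ {c : Fin L} (alc : Alive hs c) (ac : a c ≡ p) (abs : Absent hs as (suc p))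
          {b : Fin L → ℕ} (sa : Swapped p 1 h a b) where

        private
          is-c′ : ∀ {x} → Alive hs x → a x ≡ p → x ≡ c
          is-c′ alx q = valid-distinct {h = h} V alx alc (trans q (sym ac))

        -- Since `b` contains no p, exchanging both rows can only violate the rule that column c
        -- does not increase, and this happens when p stands above its p + 1.
        target-above : StepF h b w → ¬ StepF h a v → 2 ≤ h c × w c ≡ p
        target-above S n with (2 ≤? h c) ×-dec (w c ≟ p)
        ... | yes q = q
        ... | no m = ⊥-elim (n (step-both {h = h} (swapped-sym {h = h} sa) s S
              (λ x kx wx bx → m (subst (λ x → 2 ≤ h x × w x ≡ p) (is-c′ (<⇒≤ kx) (sw≡suc p (trans (sym (sa x (<⇒≤ kx))) bx))) (kx , wx)))
              (λ x y x<y aly hlt by bx → ⊥-elim (abs x (≤-trans aly (<⇒≤ hlt)) (sw≡p p (trans (sym (sa x (≤-trans aly (<⇒≤ hlt)))) bx))))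
              λ x y x<y aly hlt _ _ by _ → abs y aly (sw≡p p (trans (sym (sa y aly)) by))))

        -- Since `a` contains no p + 1, exchanging both rows can only violate the passing condition
        -- of a taller column left of c whose new label p + 1 just clears the p of c.
        target-blocked : StepF h a w → ¬ StepF h b v → ∃[ x ] (x Fin.< c × h c < h x × w x ≡ suc p)
        target-blocked S n with Finₚ.any? (λ x → (x Finₚ.<? c) ×-dec (h c <? h x) ×-dec (w x ≟ suc p))
        ... | yes q = q
        ... | no m = ⊥-elim (n (step-both {h = h} sa s S
              (λ x kx _ ax → abs x (<⇒≤ kx) ax)
              (λ x y x<y aly hlt ay ax → ⊥-elim (abs y aly ay))
              λ x y x<y aly hlt _ _ ay wx → blocked x y x<y aly hlt ay wx))
          where
          blocked : ∀ x y → x Fin.< y → 1 ≤ h y → h y < h x → a y ≡ p → w x ≡ suc p → ⊥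
          blocked x y x<y aly hlt ay wx with is-c′ aly ay
          ... | refl = m (x , x<y , hlt , wx)

-- Orbit sums weighted by step conditions

module _ {p : ℕ} where

  -- Where the two conditions differ, one of the rows is invalid and its series is 0; the weighted
  -- sum is then still f ⊕ g or 0.
  χ-orbit : {P Q V W : Set} (dP : Dec P) (dQ : Dec Q) (dV : Dec V) (dW : Dec W) {f g : Poly} →
    (¬ V → f ≗ (λ _ → 0)) → (¬ W → g ≗ (λ _ → 0)) → (V → W → (P → Q) × (Q → P)) →
    Symm p (f ⊕ g) → Symm p (χ dP f ⊕ χ dQ g)
  χ-orbit (no _)  (no _)  dV dW f0 g0 pq s = Symm-0
  χ-orbit (yes _) (yes _) dV dW f0 g0 pq s = s
  χ-orbit (yes P) (no ¬Q) (yes V) (yes W) f0 g0 pq s = ⊥-elim (¬Q (proj₁ (pq V W) P))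
  χ-orbit (yes P) (no ¬Q) (yes V) (no ¬W) f0 g0 pq s = Symm-cong (λ e → cong (_ +_) (g0 ¬W e)) s
  χ-orbit (yes P) (no ¬Q) (no ¬V) dW f0 g0 pq s = Symm-cong (λ e → sym (cong (_+ 0) (f0 ¬V e))) Symm-0
  χ-orbit (no ¬P) (yes Q) (yes V) (yes W) f0 g0 pq s = ⊥-elim (¬P (proj₂ (pq V W) Q))
  χ-orbit (no ¬P) (yes Q) (no ¬V) dW f0 g0 pq s = Symm-cong (λ e → cong (_+ _) (f0 ¬V e)) s
  χ-orbit (no ¬P) (yes Q) (yes V) (no ¬W) f0 g0 pq s = Symm-cong (λ e → sym (g0 ¬W e)) Symm-0

  -- If U and U′ hold, the sum is (x_p + x_{p+1})(f + g) without those of the terms x_p f and x_p g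
  -- whose condition T or T′ fails, and the missing terms are symmetric by hypothesis. If neither
  -- holds, the surviving terms x_p f and x_p g are symmetric one by one.
  χ-single : {T U T′ U′ : Set} (dT : Dec T) (dU : Dec U) (dT′ : Dec T′) (dU′ : Dec U′) {f g : Poly} →
    (U → U′) → (U′ → U) → (U → ¬ T′ → Symm p (mul p g)) → (U′ → ¬ T → Symm p (mul p f)) →
    (T → ¬ U′ → Symm p (mul p f)) → (T′ → ¬ U → Symm p (mul p g)) → Symm p (f ⊕ g) →
    Symm p ((mul p (χ dT f) ⊕ mul (suc p) (χ dU f)) ⊕ (mul p (χ dT′ g) ⊕ mul (suc p) (χ dU′ g)))
  χ-single dT (yes U) dT′ (no ¬U′) uu uu′ ug uf tf tg s = ⊥-elim (¬U′ (uu U))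
  χ-single dT (no ¬U) dT′ (yes U′) uu uu′ ug uf tf tg s = ⊥-elim (¬U (uu′ U′))
  χ-single {T = T} {T′ = T′} dT (no ¬U) dT′ (no ¬U′) {f} {g} uu uu′ ug uf tf tg s =
    Symm-⊕ (Symm-⊕ (part dT (λ t → tf t ¬U′)) (Symm-mul-0 {p} (suc p))) (Symm-⊕ (part dT′ (λ t → tg t ¬U)) (Symm-mul-0 {p} (suc p)))
    where
    part : {T : Set} (dT : Dec T) {f : Poly} → (T → Symm p (mul p f)) → Symm p (mul p (χ dT f))
    part (yes t) h = h t
    part (no _)  h = Symm-mul-0 {p} p
  χ-single {T = T} {T′ = T′} dT (yes U) dT′ (yes U′) {f} {g} uu uu′ ug uf tf tg s =
    Symm-cancelʳ (Symm-cong regroup (Symm-X⊕Y s)) (Symm-⊕ (rest dT (uf U′)) (rest dT′ (ug U)))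
    where
    missing : {T : Set} → Dec T → Poly → Poly
    missing (yes _) f = λ _ → 0
    missing (no _)  f = f
    rest : {T : Set} (dT : Dec T) {f : Poly} → (¬ T → Symm p (mul p f)) → Symm p (mul p (missing dT f))
    rest (yes _) h = Symm-mul-0 {p} p
    rest (no ¬t) h = h ¬t
    split : {T : Set} (dT : Dec T) (f : Poly) → ∀ e → mul p f e ≡ mul p (χ dT f) e + mul p (missing dT f) e
    split (yes _) f e = sym (trans (cong (mul p f e +_) (mul-0 p e)) (+-identityʳ _))
    split (no _)  f e = sym (cong (_+ mul p f e) (mul-0 p e))
    arith : ∀ x₁ x₂ m₁ m₂ y₁ y₂ → ((x₁ + m₁) + (x₂ + m₂)) + (y₁ + y₂) ≡ ((x₁ + y₁) + (x₂ + y₂)) + (m₁ + m₂)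
    arith = solve-∀
    regroup : (mul p (f ⊕ g) ⊕ mul (suc p) (f ⊕ g)) ≗
      ((mul p (χ dT f) ⊕ mul (suc p) f) ⊕ (mul p (χ dT′ g) ⊕ mul (suc p) g)) ⊕ (mul p (missing dT f) ⊕ mul p (missing dT′ g))
    regroup e = trans (cong₂ _+_ (trans (mul-⊕ p f g e) (cong₂ _+_ (split dT f e) (split dT′ g e))) (mul-⊕ (suc p) f g e))
      (arith (mul p (χ dT f) e) (mul p (χ dT′ g) e) (mul p (missing dT f) e) (mul p (missing dT′ g) e) (mul (suc p) f e) (mul (suc p) g e))

-- The symmetries of G by induction on the number of rows

module _ (p N : ℕ) (p<N : suc p < N) {L : ℕ} where

  G-symmetries-zero : GSymmetries p N {L} 0
  G-symmetries-zero = record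
    { absent   = λ hs as fuel _ → Symm-χ (valid? hs as) (Symm-δ₀ p)
    ; single   = λ hs as c _ fuel al → ⊥-elim (<⇒≱ al (fuel c))
    ; ordered  = λ hs as c d _ fuel al → ⊥-elim (<⇒≱ al (fuel c))
    ; crossing = λ hs as c d _ fuel al → ⊥-elim (<⇒≱ al (fuel c))
    ; crossed  = λ hs as c d _ fuel dom → ⊥-elim (<⇒≱ (proj₁ dom) (fuel c))
    }

  module _ (k : ℕ) (ih₁ : OrbitSymmetric p N {L} k) (ih₂ : DominantSymmetric p N {L} k) where

    module _ (hs as : Vec ℕ L) (fuel : Bounded (suc k) hs) where

      private
        h = lookup hs
        low = lower hs
        f : Vec ℕ L → Poly
        f ws = F N k low ws
        rowsOf : Vec ℕ L → Vec ℕ L → Poly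
        rowsOf bs ws = χ (step? hs bs ws) (f ws)
        as′ = act p hs as
        sa : Swapped p 1 h (lookup as) (lookup as′)
        sa = act-swapped hs as
        fuel′ : Bounded k low
        fuel′ = lower-bounded {hs = hs} fuel
        row : ∀ ws → Swapped p 2 h (lookup ws) (lookup (act p low ws))
        row = act-swapped′ hs
        row⁻ : ∀ ws → Swapped p 2 h (lookup (act p low ws)) (lookup ws)
        row⁻ ws = swapped-sym {h = h} (row ws)
        orbit : ∀ ws → Symm p (f ws ⊕ f (act p low ws))
        orbit ws = ih₁ low ws fuel′
        V₂ : ∀ ws → Valid low ws → ValidF 2 h (lookup ws)
        V₂ ws = valid-lower {hs = hs} {ws = ws}
        f-zero : ∀ ws → ¬ Valid low ws → f ws ≗ (λ _ → 0)
        f-zero ws = F-invalid N k low ws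
        dominant : ∀ ws → (Valid low ws → ∃[ c ] Dominant p 2 h (lookup ws) c) → Symm p (mul p (f ws))
        dominant ws dom with valid? low ws
        ... | no n = Symm-cong (λ e → sym (mul-cong p (f-zero ws n) e)) (Symm-mul-0 {p} p)
        ... | yes V with dom V
        ...   | c , D = ih₂ low ws c fuel′ (dom-lower {hs = hs} {ws = ws} D)

      absent-suc : Absent hs as p → Symm p (G N (suc k) hs as)
      absent-suc n with valid? hs as
      ... | no _ = Symm-0
      ... | yes V = Symm-Σ-orbits p N low (rowsOf as) p<N λ ws →
          χ-orbit (step? hs as ws) (step? hs as (act p low ws)) (valid? low ws) (valid? low (act p low ws))
            (f-zero ws) (f-zero (act p low ws))
            (λ _ _ → absent-step p hs as V (row ws) n , absent-step p hs as V (row⁻ ws) n) (orbit ws)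
        where open RowStep

      module _ (V : Valid hs as) where
        open RowStep p hs as V

        G-valid : ∀ {bs} → Valid hs bs → G N (suc k) hs bs ≡ ΣPoly N low (rowsOf bs)
        G-valid {bs} V′ = χ-yes (valid? hs bs) V′

        ordered-suc : ∀ {c d} → Alive hs c → Alive hs d → lookup as c ≡ p → lookup as d ≡ suc p →
          c Fin.< d → h c ≤ h d → Symm p (G N (suc k) hs as)
        ordered-suc alc ald ac ad c<d le = subst (Symm p) (sym (G-valid V))
          (Symm-Σ-orbits p N low (rowsOf as) p<N λ ws →
            χ-orbit (step? hs as ws) (step? hs as (act p low ws)) (valid? low ws) (valid? low (act p low ws))
              (f-zero ws) (f-zero (act p low ws))
              (λ v₁ v₂ → ordered-step (row ws) alc ald ac ad c<d le (V₂ ws v₁) (V₂ (act p low ws) v₂) ,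
                         ordered-step (row⁻ ws) alc ald ac ad c<d le (V₂ (act p low ws) v₂) (V₂ ws v₁)) (orbit ws))

        crossing-suc : ∀ {c d} → Alive hs c → Alive hs d → lookup as c ≡ p → lookup as d ≡ suc p →
          c Fin.< d → h d < h c → Symm p (G N (suc k) hs as ⊕ G N (suc k) hs as′)
        crossing-suc {c} {d} alc ald ac ad c<d lt =
          subst₂ (λ g g′ → Symm p (g ⊕ g′)) (sym (G-valid V)) (sym (G-valid (crossing-valid sa alc ald ac ad lt)))
          (Symm-cong (λ e → Σbox-+ N low (λ ws → rowsOf as ws e) (λ ws → rowsOf as′ ws e)) (Symm-Σ-orbits p N low (λ ws → rowsOf as ws ⊕ rowsOf as′ ws) p<N λ ws →
            Symm-cong (λ e → cong₂ _+_ (χ-⊎ ws e) (χ-⊎ (act p low ws) e))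
            (χ-orbit (step? hs as ws ⊎-dec step? hs as′ ws)
              (step? hs as (act p low ws) ⊎-dec step? hs as′ (act p low ws)) (valid? low ws) (valid? low (act p low ws))
              (f-zero ws) (f-zero (act p low ws))
              (λ v₁ v₂ → crossing-step (row ws) alc ald ac ad sa c<d lt (V₂ ws v₁) ,
                         crossing-step (row⁻ ws) alc ald ac ad sa c<d lt (V₂ (act p low ws) v₂)) (orbit ws))))
          where
          kc : 2 ≤ h c
          kc = ≤-trans (s≤s ald) lt
          a′c : lookup as′ c ≡ suc p
          a′c = swapped-p {h = h} sa alc ac
          a′d : lookup as′ d ≡ p
          a′d = swapped-suc {h = h} sa ald ad
          -- The label of the taller column c tells the two lower rows apart: `as` keeps it at most
          -- p, `as′` forces it beyond p.
          exclusive : ∀ ws → Step hs as ws → Step hs as′ ws → ⊥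
          exclusive ws (S₁ , _) (_ , S₂) = <⇒≱
            (subst (_< lookup ws c) a′d (S₂ c d c<d ald lt (subst₂ _<_ (sym a′d) (sym a′c) ≤-refl)))
            (subst (lookup ws c ≤_) ac (S₁ c kc))
          χ-⊎ : ∀ ws → χ (step? hs as ws ⊎-dec step? hs as′ ws) (f ws) ≗ χ (step? hs as ws) (f ws) ⊕ χ (step? hs as′ ws) (f ws)
          χ-⊎ ws e with step? hs as ws | step? hs as′ ws
          ... | yes S | yes S′ = ⊥-elim (exclusive ws S S′)
          ... | yes S | no _ = sym (+-identityʳ _)
          ... | no _ | yes _ = refl
          ... | no _ | no _ = refl

        single-suc : ∀ {c} → Alive hs c → lookup as c ≡ p → Absent hs as (suc p) →
          Symm p (mul p (G N (suc k) hs as) ⊕ mul (suc p) (G N (suc k) hs as′))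
        single-suc {c} alc ac abs =
          subst₂ (λ g g′ → Symm p (mul p g ⊕ mul (suc p) g′)) (sym (G-valid V)) (sym (G-valid V′))
          (Symm-cong (λ e → trans (Σbox-+ N low (λ ws → mul p (rowsOf as ws) e) (λ ws → mul (suc p) (rowsOf as′ ws) e))
                       (sym (cong₂ _+_ (mul-Σ N low p (rowsOf as) e) (mul-Σ N low (suc p) (rowsOf as′) e))))
          (Symm-Σ-orbits p N low (λ ws → mul p (rowsOf as ws) ⊕ mul (suc p) (rowsOf as′ ws)) p<N λ ws →
            χ-single (step? hs as ws) (step? hs as′ ws) (step? hs as (act p low ws)) (step? hs as′ (act p low ws))
              (RowStep.absent-step p hs as′ V′ (row ws) abs′) (RowStep.absent-step p hs as′ V′ (row⁻ ws) abs′)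
              (λ u n → above ws (act p low ws) (row ws) u n (RowStep.absent-step p hs as′ V′ (row ws) abs′ u))
              (λ u n → above (act p low ws) ws (row⁻ ws) u n (RowStep.absent-step p hs as′ V′ (row⁻ ws) abs′ u))
              (blocked ws (act p low ws) (row ws)) (blocked (act p low ws) ws (row⁻ ws)) (orbit ws)))
          where
          V′ : Valid hs as′
          V′ = valid-swapped {h = h} sa V λ x y _ _ aly _ _ q → abs y aly q
          abs′ : Absent hs as′ p
          abs′ x alx q = abs x alx (sw≡p p (trans (sym (sa x alx)) q))
          -- Here the term of `vs` over `as` is missing because p + 1 would stand above the p of c.
          -- Over `as′`, which has p + 1 in c and no p, dominance is inherited by `vs`.
          above : ∀ ws vs → Swapped p 2 h (lookup ws) (lookup vs) → Step hs as′ ws → ¬ Step hs as vs →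
            Step hs as′ vs → Symm p (mul p (f vs))
          above ws vs s S n S′ with target-above s alc ac abs sa S n
          ... | kc , wc = dominant vs λ v → c , dominant-step {h = h} V′
                  (alc , swapped-p {h = h} sa alc ac , λ d al q → ⊥-elim (abs′ d al q))
                  S′ (V₂ vs v) kc (swapped-p {h = h} s kc wc)
          -- Here the term of `ws` over `as` has no partner over `as′`. The column x that just
          -- clears the p of c dominates `ws`.
          blocked : ∀ ws vs → Swapped p 2 h (lookup ws) (lookup vs) → Step hs as ws → ¬ Step hs as′ vs →
            Symm p (mul p (f ws))
          blocked ws vs s S n with target-blocked s alc ac abs sa S n
          ... | x , x<c , lt , wx = dominant ws λ v → x , blocked-dominant {h = h} V S (V₂ ws v) alc ac x<c lt wx

        crossed-suc : ∀ {c d} → Dom p hs as c → Alive hs d → lookup as d ≡ p → Symm p (mul p (G N (suc k) hs as))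
        crossed-suc {c} {d} (alc , ac , dom) ald ad = subst (λ g → Symm p (mul p g)) (sym (G-valid V))
          (Symm-cong (λ e → sym (mul-Σ N low p (rowsOf as) e)) (Symm-Σ p N low (λ ws → mul p (rowsOf as ws)) go))
          where
          lt : c Fin.< d × h d < h c
          lt = dom d ald ad
          kc : 2 ≤ h c
          kc = ≤-trans (s≤s ald) (proj₂ lt)
          go : ∀ ws → Symm p (mul p (χ (step? hs as ws) (f ws)))
          go ws with step? hs as ws
          ... | no _ = Symm-mul-0 {p} p
          -- The new label of c is squeezed to p + 1: it is at most p + 1 and stays beyond the p of
          -- d. So every term of the sum is dominant by itself.
          ... | yes S@(S₁ , S₂) = dominant ws λ v → c , dominant-step {h = h} V (alc , ac , dom) S (V₂ ws v) kc
                (≤-antisym (subst (lookup ws c ≤_) ac (S₁ c kc))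
                  (subst (_< lookup ws c) ad (S₂ c d (proj₁ lt) ald (proj₂ lt) (subst₂ _<_ (sym ad) (sym ac) ≤-refl))))

    G-symmetries-suc : GSymmetries p N {L} (suc k)
    G-symmetries-suc = record
      { absent   = λ hs as fuel n → absent-suc hs as fuel n
      ; single   = λ hs as c V fuel al ac abs → single-suc hs as fuel V al ac abs
      ; ordered  = λ hs as c d V fuel alc ald ac ad c<d le → ordered-suc hs as fuel V alc ald ac ad c<d le
      ; crossing = λ hs as c d V fuel alc ald ac ad c<d lt → crossing-suc hs as fuel V alc ald ac ad c<d lt
      ; crossed  = λ hs as c d V fuel D ald ad → crossed-suc hs as fuel V D ald ad
      }

  G-symmetries : ∀ k → GSymmetries p N {L} k
  G-symmetries zero    = G-symmetries-zero
  G-symmetries (suc k) = G-symmetries-suc k (orbit-symmetric p N k (G-symmetries k)) (dominant-symmetric p N k (G-symmetries k))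

-- Exchanging two adjacent columns: vectors, row monomials and sums

swapV : ∀ {A : Set} {L} → ℕ → Vec A L → Vec A L
swapV i       []          = []
swapV zero    (x ∷ [])    = x ∷ []
swapV zero    (x ∷ y ∷ v) = y ∷ x ∷ v
swapV (suc i) (x ∷ v)     = x ∷ swapV i v

swF : ∀ {L} → ℕ → Fin L → Fin L
swF {suc zero}    zero    zero          = zero
swF {suc (suc L)} zero    zero          = suc zero
swF {suc (suc L)} zero    (suc zero)    = zero
swF {suc (suc L)} zero    (suc (suc x)) = suc (suc x)
swF               (suc i) zero          = zero
swF               (suc i) (suc x)       = suc (swF i x)

lookup-swapV : ∀ {A : Set} {L} i (v : Vec A L) c → lookup (swapV i v) c ≡ lookup v (swF i c)
lookup-swapV zero    (x ∷ [])    zero          = refl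
lookup-swapV zero    (x ∷ y ∷ v) zero          = refl
lookup-swapV zero    (x ∷ y ∷ v) (suc zero)    = refl
lookup-swapV zero    (x ∷ y ∷ v) (suc (suc c)) = refl
lookup-swapV (suc i) (x ∷ v)     zero          = refl
lookup-swapV (suc i) (x ∷ v)     (suc c)       = lookup-swapV i v c

swapV-invol : ∀ {A : Set} {L} i (v : Vec A L) → swapV i (swapV i v) ≡ v
swapV-invol i       []          = refl
swapV-invol zero    (x ∷ [])    = refl
swapV-invol zero    (x ∷ y ∷ v) = refl
swapV-invol (suc i) (x ∷ v)     = cong (x ∷_) (swapV-invol i v)

map-swapV : ∀ {A B : Set} {L} (f : A → B) i (v : Vec A L) → map f (swapV i v) ≡ swapV i (map f v)
map-swapV f i       []          = refl
map-swapV f zero    (x ∷ [])    = refl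
map-swapV f zero    (x ∷ y ∷ v) = refl
map-swapV f (suc i) (x ∷ v)     = cong (f x ∷_) (map-swapV f i v)

toℕ-swF : ∀ {L} i (c : Fin L) → suc i < L → toℕ (swF i c) ≡ sw i (toℕ c)
toℕ-swF {suc zero}    zero    zero          (s≤s ())
toℕ-swF {suc (suc L)} zero    zero          l = refl
toℕ-swF {suc (suc L)} zero    (suc zero)    l = refl
toℕ-swF {suc (suc L)} zero    (suc (suc c)) l = refl
toℕ-swF               (suc i) zero          l = refl
toℕ-swF               (suc i) (suc c) (s≤s l) = cong suc (toℕ-swF i c l)

mulRow-swapV : ∀ {L} i (hs as : Vec ℕ L) f → mulRow (swapV i hs) (swapV i as) f ≗ mulRow hs as f
mulRow-swapV i       []                    []           f e = refl
mulRow-swapV zero    (x ∷ [])              (a ∷ [])     f e = refl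
mulRow-swapV zero    (zero ∷ zero ∷ hs)    (a ∷ b ∷ as) f e = refl
mulRow-swapV zero    (zero ∷ suc y ∷ hs)   (a ∷ b ∷ as) f e = refl
mulRow-swapV zero    (suc x ∷ zero ∷ hs)   (a ∷ b ∷ as) f e = refl
mulRow-swapV zero    (suc x ∷ suc y ∷ hs)  (a ∷ b ∷ as) f e = mul-comm b a (mulRow hs as f) e
mulRow-swapV (suc i) (zero ∷ hs)           (a ∷ as)     f e = mulRow-swapV i hs as f e
mulRow-swapV (suc i) (suc x ∷ hs)          (a ∷ as)     f e = mul-cong a (mulRow-swapV i hs as f) e

Σ<-comm : ∀ M N (F : ℕ → ℕ → ℕ) → Σ< M (λ a → Σ< N (λ b → F a b)) ≡ Σ< N (λ b → Σ< M (λ a → F a b))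
Σ<-comm zero    N F = sym (Σ<-0 N)
Σ<-comm (suc M) N F = trans (cong (_+ Σ< N (F M)) (Σ<-comm M N F)) (sym (Σ<-+ N _ _))

Σbox-swapV : ∀ {L} N i (hs : Vec ℕ L) F → Σbox N (swapV i hs) F ≡ Σbox N hs (λ ws → F (swapV i ws))
Σbox-swapV N i       []                   F = refl
Σbox-swapV N zero    (zero ∷ [])          F = refl
Σbox-swapV N zero    (suc x ∷ [])         F = refl
Σbox-swapV N zero    (zero ∷ zero ∷ hs)   F = refl
Σbox-swapV N zero    (zero ∷ suc y ∷ hs)  F = refl
Σbox-swapV N zero    (suc x ∷ zero ∷ hs)  F = refl
Σbox-swapV N zero    (suc x ∷ suc y ∷ hs) F = Σ<-comm N N (λ b a → Σbox N hs (λ ws → F (b ∷ a ∷ ws)))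
Σbox-swapV N (suc i) (zero ∷ hs)          F = Σbox-swapV N i hs (λ ws → F (0 ∷ ws))
Σbox-swapV N (suc i) (suc x ∷ hs)         F = Σ<-cong N λ a → Σbox-swapV N i hs (λ ws → F (a ∷ ws))

-- Row monomials and the range of a sum over rows depend only on which columns are alive, and
-- exchanging two living columns of different heights does not affect this.
SameShape : ∀ {L} → Vec ℕ L → Vec ℕ L → Set
SameShape hs gs = ∀ c → (Alive hs c → Alive gs c) × (Alive gs c → Alive hs c)

Σbox-shape : ∀ {L} N (hs gs : Vec ℕ L) F → SameShape hs gs → Σbox N hs F ≡ Σbox N gs F
Σbox-shape N []           []           F s = refl
Σbox-shape N (zero ∷ hs)  (zero ∷ gs)  F s = Σbox-shape N hs gs (λ ws → F (0 ∷ ws)) (λ c → s (suc c))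
Σbox-shape N (suc x ∷ hs) (suc y ∷ gs) F s = Σ<-cong N λ a → Σbox-shape N hs gs (λ ws → F (a ∷ ws)) (λ c → s (suc c))
Σbox-shape N (zero ∷ hs)  (suc y ∷ gs) F s with proj₂ (s zero) (s≤s z≤n)
... | ()
Σbox-shape N (suc x ∷ hs) (zero ∷ gs)  F s with proj₁ (s zero) (s≤s z≤n)
... | ()

mulRow-shape : ∀ {L} (hs gs as : Vec ℕ L) f → SameShape hs gs → mulRow hs as f ≗ mulRow gs as f
mulRow-shape []           []           []       f s e = refl
mulRow-shape (zero ∷ hs)  (zero ∷ gs)  (a ∷ as) f s e = mulRow-shape hs gs as f (λ c → s (suc c)) e
mulRow-shape (suc x ∷ hs) (suc y ∷ gs) (a ∷ as) f s e = mul-cong a (mulRow-shape hs gs as f (λ c → s (suc c))) e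
mulRow-shape (zero ∷ hs)  (suc y ∷ gs) (a ∷ as) f s e with proj₂ (s zero) (s≤s z≤n)
... | ()
mulRow-shape (suc x ∷ hs) (zero ∷ gs)  (a ∷ as) f s e with proj₁ (s zero) (s≤s z≤n)
... | ()

ValidPair : ℕ → ℕ → ℕ → ℕ → ℕ → Set
ValidPair k hc ac hd ad = k ≤ hc → k ≤ hd → ac ≢ ad × (hc ≤ hd → ac < ad)

StepPair : ℕ → ℕ → ℕ → ℕ → ℕ → Set
StepPair hc ac wc hd ad = 1 ≤ hd → hd < hc → ad < ac → ad < wc

-- Validity and steps when the heights of two adjacent columns are exchanged

module Adjacent {L : ℕ} (i : ℕ) (i₀ i₁ : Fin L) (q₀ : toℕ i₀ ≡ i) (q₁ : toℕ i₁ ≡ suc i) where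

  σ : Fin L → Fin L
  σ = swF i

  i<L : suc i < L
  i<L = subst (_< L) q₁ (Finₚ.toℕ<n i₁)

  i₀<i₁ : i₀ Fin.< i₁
  i₀<i₁ = subst₂ _<_ (sym q₀) (sym q₁) ≤-refl

  σi₀ : σ i₀ ≡ i₁
  σi₀ = Finₚ.toℕ-injective (trans (toℕ-swF i i₀ i<L) (trans (cong (sw i) q₀) (trans (sw-p i) (sym q₁))))

  σi₁ : σ i₁ ≡ i₀
  σi₁ = Finₚ.toℕ-injective (trans (toℕ-swF i i₁ i<L) (trans (cong (sw i) q₁) (trans (sw-suc i) (sym q₀))))

  σ-other : ∀ {e} → e ≢ i₀ → e ≢ i₁ → σ e ≡ e
  σ-other {e} n m = Finₚ.toℕ-injective (trans (toℕ-swF i e i<L)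
    (sw-other i (λ q → n (Finₚ.toℕ-injective (trans q (sym q₀)))) (λ q → m (Finₚ.toℕ-injective (trans q (sym q₁))))))

  σ-invol : ∀ c → σ (σ c) ≡ c
  σ-invol c = Finₚ.toℕ-injective (trans (toℕ-swF i (σ c) i<L) (trans (cong (sw i) (toℕ-swF i c i<L)) (sw-invol i (toℕ c))))

  -- An adjacent transposition reverses only the pair of the two positions themselves, so one more
  -- instance of R is all that has to be added.
  reindex : (R : Fin L → Fin L → Set) → (∀ c d → c Fin.< d → R c d) → R i₁ i₀ → ∀ c d → c Fin.< d → R (σ c) (σ d)
  reindex R r r₁₀ c d c<d with (toℕ c ≟ i) ×-dec (toℕ d ≟ suc i)
  ... | yes (u , v) with Finₚ.toℕ-injective (trans u (sym q₀)) | Finₚ.toℕ-injective (trans v (sym q₁))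
  ...   | refl | refl = subst₂ R (sym σi₀) (sym σi₁) r₁₀
  reindex R r r₁₀ c d c<d | no n = r (σ c) (σ d)
    (subst₂ _<_ (sym (toℕ-swF i c i<L)) (sym (toℕ-swF i d i<L)) (sw-< i c<d n))

  pairs : (Q : Fin L → Fin L → Set) →
    (∀ c d → c Fin.< d → c ≢ i₀ → c ≢ i₁ → d ≢ i₀ → d ≢ i₁ → Q c d) →
    (∀ e → e ≢ i₀ → e ≢ i₁ → e Fin.< i₀ → Q e i₀) → (∀ e → e ≢ i₀ → e ≢ i₁ → e Fin.< i₁ → Q e i₁) →
    (∀ e → e ≢ i₀ → e ≢ i₁ → i₀ Fin.< e → Q i₀ e) → (∀ e → e ≢ i₀ → e ≢ i₁ → i₁ Fin.< e → Q i₁ e) →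
    Q i₀ i₁ → ∀ c d → c Fin.< d → Q c d
  pairs Q o l₀ l₁ r₀ r₁ m c d c<d with c Finₚ.≟ i₀ | c Finₚ.≟ i₁ | d Finₚ.≟ i₀ | d Finₚ.≟ i₁
  ... | no a     | no b     | no x     | no y     = o c d c<d a b x y
  ... | no a     | no b     | yes refl | _        = l₀ c a b c<d
  ... | no a     | no b     | no _     | yes refl = l₁ c a b c<d
  ... | yes refl | _        | no x     | no y     = r₀ d x y c<d
  ... | no a     | yes refl | no x     | no y     = r₁ d x y c<d
  ... | yes refl | _        | no _     | yes refl = m
  ... | yes refl | _        | yes refl | _        = ⊥-elim (<-irrefl refl c<d)
  ... | no _     | yes refl | yes refl | _        = ⊥-elim (<-asym c<d i₀<i₁)
  ... | no _     | yes refl | no _     | yes refl = ⊥-elim (<-irrefl refl c<d)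

  left-of-both : ∀ {e} → e ≢ i₀ → e Fin.< i₁ → e Fin.< i₀
  left-of-both {e} n l = ≤∧≢⇒< (≤-pred (subst (toℕ e <_) (trans q₁ (cong suc (sym q₀))) l)) (λ q → n (Finₚ.toℕ-injective q))

  right-of-both : ∀ {e} → e ≢ i₁ → i₀ Fin.< e → i₁ Fin.< e
  right-of-both {e} n l = ≤∧≢⇒< (subst (_≤ toℕ e) (trans (cong suc q₀) (sym q₁)) l) (λ q → n (Finₚ.toℕ-injective (sym q)))

  -- h and g are the heights before and after the exchange of the two positions.
  module _ {h g : Fin L → ℕ} (hg : ∀ c → g c ≡ h (σ c)) where

    private
      g₀ : g i₀ ≡ h i₁
      g₀ = trans (hg i₀) (cong h σi₀)
      g₁ : g i₁ ≡ h i₀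
      g₁ = trans (hg i₁) (cong h σi₁)
      gₑ : ∀ {e} → e ≢ i₀ → e ≢ i₁ → g e ≡ h e
      gₑ n m = trans (hg _) (cong h (σ-other n m))

    valid-moved : ∀ {k a b} → (∀ c → b c ≡ a (σ c)) → ValidF k h a → ValidPair k (h i₁) (a i₁) (h i₀) (a i₀) → ValidF k g b
    valid-moved {k} {a} {b} ab V m c d c<d rewrite hg c | hg d | ab c | ab d =
      reindex (λ c d → ValidPair k (h c) (a c) (h d) (a d)) V m c d c<d

    step-moved : ∀ {a b w v} → (∀ c → b c ≡ a (σ c)) → (∀ c → v c ≡ w (σ c)) → StepF h a w →
      StepPair (h i₁) (a i₁) (w i₁) (h i₀) (a i₀) → StepF g b v
    step-moved {a} {b} {w} {v} ab wv (S₁ , S₂) m = first , second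
      where
      first : ∀ c → 2 ≤ g c → v c ≤ b c
      first c rewrite hg c | ab c | wv c = S₁ (σ c)
      second : ∀ c d → c Fin.< d → StepPair (g c) (b c) (v c) (g d) (b d)
      second c d c<d rewrite hg c | hg d | ab c | ab d | wv c =
        reindex (λ c d → StepPair (h c) (a c) (w c) (h d) (a d)) S₂ m c d c<d

    module _ (lt : h i₀ < h i₁) where

      private
        p₀ = h i₀
        p₁ = h i₁
        le = <⇒≤ lt

      module FromG {k : ℕ} {a : Fin L → ℕ} (V : ValidF k g a) where
        l₀ : ∀ {e} → e ≢ i₀ → e ≢ i₁ → e Fin.< i₀ → ValidPair k (h e) (a e) p₁ (a i₀)
        l₀ {e} n m l = subst₂ (λ x y → ValidPair k x (a e) y (a i₀)) (gₑ n m) g₀ (V e i₀ l)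
        l₁ : ∀ {e} → e ≢ i₀ → e ≢ i₁ → e Fin.< i₁ → ValidPair k (h e) (a e) p₀ (a i₁)
        l₁ {e} n m l = subst₂ (λ x y → ValidPair k x (a e) y (a i₁)) (gₑ n m) g₁ (V e i₁ l)
        r₀ : ∀ {e} → e ≢ i₀ → e ≢ i₁ → i₀ Fin.< e → ValidPair k p₁ (a i₀) (h e) (a e)
        r₀ {e} n m l = subst₂ (λ x y → ValidPair k x (a i₀) y (a e)) g₀ (gₑ n m) (V i₀ e l)
        r₁ : ∀ {e} → e ≢ i₀ → e ≢ i₁ → i₁ Fin.< e → ValidPair k p₀ (a i₁) (h e) (a e)
        r₁ {e} n m l = subst₂ (λ x y → ValidPair k x (a i₁) y (a e)) g₁ (gₑ n m) (V i₁ e l)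
        o : ∀ {c d} → c Fin.< d → c ≢ i₀ → c ≢ i₁ → d ≢ i₀ → d ≢ i₁ → ValidPair k (h c) (a c) (h d) (a d)
        o {c} {d} l n m n′ m′ = subst₂ (λ x y → ValidPair k x (a c) y (a d)) (gₑ n m) (gₑ n′ m′) (V c d l)

      -- The comparisons that change their role are bridged by a i₀ < a i₁.
      valid-from : ∀ {k a} → a i₀ < a i₁ → k ≤ p₀ → ValidF k g a → ValidF k h a
      valid-from {k} {a} a₀<a₁ k₀ V = pairs (λ c d → ValidPair k (h c) (a c) (h d) (a d))
        (λ c d l n m n′ m′ → o l n m n′ m′)
        (λ e n m l ke _ → proj₁ (l₀ n m l ke k₁) , λ le′ → proj₂ (l₀ n m l ke k₁) (≤-trans le′ le))
        (λ e n m l ke _ → proj₁ (l₁ n m l ke k₀) , λ le′ → <-trans (proj₂ (l₀ n m (left-of-both n l) ke k₁) le′) a₀<a₁)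
        (λ e n m l _ ke → proj₁ (r₀ n m l k₁ ke) , λ le′ → <-trans a₀<a₁ (proj₂ (r₁ n m (right-of-both m l) k₀ ke) le′))
        (λ e n m l _ ke → proj₁ (r₁ n m l k₀ ke) , λ le′ → proj₂ (r₁ n m l k₀ ke) (≤-trans le le′))
        (λ _ _ → <⇒≢ a₀<a₁ , λ _ → a₀<a₁)
        where
        open FromG V
        k₁ = ≤-trans k₀ le

      -- The labels a stay in place while the heights are exchanged.
      valid-to : ∀ {k a} → a i₀ < a i₁ → k ≤ p₀ → ValidF k h a →
        (∀ e → e ≢ i₀ → e ≢ i₁ → e Fin.< i₀ → k ≤ h e → h e ≤ p₁ → a e < a i₀) →
        (∀ e → e ≢ i₀ → e ≢ i₁ → i₁ Fin.< e → k ≤ h e → p₀ ≤ h e → a i₁ < a e) → ValidF k g a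
      valid-to {k} {a} a₀<a₁ k₀ V ul ur = pairs (λ c d → ValidPair k (g c) (a c) (g d) (a d)) o l₀ l₁ r₀ r₁
          (λ _ _ → <⇒≢ a₀<a₁ , λ _ → a₀<a₁)
        where
        k₁ = ≤-trans k₀ le
        o : ∀ c d → c Fin.< d → c ≢ i₀ → c ≢ i₁ → d ≢ i₀ → d ≢ i₁ → ValidPair k (g c) (a c) (g d) (a d)
        o c d l n m n′ m′ rewrite gₑ n m | gₑ n′ m′ = V c d l
        l₀ : ∀ e → e ≢ i₀ → e ≢ i₁ → e Fin.< i₀ → ValidPair k (g e) (a e) (g i₀) (a i₀)
        l₀ e n m l rewrite gₑ n m | g₀ = λ ke _ → proj₁ (V e i₀ l ke k₀) , ul e n m l ke
        l₁ : ∀ e → e ≢ i₀ → e ≢ i₁ → e Fin.< i₁ → ValidPair k (g e) (a e) (g i₁) (a i₁)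
        l₁ e n m l rewrite gₑ n m | g₁ = λ ke _ → proj₁ (V e i₁ l ke k₁) , λ le′ → proj₂ (V e i₁ l ke k₁) (≤-trans le′ le)
        r₀ : ∀ e → e ≢ i₀ → e ≢ i₁ → i₀ Fin.< e → ValidPair k (g i₀) (a i₀) (g e) (a e)
        r₀ e n m l rewrite gₑ n m | g₀ = λ _ ke → proj₁ (V i₀ e l k₀ ke) , λ le′ → proj₂ (V i₀ e l k₀ ke) (≤-trans le le′)
        r₁ : ∀ e → e ≢ i₀ → e ≢ i₁ → i₁ Fin.< e → ValidPair k (g i₁) (a i₁) (g e) (a e)
        r₁ e n m l rewrite gₑ n m | g₁ = λ _ ke → proj₁ (V i₁ e l k₁ ke) , ur e n m l ke

      module _ {a : Fin L → ℕ} (a₀<a₁ : a i₀ < a i₁) (k₀ : 1 ≤ p₀) where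

        private
          k₁ : 2 ≤ p₁
          k₁ = ≤-trans (s≤s k₀) lt

        -- Over the unmoved labels the tall column at `i₀` may not exceed a i₀; over the moved ones
        -- it starts beyond a i₀, the label of its shorter neighbour, and has to stay there.
        step-exclusive : ∀ {b v} → (∀ c → b c ≡ a (σ c)) → StepF g a v → StepF g b v → ⊥
        step-exclusive {b} {v} ab (S₁ , _) (_ , S₂) = <⇒≱
          (subst (_< v i₀) b₁ (S₂ i₀ i₁ i₀<i₁ (subst (1 ≤_) (sym g₁) k₀) (subst₂ _<_ (sym g₁) (sym g₀) lt)
            (subst₂ _<_ (sym b₁) (sym b₀) a₀<a₁)))
          (S₁ i₀ (subst (2 ≤_) (sym g₀) k₁))
          where
          b₀ : b i₀ ≡ a i₁
          b₀ = trans (ab i₀) (cong a σi₀)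
          b₁ : b i₁ ≡ a i₀
          b₁ = trans (ab i₁) (cong a σi₁)

        step-to : ∀ {w v} → ValidF 1 h a → StepF h a w →
          (∀ {e} → e ≢ i₀ → e ≢ i₁ → v e ≡ w e) →
          v i₀ ≤ a i₀ → (2 ≤ p₀ → v i₁ ≤ a i₁) →
          (∀ e → e ≢ i₀ → e ≢ i₁ → i₁ Fin.< e → 1 ≤ h e → h e < p₁ → a e < a i₀ → a e < v i₀) →
          (∀ e → e ≢ i₀ → e ≢ i₁ → i₁ Fin.< e → 1 ≤ h e → h e < p₀ → a e < a i₁ → a e < v i₁) →
          StepF g a v
        step-to {w} {v} V (S₁ , S₂) wv x y rx ry = first ,
            pairs (λ c d → StepPair (g c) (a c) (v c) (g d) (a d)) o l₀ l₁ r₀ r₁ (λ _ _ q → ⊥-elim (<-asym q a₀<a₁))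
          where
          first : ∀ c → 2 ≤ g c → v c ≤ a c
          first c kc with c Finₚ.≟ i₀ | c Finₚ.≟ i₁
          ... | yes refl | _ = x
          ... | no _ | yes refl = y (subst (2 ≤_) g₁ kc)
          ... | no n | no m rewrite wv n m = S₁ c (subst (2 ≤_) (gₑ n m) kc)
          o : ∀ c d → c Fin.< d → c ≢ i₀ → c ≢ i₁ → d ≢ i₀ → d ≢ i₁ → StepPair (g c) (a c) (v c) (g d) (a d)
          o c d l n m n′ m′ rewrite gₑ n m | gₑ n′ m′ | wv n m = S₂ c d l
          l₀ : ∀ e → e ≢ i₀ → e ≢ i₁ → e Fin.< i₀ → StepPair (g e) (a e) (v e) (g i₀) (a i₀)
          l₀ e n m l rewrite gₑ n m | g₀ | wv n m = λ _ hlt q → S₂ e i₀ l k₀ (<-trans lt hlt) q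
          l₁ : ∀ e → e ≢ i₀ → e ≢ i₁ → e Fin.< i₁ → StepPair (g e) (a e) (v e) (g i₁) (a i₁)
          l₁ e n m l rewrite gₑ n m | g₁ | wv n m = go
            where
            go : StepPair (h e) (a e) (w e) p₀ (a i₁)
            go _ hlt q with h e ≤? p₁
            -- A column of height above `p₀` and at most `p₁` becomes subject to this condition only
            -- by the exchange; but validity before it makes its label smaller than a i₁, so it has
            -- not passed.
            ... | yes le′ = ⊥-elim (<-asym q (proj₂ (V e i₁ l (≤-trans k₀ (<⇒≤ hlt)) (<⇒≤ k₁)) le′))
            ... | no nle = S₂ e i₁ l (<⇒≤ k₁) (≰⇒> nle) q
          r₀ : ∀ e → e ≢ i₀ → e ≢ i₁ → i₀ Fin.< e → StepPair (g i₀) (a i₀) (v i₀) (g e) (a e)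
          r₀ e n m l rewrite gₑ n m | g₀ = rx e n m (right-of-both m l)
          r₁ : ∀ e → e ≢ i₀ → e ≢ i₁ → i₁ Fin.< e → StepPair (g i₁) (a i₁) (v i₁) (g e) (a e)
          r₁ e n m l rewrite gₑ n m | g₁ = ry e n m l

        step-from : ∀ {w v} → ValidF 1 g a → StepF g a v →
          (∀ {e} → e ≢ i₀ → e ≢ i₁ → v e ≡ w e) →
          (2 ≤ p₀ → w i₀ ≤ a i₀) → w i₁ ≤ a i₁ →
          (∀ e → e ≢ i₀ → e ≢ i₁ → i₁ Fin.< e → 1 ≤ h e → h e < p₀ → a e < a i₀ → a e < w i₀) →
          (∀ e → e ≢ i₀ → e ≢ i₁ → i₁ Fin.< e → 1 ≤ h e → h e < p₁ → a e < a i₁ → a e < w i₁) →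
          StepF h a w
        step-from {w} {v} V (S₁ , S₂) wv x y rx ry = first ,
            pairs (λ c d → StepPair (h c) (a c) (w c) (h d) (a d)) o l₀ l₁ r₀ ry (λ _ hlt _ → ⊥-elim (<-asym hlt lt))
          where
          open FromG V using () renaming (l₀ to V₀)
          first : ∀ c → 2 ≤ h c → w c ≤ a c
          first c kc with c Finₚ.≟ i₀ | c Finₚ.≟ i₁
          ... | yes refl | _ = x kc
          ... | no _ | yes refl = y
          ... | no n | no m = subst (_≤ a c) (wv n m) (S₁ c (subst (2 ≤_) (sym (gₑ n m)) kc))
          o : ∀ c d → c Fin.< d → c ≢ i₀ → c ≢ i₁ → d ≢ i₀ → d ≢ i₁ → StepPair (h c) (a c) (w c) (h d) (a d)
          o c d l n m n′ m′ rewrite sym (gₑ n m) | sym (gₑ n′ m′) | sym (wv n m) = S₂ c d l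
          fromG₀ : ∀ e → e ≢ i₀ → e ≢ i₁ → e Fin.< i₀ → StepPair (h e) (a e) (w e) p₁ (a i₀)
          fromG₀ e n m l rewrite sym (gₑ n m) | sym g₀ | sym (wv n m) = S₂ e i₀ l
          fromG₁ : ∀ e → e ≢ i₀ → e ≢ i₁ → e Fin.< i₁ → StepPair (h e) (a e) (w e) p₀ (a i₁)
          fromG₁ e n m l rewrite sym (gₑ n m) | sym g₁ | sym (wv n m) = S₂ e i₁ l
          l₀ : ∀ e → e ≢ i₀ → e ≢ i₁ → e Fin.< i₀ → StepPair (h e) (a e) (w e) p₀ (a i₀)
          l₀ e n m l _ hlt q with h e ≤? p₁
          ... | yes le′ = ⊥-elim (<-asym q (proj₂ (V₀ n m l (≤-trans k₀ (<⇒≤ hlt)) (<⇒≤ k₁)) le′))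
          ... | no nle = fromG₀ e n m l (<⇒≤ k₁) (≰⇒> nle) q
          l₁ : ∀ e → e ≢ i₀ → e ≢ i₁ → e Fin.< i₁ → StepPair (h e) (a e) (w e) p₁ (a i₁)
          l₁ e n m l _ hlt q = fromG₁ e n m l k₀ (<-trans lt hlt) q
          r₀ : ∀ e → e ≢ i₀ → e ≢ i₁ → i₀ Fin.< e → StepPair p₀ (a i₀) (w i₀) (h e) (a e)
          r₀ e n m l = rx e n m (right-of-both m l)

χ-at : {P : Set} (d : Dec P) {f g : Poly} → ∀ e → f e ≡ g e → χ d f e ≡ χ d g e
χ-at (yes _) e q = q
χ-at (no _)  e q = refl

χ-zero : {P : Set} (d : Dec P) {f : Poly} → ∀ e → f e ≡ 0 → χ d f e ≡ 0
χ-zero (yes _) e q = q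
χ-zero (no _)  e q = refl

χ-⊕ : {P : Set} (d : Dec P) (f g : Poly) → χ d (f ⊕ g) ≗ χ d f ⊕ χ d g
χ-⊕ (yes _) f g e = refl
χ-⊕ (no _)  f g e = refl

χ-⊎ : {P Q R : Set} (p : Dec P) (q : Dec Q) (r : Dec R) {f : Poly} →
  (P → Q ⊎ R) → (Q ⊎ R → P) → (Q → R → ⊥) → χ p f ≗ χ q f ⊕ χ r f
χ-⊎ (yes p) (yes q) (yes r) pqr qrp qr e = ⊥-elim (qr q r)
χ-⊎ (yes p) (yes q) (no ¬r) pqr qrp qr e = sym (+-identityʳ _)
χ-⊎ (yes p) (no ¬q) (yes r) pqr qrp qr e = refl
χ-⊎ (yes p) (no ¬q) (no ¬r) pqr qrp qr e = ⊥-elim (Sum.reduce (Sum.map ¬q ¬r (pqr p)))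
χ-⊎ (no ¬p) (yes q) dr      pqr qrp qr e = ⊥-elim (¬p (qrp (inj₁ q)))
χ-⊎ (no ¬p) (no ¬q) (yes r) pqr qrp qr e = ⊥-elim (¬p (qrp (inj₂ r)))
χ-⊎ (no ¬p) (no ¬q) (no ¬r) pqr qrp qr e = refl

χ-Σ : ∀ {L} {P : Set} {Q : Vec ℕ L → Set} N (hs : Vec ℕ L) (p : Dec P) (q : ∀ ws → Dec (Q ws)) (f : Vec ℕ L → Poly) →
  χ p (ΣPoly N hs (λ ws → χ (q ws) (f ws))) ≗ ΣPoly N hs (λ ws → χ (p ×-dec q ws) (f ws))
χ-Σ N hs (yes p) q f e = Σbox-cong N hs λ ws → cong (λ v → v e) (χ-cong (q ws) (yes p ×-dec q ws) (p ,_) proj₂)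
χ-Σ N hs (no ¬p) q f e = sym (trans (Σbox-cong N hs λ ws → cong (λ v → v e) (χ-no (no ¬p ×-dec q ws) {f ws} λ r → ¬p (proj₁ r)))
  (Σbox-0 N hs))

-- The exchange identity T₂ = T + T′

module Exchange {L : ℕ} (i : ℕ) (i₀ i₁ : Fin L) (q₀ : toℕ i₀ ≡ i) (q₁ : toℕ i₁ ≡ suc i) where

  open Adjacent i i₀ i₁ q₀ q₁

  module Claims {h g a b : Fin L → ℕ} (hg : ∀ c → g c ≡ h (σ c)) (ab : ∀ c → b c ≡ a (σ c))
      (k₀ : 1 ≤ h i₀) (lt : h i₀ < h i₁) (a₀<a₁ : a i₀ < a i₁) where

    private
      p₀ = h i₀
      p₁ = h i₁
      k₁ : 2 ≤ p₁
      k₁ = ≤-trans (s≤s k₀) lt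
      g₀ : g i₀ ≡ p₁
      g₀ = trans (hg i₀) (cong h σi₀)
      g₁ : g i₁ ≡ p₀
      g₁ = trans (hg i₁) (cong h σi₁)
      gₑ : ∀ {e} → e ≢ i₀ → e ≢ i₁ → g e ≡ h e
      gₑ n m = trans (hg _) (cong h (σ-other n m))
      b₀ : b i₀ ≡ a i₁
      b₀ = trans (ab i₀) (cong a σi₀)
      b₁ : b i₁ ≡ a i₀
      b₁ = trans (ab i₁) (cong a σi₁)
      gh : ∀ c → h c ≡ g (σ c)
      gh c = sym (trans (hg (σ c)) (cong h (σ-invol c)))
      ba : ∀ c → a c ≡ b (σ c)
      ba c = sym (trans (ab (σ c)) (cong a (σ-invol c)))

      right₀ : ∀ {v} → StepF g a v → ∀ {e} → e ≢ i₀ → e ≢ i₁ → i₁ Fin.< e → StepPair p₁ (a i₀) (v i₀) (h e) (a e)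
      right₀ {v} S {e} n m l = subst₂ (λ x y → StepPair x (a i₀) (v i₀) y (a e)) g₀ (gₑ n m) (proj₂ S i₀ e (<-trans i₀<i₁ l))
      right₁ : ∀ {v} → StepF g a v → ∀ {e} → e ≢ i₀ → e ≢ i₁ → i₁ Fin.< e → StepPair p₀ (a i₁) (v i₁) (h e) (a e)
      right₁ {v} S {e} n m l = subst₂ (λ x y → StepPair x (a i₁) (v i₁) y (a e)) g₁ (gₑ n m) (proj₂ S i₁ e l)

      -- New order requirements concern the columns of height between `p₀` and `p₁`. On the left, a
      -- column violating one would have to stay beyond a i₀ in the next row, against the validity
      -- of v. On the right, the label of such a column would lie between a i₀ and w i₁, which the
      -- last hypothesis excludes.
      valid-unmoved : ValidF 1 h a → ∀ {w v} → StepF h a w → (∀ {e} → e ≢ i₀ → e ≢ i₁ → v e ≡ w e) →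
        ValidF 2 g v → v i₀ ≤ a i₀ →
        (∀ e → e ≢ i₀ → e ≢ i₁ → i₁ Fin.< e → p₀ ≤ h e → a i₀ < a e → a e < w i₁ → ⊥) → ValidF 1 g a
      valid-unmoved V {w} {v} (S₁ , S₂) wv V′ x r = valid-to hg lt a₀<a₁ k₀ V left right
        where
        left : ∀ e → e ≢ i₀ → e ≢ i₁ → e Fin.< i₀ → 1 ≤ h e → h e ≤ p₁ → a e < a i₀
        left e n m l ke le with h e ≤? p₀
        ... | yes le′ = proj₂ (V e i₀ l ke k₀) le′
        ... | no nle with <-cmp (a e) (a i₀)
        ...   | tri< q _ _ = q
        ...   | tri≈ _ q _ = ⊥-elim (proj₁ (V e i₀ l ke k₀) q)
        ...   | tri> _ _ q = ⊥-elim (<-asym (S₂ e i₀ l k₀ (≰⇒> nle) q) (≤-trans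
                  (subst (_< v i₀) (wv n m) (proj₂ (V′ e i₀ l (subst (2 ≤_) (sym (gₑ n m)) (≤-trans (s≤s k₀) (≰⇒> nle)))
                    (subst (2 ≤_) (sym g₀) k₁)) (subst₂ _≤_ (sym (gₑ n m)) (sym g₀) le))) x))
        right : ∀ e → e ≢ i₀ → e ≢ i₁ → i₁ Fin.< e → 1 ≤ h e → p₀ ≤ h e → a i₁ < a e
        right e n m l ke le with p₁ ≤? h e
        ... | yes le′ = proj₂ (V i₁ e l (<⇒≤ k₁) ke) le′
        ... | no nle with <-cmp (a i₁) (a e)
        ...   | tri< q _ _ = q
        ...   | tri≈ _ q _ = ⊥-elim (proj₁ (V i₁ e l (<⇒≤ k₁) ke) q)
        ...   | tri> _ _ q = ⊥-elim (r e n m l le (proj₂ (V i₀ e (<-trans i₀<i₁ l) k₀ ke) le)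
                  (S₂ i₁ e l ke (≰⇒> nle) q))

    moved-valid : ValidF 1 g b → ValidF 1 h a
    moved-valid V = valid-moved gh ba V λ _ _ →
      (λ q → <⇒≢ a₀<a₁ (trans (sym b₁) (trans q b₀))) , λ _ → subst₂ _<_ (sym b₁) (sym b₀) a₀<a₁

    unmoved-valid : ValidF 1 g a → ValidF 1 h a
    unmoved-valid = valid-from hg lt a₀<a₁ k₀

    module _ {w v : Fin L → ℕ} (wv : ∀ c → v c ≡ w (σ c)) (w₀<w₁ : 2 ≤ p₀ → w i₀ < w i₁) where

      private
        v₀ : v i₀ ≡ w i₁
        v₀ = trans (wv i₀) (cong w σi₀)
        v₁ : v i₁ ≡ w i₀
        v₁ = trans (wv i₁) (cong w σi₁)
        vₑ : ∀ {e} → e ≢ i₀ → e ≢ i₁ → v e ≡ w e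
        vₑ n m = trans (wv _) (cong w (σ-other n m))

      -- The tall column lands above a i₀ or not, which decides between the two positions.
      moved-to : ValidF 2 g v → ValidF 1 h a → StepF h a w → (ValidF 1 g a × StepF g a v) ⊎ (ValidF 1 g b × StepF g b v)
      moved-to V′ V S@(S₁ , S₂) with a i₀ <? w i₁
      ... | yes q = inj₂
          ( valid-moved hg ab V (λ _ _ → (λ q → <⇒≢ a₀<a₁ (sym q)) , λ le → ⊥-elim (<⇒≱ lt le))
          , step-moved hg ab wv S λ _ _ _ → q )
      ... | no nq = inj₁
          ( valid-unmoved V S vₑ V′ (subst (_≤ a i₀) (sym v₀) le) (λ e n m l _ q q′ → <⇒≱ (<-trans q q′) le)
          , step-to hg lt a₀<a₁ k₀ V S vₑ (subst (_≤ a i₀) (sym v₀) le)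
              (λ kp → subst (_≤ a i₁) (sym v₁) (≤-trans (S₁ i₀ kp) (<⇒≤ a₀<a₁)))
              (λ e n m l ke hlt q → subst (a e <_) (sym v₀) (S₂ i₁ e l ke hlt (<-trans q a₀<a₁)))
              (λ e n m l ke hlt q → subst (a e <_) (sym v₁) (S₂ i₀ e (<-trans i₀<i₁ l) ke hlt
                 (<-≤-trans (S₂ i₁ e l ke (<-trans hlt lt) q) le))) )
        where
        le : w i₁ ≤ a i₀
        le = ≮⇒≥ nq

      moved-from : (ValidF 1 g a × StepF g a v) ⊎ (ValidF 1 g b × StepF g b v) → StepF h a w
      moved-from (inj₂ (V , S)) = step-moved gh ba (λ c → sym (trans (wv (σ c)) (cong w (σ-invol c)))) S
        λ _ hlt _ → ⊥-elim (<-asym (subst₂ _<_ g₀ g₁ hlt) lt)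
      moved-from (inj₁ (V , S@(S₁ , S₂))) = step-from hg lt a₀<a₁ k₀ V S vₑ
          (λ kp → ≤-trans (<⇒≤ (w₀<w₁ kp)) w₁≤a₀) (≤-trans w₁≤a₀ (<⇒≤ a₀<a₁))
          (λ e n m l ke hlt q → subst (a e <_) v₁ (right₁ S n m l ke hlt (<-trans q a₀<a₁))) r₁
        where
        w₁≤a₀ : w i₁ ≤ a i₀
        w₁≤a₀ = subst (_≤ a i₀) v₀ (S₁ i₀ (subst (2 ≤_) (sym g₀) k₁))
        r₁ : ∀ e → e ≢ i₀ → e ≢ i₁ → i₁ Fin.< e → 1 ≤ h e → h e < p₁ → a e < a i₁ → a e < w i₁
        r₁ e n m l ke hlt q with <-cmp (a e) (a i₀)
        ... | tri< q′ _ _ = subst (a e <_) v₀ (right₀ S n m l ke hlt q′)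
        ... | tri≈ _ q′ _ = ⊥-elim (proj₁ (FromG.r₀ hg lt V n m (<-trans i₀<i₁ l) (<⇒≤ k₁) ke) (sym q′))
        ... | tri> _ _ q′ with h e <? p₀
        ...   | yes hlt′ = <-trans (subst (a e <_) v₁ (right₁ S n m l ke hlt′ q)) (w₀<w₁ (≤-trans (s≤s ke) hlt′))
        ...   | no nlt = ⊥-elim (<-asym q (proj₂ (FromG.r₁ hg lt V n m l k₀ ke) (≮⇒≥ nlt)))

    module _ {w : Fin L → ℕ} (kp : 2 ≤ p₀) (w₀<w₁ : w i₀ < w i₁) where

      -- If the upper labels stay in place too, only the unmoved lower row can allow them: the moved
      -- one would force w i₁ ≤ a i₀ < w i₀.
      unmoved-to : ValidF 2 g w → ValidF 1 h a → StepF h a w → (ValidF 1 g a × StepF g a w) ⊎ (ValidF 1 g b × StepF g b w)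
      unmoved-to V′ V S@(S₁ , S₂) = inj₁
        ( valid-unmoved V S (λ _ _ → refl) V′ (S₁ i₀ kp) (λ e n m l le _ q → <⇒≱
            (<-trans q (proj₂ (V′ i₁ e l (subst (2 ≤_) (sym g₁) kp) (subst (2 ≤_) (sym (gₑ n m)) (≤-trans kp le)))
               (subst₂ _≤_ (sym g₁) (sym (gₑ n m)) le))) (S₁ e (≤-trans kp le)))
        , step-to hg lt a₀<a₁ k₀ V S (λ _ _ → refl) (S₁ i₀ kp) (λ _ → S₁ i₁ k₁) r₀
            (λ e n m l ke hlt q → S₂ i₁ e l ke (<-trans hlt lt) q) )
        where
        r₀ : ∀ e → e ≢ i₀ → e ≢ i₁ → i₁ Fin.< e → 1 ≤ h e → h e < p₁ → a e < a i₀ → a e < w i₀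
        r₀ e n m l ke hlt q with h e <? p₀
        ... | yes hlt′ = S₂ i₀ e (<-trans i₀<i₁ l) ke hlt′ q
        ... | no nlt = ⊥-elim (<-asym q (proj₂ (V i₀ e (<-trans i₀<i₁ l) k₀ ke) (≮⇒≥ nlt)))

      unmoved-from : (ValidF 1 g a × StepF g a w) ⊎ (ValidF 1 g b × StepF g b w) → StepF h a w
      unmoved-from (inj₂ (V , S₁ , S₂)) = ⊥-elim (<-asym w₀<w₁ (≤-<-trans
        (subst (w i₁ ≤_) b₁ (S₁ i₁ (subst (2 ≤_) (sym g₁) kp)))
        (subst (_< w i₀) b₁ (S₂ i₀ i₁ i₀<i₁ (subst (1 ≤_) (sym g₁) k₀) (subst₂ _<_ (sym g₁) (sym g₀) lt)
          (subst₂ _<_ (sym b₁) (sym b₀) a₀<a₁)))))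
      unmoved-from (inj₁ (V , S@(S₁ , S₂))) = step-from hg lt a₀<a₁ k₀ V S (λ _ _ → refl)
          (λ _ → S₁ i₀ (subst (2 ≤_) (sym g₀) k₁)) (S₁ i₁ (subst (2 ≤_) (sym g₁) kp))
          (λ e n m l ke hlt q → right₀ S n m l ke (<-trans hlt lt) q) r₁
        where
        r₁ : ∀ e → e ≢ i₀ → e ≢ i₁ → i₁ Fin.< e → 1 ≤ h e → h e < p₁ → a e < a i₁ → a e < w i₁
        r₁ e n m l ke hlt q with h e <? p₀
        ... | yes hlt′ = right₁ S n m l ke hlt′ q
        ... | no nlt = ⊥-elim (<-asym q (proj₂ (FromG.r₁ hg lt V n m l k₀ ke) (≮⇒≥ nlt)))

  module _ (N : ℕ) where

    private
      move : Vec ℕ L → Vec ℕ L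
      move = swapV i
      moved : ∀ (v : Vec ℕ L) c → lookup (move v) c ≡ lookup v (σ c)
      moved = lookup-swapV i

    module Unordered (hs as : Vec ℕ L) (dead : lookup hs i₀ ≡ 0) where
      private
        h = lookup hs
        g = lookup (move hs)
        gh : ∀ c → h c ≡ g (σ c)
        gh c = sym (trans (moved hs (σ c)) (cong h (σ-invol c)))
        back : ∀ (v : Vec ℕ L) c → lookup v c ≡ lookup (move v) (σ c)
        back v c = sym (trans (moved v (σ c)) (cong (lookup v) (σ-invol c)))
        dead′ : g i₁ ≡ 0
        dead′ = trans (moved hs i₁) (trans (cong h σi₁) dead)
        absurd₀ : ∀ {A : Set} → 1 ≤ h i₀ → A
        absurd₀ k = ⊥-elim (<⇒≢ k (sym dead))
        absurd₁ : ∀ {A : Set} → 1 ≤ g i₁ → A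
        absurd₁ k = ⊥-elim (<⇒≢ k (sym dead′))

      valid⇒ : Valid hs as → Valid (move hs) (move as)
      valid⇒ V = valid-moved {g = g} (moved hs) (moved as) V λ _ k → absurd₀ k

      valid⇐ : Valid (move hs) (move as) → Valid hs as
      valid⇐ V = valid-moved {g = h} gh (back as) V λ k _ → absurd₁ k

      step⇒ : ∀ ws → Step hs as ws → Step (move hs) (move as) (move ws)
      step⇒ ws S = step-moved {g = g} (moved hs) (moved as) (moved ws) S λ k _ _ → absurd₀ k

      step⇐ : ∀ ws → Step (move hs) (move as) (move ws) → Step hs as ws
      step⇐ ws S = step-moved {g = h} gh (back as) (back ws) S λ _ lt _ → absurd₁ (≤-trans (s≤s z≤n) lt)

    lower-move : ∀ hs → lower (move hs) ≡ move (lower hs)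
    lower-move hs = map-swapV pred i hs

    -- A position of height 0 imposes no condition, so exchanging it with its neighbour, labels
    -- included, only renames columns. In the exchange identity this takes over once the shorter
    -- column has ended.
    G-move : ∀ k hs as → lookup hs i₀ ≡ 0 → G N k hs as ≗ G N k (move hs) (move as)
    F-move : ∀ k hs as → lookup hs i₀ ≡ 0 → F N k hs as ≗ F N k (move hs) (move as)
    F-move k hs as dead e = trans (mulRow-cong hs as (G-move k hs as dead) e)
      (sym (mulRow-swapV i hs as (G N k (move hs) (move as)) e))
    G-move zero    hs as dead e = cong (λ f → f e) (χ-cong (valid? hs as) (valid? (move hs) (move as)) valid⇒ valid⇐)
      where open Unordered hs as dead
    G-move (suc k) hs as dead e = trans
        (cong (λ f → f e) (χ-cong (valid? hs as) (valid? (move hs) (move as)) valid⇒ valid⇐))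
        (χ-at (valid? (move hs) (move as)) e sums)
      where
      open Unordered hs as dead
      row : ∀ ws → χ (step? hs as ws) (F N k (lower hs) ws) e ≡
        χ (step? (move hs) (move as) (move ws)) (F N k (lower (move hs)) (move ws)) e
      row ws = trans (cong (λ f → f e) (χ-cong (step? hs as ws) (step? (move hs) (move as) (move ws)) (step⇒ ws) (step⇐ ws)))
        (χ-at (step? (move hs) (move as) (move ws)) e (trans
          (F-move k (lower hs) ws (trans (lookup-map i₀ pred hs) (cong pred dead)) e)
          (cong (λ gs → F N k gs (move ws) e) (sym (lower-move hs)))))
      sums : Σbox N (lower hs) (λ ws → χ (step? hs as ws) (F N k (lower hs) ws) e) ≡
        Σbox N (lower (move hs)) (λ ws → χ (step? (move hs) (move as) ws) (F N k (lower (move hs)) ws) e)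
      sums = trans (Σbox-cong N (lower hs) row)
        (trans (sym (Σbox-swapV N i (lower hs) new)) (cong (λ gs → Σbox N gs new) (sym (lower-move hs))))
        where
        new : Vec ℕ L → ℕ
        new ws = χ (step? (move hs) (move as) ws) (F N k (lower (move hs)) ws) e

    alive-move : ∀ hs → Alive hs i₀ → Alive hs i₁ → SameShape hs (move hs)
    alive-move hs al₀ al₁ c = (λ al → subst (1 ≤_) (sym (moved hs c)) (to c al)) ,
        (λ al → subst (Alive hs) (σ-invol c) (to (σ c) (subst (1 ≤_) (moved hs c) al)))
      where
      to : ∀ c → Alive hs c → Alive hs (σ c)
      to c al with c Finₚ.≟ i₀ | c Finₚ.≟ i₁
      ... | yes refl | _ = subst (Alive hs) (sym σi₀) al₁
      ... | no _ | yes refl = subst (Alive hs) (sym σi₁) al₀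
      ... | no n | no m = subst (Alive hs) (sym (σ-other n m)) al

    -- Stated for every basement that increases from `i₀` to `i₁`, because the induction meets
    -- arbitrary rows in place of the standard basement.
    Exchanged : ℕ → Set
    Exchanged k = ∀ hs as → Bounded k hs → Alive hs i₀ → lookup hs i₀ < lookup hs i₁ →
      lookup as i₀ < lookup as i₁ → G N k hs as ≗ G N k (move hs) as ⊕ G N k (move hs) (move as)

    F-exchanged : ∀ k → Exchanged k → ∀ hs as → Bounded k hs → Alive hs i₀ → lookup hs i₀ < lookup hs i₁ →
      lookup as i₀ < lookup as i₁ → F N k hs as ≗ F N k (move hs) as ⊕ F N k (move hs) (move as)
    F-exchanged k ex hs as fuel al lt q e = trans (mulRow-cong hs as (ex hs as fuel al lt q) e)
      (trans (mulRow-⊕ hs as _ _ e) (cong₂ _+_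
        (mulRow-shape hs (move hs) as _ (alive-move hs al (≤-trans al (<⇒≤ lt))) e)
        (sym (mulRow-swapV i hs as (G N k (move hs) (move as)) e))))

    module ExchangeStep (k : ℕ) (ex : Exchanged k) (hs as : Vec ℕ L) (fuel : Bounded (suc k) hs)
        (al : Alive hs i₀) (lt : lookup hs i₀ < lookup hs i₁) (a₀<a₁ : lookup as i₀ < lookup as i₁) where

      private
        module C = Claims {h = lookup hs} {g = lookup (move hs)} {a = lookup as} {b = lookup (move as)}
          (moved hs) (moved as) al lt a₀<a₁
        low = lower hs
        f̂ : Vec ℕ L → Poly
        f̂ ws = F N k (move low) ws
        unmoved? : ∀ ws → Dec (Valid (move hs) as × Step (move hs) as ws)
        unmoved? ws = valid? (move hs) as ×-dec step? (move hs) as ws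
        moved? : ∀ ws → Dec (Valid (move hs) (move as) × Step (move hs) (move as) ws)
        moved? ws = valid? (move hs) (move as) ×-dec step? (move hs) (move as) ws
        -- The contribution of one upper row to the two summands on the exchanged columns; by
        -- `step-exclusive` at most one of the two conditions holds.
        T : Vec ℕ L → Poly
        T ws = χ (unmoved? ws) (f̂ ws) ⊕ χ (moved? ws) (f̂ ws)
        left : Vec ℕ L → Poly
        left ws = χ (step? hs as ws) (F N k low ws)

        right-side : G N (suc k) (move hs) as ⊕ G N (suc k) (move hs) (move as) ≗ ΣPoly N (move low) T
        right-side e = trans (cong₂ _+_ (side as) (side (move as)))
          (sym (Σbox-+ N (move low) (λ ws → χ (unmoved? ws) (f̂ ws) e) (λ ws → χ (moved? ws) (f̂ ws) e)))
          where
          side : ∀ bs → G N (suc k) (move hs) bs e ≡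
            Σbox N (move low) (λ ws → χ (valid? (move hs) bs ×-dec step? (move hs) bs ws) (f̂ ws) e)
          side bs = trans (χ-Σ N (lower (move hs)) (valid? (move hs) bs) (step? (move hs) bs) (F N k (lower (move hs))) e)
            (cong (λ gs → Σbox N gs (λ ws → χ (valid? (move hs) bs ×-dec step? (move hs) bs ws) (F N k gs ws) e)) (lower-move hs))

        -- An upper row that is invalid on the exchanged columns has series 0, so the equivalence of
        -- the step conditions matters for valid rows only.
        row-sum : ∀ ws vs → (Valid (move low) vs →
            (Step hs as ws → (Valid (move hs) as × Step (move hs) as vs) ⊎ (Valid (move hs) (move as) × Step (move hs) (move as) vs)) ×
            ((Valid (move hs) as × Step (move hs) as vs) ⊎ (Valid (move hs) (move as) × Step (move hs) (move as) vs) → Step hs as ws)) →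
          χ (step? hs as ws) (f̂ vs) ≗ T vs
        row-sum ws vs iff e with valid? (move low) vs
        ... | no n = trans (χ-zero (step? hs as ws) e z) (sym (cong₂ _+_ (χ-zero (unmoved? vs) e z) (χ-zero (moved? vs) e z)))
          where
          z : f̂ vs e ≡ 0
          z = F-invalid N k (move low) vs n e
        ... | yes V = χ-⊎ (step? hs as ws) (unmoved? vs) (moved? vs) (proj₁ (iff V)) (proj₂ (iff V))
          (λ A B → step-exclusive (moved hs) lt a₀<a₁ al (moved as) (proj₂ A) (proj₂ B)) e

        V₂ : ∀ vs → Valid (move low) vs → ValidF 2 (lookup (move hs)) (lookup vs)
        V₂ vs V = valid-lower {hs = move hs} {ws = vs} (subst (λ gs → Valid gs vs) (sym (lower-move hs)) V)

        moved-row : Valid hs as → ∀ ws → (2 ≤ lookup hs i₀ → lookup ws i₀ < lookup ws i₁) →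
          χ (step? hs as ws) (f̂ (move ws)) ≗ T (move ws)
        moved-row V ws w₀<w₁ = row-sum ws (move ws) λ V′ →
          (λ S → C.moved-to (moved ws) w₀<w₁ (V₂ (move ws) V′) V S) , C.moved-from (moved ws) w₀<w₁

        unmoved-row : Valid hs as → 2 ≤ lookup hs i₀ → ∀ ws → lookup ws i₀ < lookup ws i₁ →
          χ (step? hs as ws) (f̂ ws) ≗ T ws
        unmoved-row V kp ws w₀<w₁ = row-sum ws ws λ V′ →
          (λ S → C.unmoved-to kp w₀<w₁ (V₂ ws V′) V S) , C.unmoved-from kp w₀<w₁

        -- The shorter column is empty above the basement, so in the rows above only a position of
        -- height 0 is moved, and `F-move` replaces the induction hypothesis.
        short : Valid hs as → lookup hs i₀ ≤ 1 → ΣPoly N low left ≗ ΣPoly N (move low) T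
        short V h₀≤1 e = trans (Σbox-cong N low λ ws →
            trans (χ-at (step? hs as ws) e (F-move k low ws dead e)) (moved-row V ws (λ kp → ⊥-elim (<⇒≱ kp h₀≤1)) e))
          (sym (Σbox-swapV N i low (λ ws → T ws e)))
          where
          dead : lookup low i₀ ≡ 0
          dead = trans (lookup-map i₀ pred hs) (n≤0⇒n≡0 (pred-mono-≤ h₀≤1))

        -- On the left only upper rows that increase from `i₀` to `i₁` count, whereas on the right
        -- both orders can occur. Rows are therefore compared in pairs `ws`, `move ws`: the
        -- induction hypothesis splits the term of the increasing member into two, one for each
        -- member of the pair.
        module Tall (V : Valid hs as) (kp : 2 ≤ lookup hs i₀) where
          al₀ : Alive low i₀
          al₀ = alive-lower {hs = hs} kp
          lt′ : lookup low i₀ < lookup low i₁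
          lt′ = lower-< {hs = hs} al lt
          fuel′ : Bounded k low
          fuel′ = lower-bounded {hs = hs} fuel
          disordered : ∀ ws → lookup ws i₁ ≤ lookup ws i₀ → ¬ Valid low ws
          disordered ws le V′ = <⇒≱ (proj₂ (V′ i₀ i₁ i₀<i₁ al₀ (≤-trans al₀ (<⇒≤ lt′))) (<⇒≤ lt′)) le
          left-zero : ∀ ws → lookup ws i₁ ≤ lookup ws i₀ → left ws ≗ (λ _ → 0)
          left-zero ws le e = χ-zero (step? hs as ws) e (F-invalid N k low ws (disordered ws le) e)
          move₀ : ∀ ws → lookup (move ws) i₀ ≡ lookup ws i₁
          move₀ ws = trans (moved ws i₀) (cong (lookup ws) σi₀)
          move₁ : ∀ ws → lookup (move ws) i₁ ≡ lookup ws i₀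
          move₁ ws = trans (moved ws i₁) (cong (lookup ws) σi₁)
          increasing : ∀ ws → lookup ws i₀ < lookup ws i₁ → left ws ⊕ left (move ws) ≗ T ws ⊕ T (move ws)
          increasing ws q e = trans (cong₂ _+_
              (trans (χ-at (step? hs as ws) e (F-exchanged k ex low ws fuel′ al₀ lt′ q e))
                (trans (χ-⊕ (step? hs as ws) (f̂ ws) (f̂ (move ws)) e)
                  (cong₂ _+_ (unmoved-row V kp ws q e) (moved-row V ws (λ _ → q) e))))
              (left-zero (move ws) (subst₂ _≤_ (sym (move₁ ws)) (sym (move₀ ws)) (<⇒≤ q)) e))
            (+-identityʳ _)
          orbit : ∀ ws → left ws ⊕ left (move ws) ≗ T ws ⊕ T (move ws)
          orbit ws e with <-cmp (lookup ws i₀) (lookup ws i₁)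
          ... | tri< q _ _ = increasing ws q e
          ... | tri> _ _ q = trans (+-comm (left ws e) _)
                (trans (cong (λ v → left (move ws) e + left v e) (sym (swapV-invol i ws)))
                (trans (increasing (move ws) (subst₂ _<_ (sym (move₀ ws)) (sym (move₁ ws)) q) e)
                (trans (cong (λ v → T (move ws) e + T v e) (swapV-invol i ws)) (+-comm (T (move ws) e) _))))
          ... | tri≈ _ q _ = trans (cong₂ _+_ (left-zero ws (≤-reflexive (sym q)) e)
                  (left-zero (move ws) (≤-reflexive (trans (move₁ ws) (trans q (sym (move₀ ws))))) e))
                (sym (cong₂ _+_ (T-zero ws q) (T-zero (move ws) (trans (move₀ ws) (trans (sym q) (sym (move₁ ws)))))))
            where
            T-zero : ∀ vs → lookup vs i₀ ≡ lookup vs i₁ → T vs e ≡ 0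
            T-zero vs q = cong₂ _+_ (χ-zero (unmoved? vs) e z) (χ-zero (moved? vs) e z)
              where
              z : f̂ vs e ≡ 0
              z = F-invalid N k (move low) vs (λ V′ → proj₁ (V′ i₀ i₁ i₀<i₁
                (proj₁ (alive-move low al₀ (≤-trans al₀ (<⇒≤ lt′)) i₀) al₀)
                (proj₁ (alive-move low al₀ (≤-trans al₀ (<⇒≤ lt′)) i₁) (≤-trans al₀ (<⇒≤ lt′)))) q) e
          -- Each row occurs once as `ws` and once as `move ws`; the factor 2 is cancelled in
          -- `tall`.
          double : ∀ f → Σbox N low (λ ws → f ws + f (move ws)) ≡ Σbox N low f + Σbox N low f
          double f = trans (Σbox-+ N low f (λ ws → f (move ws))) (cong (Σbox N low f +_)
            (trans (sym (Σbox-swapV N i low f)) (sym (Σbox-shape N low (move low) f (alive-move low al₀ (≤-trans al₀ (<⇒≤ lt′)))))))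
          tall : ΣPoly N low left ≗ ΣPoly N (move low) T
          tall e = trans (m+m-injective (trans (sym (double (λ ws → left ws e)))
              (trans (Σbox-cong N low λ ws → orbit ws e) (double (λ ws → T ws e)))))
            (Σbox-shape N low (move low) _ (alive-move low al₀ (≤-trans al₀ (<⇒≤ lt′))))

      exchange-step : G N (suc k) hs as ≗ G N (suc k) (move hs) as ⊕ G N (suc k) (move hs) (move as)
      exchange-step e with valid? hs as
      ... | no n = sym (cong₂ _+_ (cong (λ f → f e) (G-invalid N (suc k) {move hs} {as} (λ V → n (C.unmoved-valid V))))
                                  (cong (λ f → f e) (G-invalid N (suc k) {move hs} {move as} (λ V → n (C.moved-valid V)))))
      ... | yes V with lookup hs i₀ ≤? 1
      ...   | yes h₀≤1 = trans (short V h₀≤1 e) (sym (right-side e))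
      ...   | no h₀≰1 = trans (Tall.tall V (≰⇒> h₀≰1) e) (sym (right-side e))

    exchange : ∀ k → Exchanged k
    exchange zero    hs as fuel al = ⊥-elim (<⇒≱ al (fuel i₀))
    exchange (suc k) hs as fuel al lt q = ExchangeStep.exchange-step k (exchange k) hs as fuel al lt q

-- The standard basement

ids : ∀ n → Vec ℕ n
ids zero    = []
ids (suc n) = 0 ∷ map suc (ids n)

lookup-ids : ∀ {n} (c : Fin n) → lookup (ids n) c ≡ toℕ c
lookup-ids zero    = refl
lookup-ids {suc n} (suc c) = trans (lookup-map c suc (ids n)) (cong suc (lookup-ids c))

ids-increasing : ∀ {n} {c d : Fin n} → c Fin.< d → lookup (ids n) c < lookup (ids n) d
ids-increasing {c = c} {d} l = subst₂ _<_ (sym (lookup-ids c)) (sym (lookup-ids d)) l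

ids-valid : ∀ {n} (hs : Vec ℕ n) → Valid hs (ids n)
ids-valid hs c d l _ _ = <⇒≢ (ids-increasing l) , λ _ → ids-increasing l

-- Weakly decreasing compositions: the only filling has constant columns.

monomial : List ℕ → Poly
monomial []      []      = 1
monomial []      (_ ∷ _) = 0
monomial (_ ∷ _) []      = 0
monomial (a ∷ α) (x ∷ e) = onlyIf 0 (x ≟ a) (monomial α e)

monomial-refl : ∀ α → monomial α α ≡ 1
monomial-refl []      = refl
monomial-refl (a ∷ α) with a ≟ a
... | yes _ = monomial-refl α
... | no n = ⊥-elim (n refl)

monomial-≢ : ∀ α e → e ≢ α → monomial α e ≡ 0
monomial-≢ []      []      n = ⊥-elim (n refl)
monomial-≢ []      (_ ∷ _) n = refl
monomial-≢ (_ ∷ _) []      n = refl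
monomial-≢ (a ∷ α) (x ∷ e) n with x ≟ a
... | yes refl = monomial-≢ α e λ q → n (cong (a ∷_) q)
... | no _ = refl

mulRow-∷ : ∀ {L} (hs as : Vec ℕ L) f x e → mulRow hs (map suc as) f (x ∷ e) ≡ mulRow hs as (λ e′ → f (x ∷ e′)) e
mulRow-∷ []           []       f x e = refl
mulRow-∷ (zero ∷ hs)  (a ∷ as) f x e = mulRow-∷ hs as f x e
mulRow-∷ (suc h ∷ hs) (a ∷ as) f x e = cong (λ v → guard 0 v (at e a)) (mulRow-∷ hs as f x (decAt a e))

-- Over the standard basement the row monomial is the product of the variables of the living
-- columns, which restores the 1 that `lower` takes from each positive height.
mulRow-monomial : ∀ {n} (hs : Vec ℕ n) e → length e ≡ n →
  mulRow hs (ids n) (monomial (toList (lower hs))) e ≡ monomial (toList hs) e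
mulRow-monomial []           []      q = refl
mulRow-monomial {suc n} (zero ∷ hs) (x ∷ e) q = trans (mulRow-∷ hs (ids n) (monomial (0 ∷ toList (lower hs))) x e) (go x)
  where
  go : ∀ x → mulRow hs (ids n) (λ e′ → onlyIf 0 (x ≟ 0) (monomial (toList (lower hs)) e′)) e ≡ onlyIf 0 (x ≟ 0) (monomial (toList hs) e)
  go zero    = mulRow-monomial hs e (suc-injective q)
  go (suc x) = mulRow-0 hs (ids n) e
mulRow-monomial {suc n} (suc h ∷ hs) (zero ∷ e)  q = refl
mulRow-monomial {suc n} (suc h ∷ hs) (suc x ∷ e) q =
  trans (mulRow-∷ hs (ids n) (monomial (h ∷ toList (lower hs))) x e) go
  where
  go : mulRow hs (ids n) (λ e′ → onlyIf 0 (x ≟ h) (monomial (toList (lower hs)) e′)) e ≡ onlyIf 0 (suc x ≟ suc h) (monomial (toList hs) e)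
  go with x ≟ h | suc x ≟ suc h
  ... | yes _ | yes _ = mulRow-monomial hs e (suc-injective q)
  ... | yes r | no n = ⊥-elim (n (cong suc r))
  ... | no n | yes r = ⊥-elim (n (suc-injective r))
  ... | no _ | no _ = mulRow-0 hs (ids _) e

Σ<-single : ∀ N F a → a < N → (∀ b → b ≢ a → F b ≡ 0) → Σ< N F ≡ F a
Σ<-single (suc N) F a a<N z with a ≟ N
... | yes refl = trans (cong (_+ F N) (trans (Σ<-cong-< N λ b l → z b (<⇒≢ l)) (Σ<-0 N))) refl
... | no n = trans (cong₂ _+_ (Σ<-single N F a (≤∧≢⇒< (≤-pred a<N) n) z) (z N λ q → n (sym q))) (+-identityʳ _)

Σbox-single : ∀ {L} N (hs w : Vec ℕ L) F → (∀ c → Alive hs c → lookup w c < N) →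
  (∀ c → lookup hs c ≡ 0 → lookup w c ≡ 0) → (∀ v → (∃[ c ] (Alive hs c × lookup v c ≢ lookup w c)) → F v ≡ 0) →
  Σbox N hs F ≡ F w
Σbox-single N []           []      F b d z = refl
Σbox-single N (zero ∷ hs)  (a ∷ w) F b d z with d zero refl
... | refl = Σbox-single N hs w (λ v → F (0 ∷ v)) (λ c → b (suc c)) (λ c → d (suc c)) λ { v (c , al , n) → z (0 ∷ v) (suc c , al , n) }
Σbox-single N (suc h ∷ hs) (a ∷ w) F b d z = trans
  (Σ<-single N _ a (b zero (s≤s z≤n)) λ x x≢a → trans (Σbox-cong N hs λ v → z (x ∷ v) (zero , s≤s z≤n , x≢a)) (Σbox-0 N hs))
  (Σbox-single N hs w (λ v → F (a ∷ v)) (λ c → b (suc c)) (λ c → d (suc c)) λ { v (c , al , n) → z (a ∷ v) (suc c , al , n) })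

δ₀-monomial : ∀ {n} (hs : Vec ℕ n) e → length e ≡ n → (∀ c → lookup hs c ≡ 0) → δ₀ e ≡ monomial (toList hs) e
δ₀-monomial []       []          q z = refl
δ₀-monomial (h ∷ hs) (x ∷ e) q z with z zero
δ₀-monomial (h ∷ hs) (zero ∷ e)  q z | refl = δ₀-monomial hs e (suc-injective q) (λ c → z (suc c))
δ₀-monomial (h ∷ hs) (suc x ∷ e) q z | refl = refl

module _ {n : ℕ} where

  Sorted : Vec ℕ n → Set
  Sorted hs = ∀ c d → c Fin.< d → lookup hs d ≤ lookup hs c

  sorted-lower : ∀ {hs} → Sorted hs → Sorted (lower hs)
  sorted-lower {hs} s c d l = lower-≤ {hs = hs} (s c d l)

  -- The identity row, with the entry 0 that `Σbox` prescribes in columns of height 0.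
  restricted : Vec ℕ n → Vec ℕ n
  restricted hs = zipWith (λ h a → guard 0 a h) hs (ids n)

  lookup-restricted : ∀ hs c → Alive hs c → lookup (restricted hs) c ≡ toℕ c
  lookup-restricted hs c al rewrite lookup-zipWith (λ h a → guard 0 a h) c hs (ids n) with lookup hs c | al
  ... | suc h | _ = lookup-ids c

  restricted-dead : ∀ hs c → lookup hs c ≡ 0 → lookup (restricted hs) c ≡ 0
  restricted-dead hs c d rewrite lookup-zipWith (λ h a → guard 0 a h) c hs (ids n) | d = refl

  -- Labels do not increase, so column c carries at most c. If it carried some d < c, then column d,
  -- which is at least as tall, would by induction carry d as well.
  forced : ∀ {hs as ws} → Sorted hs → (∀ c → Alive hs c → lookup as c ≡ toℕ c) → Step hs as ws → Valid (lower hs) ws →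
    ∀ c → 2 ≤ lookup hs c → lookup ws c ≡ toℕ c
  forced {hs} {as} {ws} so id (S₁ , _) V c k = go (toℕ c) c refl k (<-wellFounded (toℕ c))
    where
    go : ∀ m c → toℕ c ≡ m → 2 ≤ lookup hs c → Acc _<_ m → lookup ws c ≡ toℕ c
    go m c refl k (acc rs) with <-cmp (lookup ws c) (toℕ c)
    ... | tri≈ _ q _ = q
    ... | tri> _ _ q = ⊥-elim (<⇒≱ q (subst (lookup ws c ≤_) (id c (<⇒≤ k)) (S₁ c k)))
    ... | tri< q _ _ = ⊥-elim (<-irrefl (trans (sym td) (cong toℕ (sym c≡d))) q)
      where
      d : Fin n
      d = fromℕ< (<-trans q (Finₚ.toℕ<n c))
      td : toℕ d ≡ lookup ws c
      td = Finₚ.toℕ-fromℕ< _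
      kd : 2 ≤ lookup hs d
      kd = ≤-trans k (so d c (subst (_< toℕ c) (sym td) q))
      c≡d : c ≡ d
      c≡d = valid-distinct {h = lookup (lower hs)} {a = lookup ws} V (alive-lower {hs = hs} k) (alive-lower {hs = hs} kd)
        (trans (sym td) (sym (go (toℕ d) d refl kd (rs (subst (_< toℕ c) (sym td) q)))))

  G-sorted : ∀ k hs as e → Bounded k hs → Sorted hs → (∀ c → Alive hs c → lookup as c ≡ toℕ c) →
    length e ≡ n → G n k hs as e ≡ monomial (toList (lower hs)) e
  G-sorted zero    hs as e fuel so id q = trans (cong (λ f → f e) (χ-yes (valid? hs as)
      λ c d _ al _ → ⊥-elim (<⇒≱ al (fuel c)))) (δ₀-monomial (lower hs) e q λ c → trans (lookup-map c pred hs) (cong pred (n≤0⇒n≡0 (fuel c))))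
  G-sorted (suc k) hs as e fuel so id q = trans (cong (λ f → f e) (χ-yes (valid? hs as) valid))
      (trans (Σbox-single n low w _ (λ c al → subst (_< n) (sym (lookup-restricted low c al)) (Finₚ.toℕ<n c)) (restricted-dead low) others)
      (trans (cong (λ f → f e) (χ-yes (step? hs as w) step))
      (trans (mulRow-labels low w (ids n) _ (λ c al → trans (lookup-restricted low c al) (sym (lookup-ids c))) e)
      (trans (mulRow-cong-on (λ e → length e ≡ n) (λ i e q → trans (length-decAt i e) q) low (ids n)
        (λ e q → G-sorted k low w e fuel′ (sorted-lower {hs} so) (lookup-restricted low) q) e q)
        (mulRow-monomial low e q)))))
    where
    low = lower hs
    w = restricted low
    fuel′ : Bounded k low
    fuel′ = lower-bounded {hs = hs} fuel
    valid : Valid hs as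
    valid c d l alc ald rewrite id c alc | id d ald = <⇒≢ l , λ _ → l
    step : Step hs as w
    step = (λ c kc → ≤-reflexive (trans (lookup-restricted low c (alive-lower {hs = hs} kc)) (sym (id c (<⇒≤ kc))))) ,
      λ c d l ald lt q → ⊥-elim (<-asym l (subst₂ _<_ (id d ald) (id c (≤-trans ald (<⇒≤ lt))) q))
    others : ∀ v → (∃[ c ] (Alive low c × lookup v c ≢ lookup w c)) → χ (step? hs as v) (F n k low v) e ≡ 0
    others v (c , al , v≢w) with step? hs as v
    ... | no _ = refl
    ... | yes S with valid? low v
    ...   | no nv = F-invalid n k low v nv e
    ...   | yes V = ⊥-elim (v≢w (trans (forced {hs} {as} {v} so id S V c (alive-lower⁻ {hs = hs} al)) (sym (lookup-restricted low c al))))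

-- The recursion defining key polynomials

module _ {n : ℕ} (k : ℕ) (i : ℕ) (i₀ i₁ : Fin n) (q₀ : toℕ i₀ ≡ i) (q₁ : toℕ i₁ ≡ suc i) where

  open Adjacent i i₀ i₁ q₀ q₁

  -- The link between the two inductions: on the standard basement, exchanging the positions i and i
  -- + 1 is the same as exchanging the labels i and i + 1.
  swapV-ids : ∀ (hs : Vec ℕ n) → (∀ c → Alive hs c) → swapV i (ids n) ≡ act i hs (ids n)
  swapV-ids hs al = Pointwise-≡⇒≡ (ext λ c → trans (lookup-swapV i (ids n) c) (trans (lookup-ids (swF i c))
    (trans (toℕ-swF i c i<L) (trans (cong (sw i) (sym (lookup-ids c))) (sym (lookup-act i hs (ids n) c (al c)))))))

  -- T₂ = T + T′ where T₂ and x_i T′ are symmetric in x_i and x_{i+1}, so ξ_i T = ξ_i T₂ - ξ_i T′ = T₂.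
  demazure : ∀ (hs : Vec ℕ n) → Bounded k hs → (∀ c → Alive hs c) → lookup hs i₀ < lookup hs i₁ →
    ∀ e → suc i < length e →
    mul i (G n k hs (ids n)) e + mul (suc i) (swapped i (G n k (swapV i hs) (ids n))) e ≡
    mul i (G n k (swapV i hs) (ids n)) e + mul (suc i) (G n k hs (ids n)) e
  demazure hs fuel al lt e l = begin
      mul i T₂ e + mul (suc i) (swapped i T) e
    ≡⟨ cong (_+ mul (suc i) (swapped i T) e) (trans (mul-cong i split e) (mul-⊕ i T T′ e)) ⟩
      (mul i T e + mul i T′ e) + mul (suc i) (swapped i T) e
    ≡⟨ trans (+-assoc (mul i T e) _ _) (cong (mul i T e +_) (trans (cong (_+ mul (suc i) (swapped i T) e) T′-sym) (+-comm (mul (suc i) (swapped i T′) e) _))) ⟩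
      mul i T e + (mul (suc i) (swapped i T) e + mul (suc i) (swapped i T′) e)
    ≡⟨ cong (mul i T e +_) (sym (mul-⊕ (suc i) (swapped i T) (swapped i T′) e)) ⟩
      mul i T e + mul (suc i) (swapped i T ⊕ swapped i T′) e
    ≡⟨ cong (mul i T e +_) (cong (λ v → guard 0 v (at e (suc i))) (trans (sym (split (swapAt (decAt (suc i) e) i)))
        (T₂-sym (decAt (suc i) e) (length-decAt-< {i} (suc i) e l)))) ⟩
      mul i T e + mul (suc i) T₂ e ∎
    where
    open ≡-Reasoning
    hs′ = swapV i hs
    T₂ = G n k hs (ids n)
    T  = G n k hs′ (ids n)
    T′ = G n k hs′ (act i hs′ (ids n))
    al′ : ∀ c → Alive hs′ c
    al′ c = subst (1 ≤_) (sym (lookup-swapV i hs c)) (al _)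
    fuel′ : ∀ c → lookup hs′ c ≤ k
    fuel′ c = subst (_≤ k) (sym (lookup-swapV i hs c)) (fuel _)
    lt′ : lookup hs′ i₁ < lookup hs′ i₀
    lt′ = subst₂ _<_ (sym (trans (lookup-swapV i hs i₁) (cong (lookup hs) σi₁))) (sym (trans (lookup-swapV i hs i₀) (cong (lookup hs) σi₀))) lt
    id₀ : lookup (ids n) i₀ ≡ i
    id₀ = trans (lookup-ids i₀) q₀
    id₁ : lookup (ids n) i₁ ≡ suc i
    id₁ = trans (lookup-ids i₁) q₁
    split : T₂ ≗ T ⊕ T′
    split e = trans (Exchange.exchange i i₀ i₁ q₀ q₁ n k hs (ids n) fuel (al i₀) lt (ids-increasing i₀<i₁) e)
      (cong (λ as → T e + G n k hs′ as e) (swapV-ids hs′ al′))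
    T₂-sym : Symm i T₂
    T₂-sym = GSymmetries.ordered (G-symmetries i n i<L k) hs (ids n) i₀ i₁ (ids-valid hs) fuel (al i₀) (al i₁) id₀ id₁ i₀<i₁ (<⇒≤ lt)
    act₀ : lookup (act i hs′ (ids n)) i₀ ≡ suc i
    act₀ = act-p i hs′ (ids n) (al′ i₀) id₀
    act₁′ : lookup (act i hs′ (ids n)) i₁ ≡ i
    act₁′ = act-suc i hs′ (ids n) (al′ i₁) id₁
    valid′ : Valid hs′ (act i hs′ (ids n))
    valid′ = RowStep.crossing-valid i hs′ (ids n) (ids-valid hs′) (act-swapped hs′ (ids n)) (al′ i₀) (al′ i₁) id₀ id₁ lt′
    T′-sym : mul i T′ e ≡ mul (suc i) (swapped i T′) e
    T′-sym = trans (sym (GSymmetries.crossed (G-symmetries i n i<L k) hs′ (act i hs′ (ids n)) i₀ i₁ valid′ fuel′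
        (al′ i₀ , act₀ , λ d ald q → subst (λ d → i₀ Fin.< d × lookup hs′ d < lookup hs′ i₀)
          (valid-distinct {h = lookup hs′} valid′ (al′ i₁) ald (trans act₁′ (sym q))) (i₀<i₁ , lt′)) (al′ i₁) act₁′ e l))
      (trans (mul-swapped i i T′ e l) (cong (λ j → mul j (swapped i T′) e) (sw-p i)))

-- Comparison with an arbitrary family of key polynomials

toList-swapV : ∀ {n} i (v : Vec ℕ n) → toList (swapV i v) ≡ swapAt (toList v) i
toList-swapV zero    []          = refl
toList-swapV (suc i) []          = refl
toList-swapV zero    (x ∷ [])    = refl
toList-swapV zero    (x ∷ y ∷ v) = refl
toList-swapV (suc i) (x ∷ v)     = trans (cong (x ∷_) (toList-swapV i v)) (sym (swapAt-∷ x (toList v) i))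

at-toList : ∀ {n} (v : Vec ℕ n) c → at (toList v) (toℕ c) ≡ lookup v c
at-toList (x ∷ v) zero    = refl
at-toList (x ∷ v) (suc c) = at-toList v c

Ascent : ∀ {n} → Vec ℕ n → Set
Ascent {n} v = ∃[ i ] ∃[ i₀ ] ∃[ i₁ ] (toℕ {n} i₀ ≡ i × toℕ {n} i₁ ≡ suc i × lookup v i₀ < lookup v i₁)

ascent? : ∀ {n} (v : Vec ℕ n) → Ascent v ⊎ Linked _≥_ (toList v)
ascent? []          = inj₂ []
ascent? (x ∷ [])    = inj₂ [-]
ascent? (x ∷ y ∷ v) with x <? y | ascent? (y ∷ v)
... | yes q | _ = inj₁ (0 , zero , suc zero , refl , refl , q)
... | no _  | inj₁ (i , i₀ , i₁ , q₀ , q₁ , lt) = inj₁ (suc i , suc i₀ , suc i₁ , cong suc q₀ , cong suc q₁ , lt)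
... | no nq | inj₂ l = inj₂ (≮⇒≥ nq ∷ l)

linked-sorted : ∀ {n} (v : Vec ℕ n) → Linked _≥_ (toList v) → ∀ c d → c Fin.< d → lookup v d ≤ lookup v c
linked-sorted (x ∷ y ∷ v) (q ∷ l) zero    (suc zero)    _       = q
linked-sorted (x ∷ y ∷ v) (q ∷ l) zero    (suc (suc d)) _       = ≤-trans (linked-sorted (y ∷ v) l zero (suc d) (s≤s z≤n)) q
linked-sorted (x ∷ y ∷ v) (q ∷ l) (suc c) (suc d)       (s≤s r) = linked-sorted (y ∷ v) l c d r
linked-sorted (x ∷ [])    [-]     (suc ()) _ _
linked-sorted (x ∷ [])    [-]     zero (suc ()) _

-- Weighting the entries by position makes the removal of an ascent x < y lower the sum by y - x;
-- this is the measure of the induction in `key-counts`.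
moment : ∀ {n} → ℕ → Vec ℕ n → ℕ
moment j []      = 0
moment j (x ∷ v) = j * x + moment (suc j) v

moment-swapV : ∀ {n} j i (v : Vec ℕ n) i₀ i₁ → toℕ i₀ ≡ i → toℕ i₁ ≡ suc i → lookup v i₀ < lookup v i₁ →
  moment j (swapV i v) < moment j v
moment-swapV j zero (x ∷ y ∷ v) zero (suc zero) q₀ q₁ lt =
  subst₂ _<_ (eq j x y (moment (suc (suc j)) v)) (eq′ j x y (moment (suc (suc j)) v)) (+-monoʳ-< (j * x + j * y + moment (suc (suc j)) v) lt)
  where
  eq : ∀ j x y r → j * x + j * y + r + x ≡ j * y + (suc j * x + r)
  eq = solve-∀
  eq′ : ∀ j x y r → j * x + j * y + r + y ≡ j * x + (suc j * y + r)
  eq′ = solve-∀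
moment-swapV j (suc i) (x ∷ v) (suc i₀) (suc i₁) q₀ q₁ lt =
  +-monoʳ-< (j * x) (moment-swapV (suc j) i v i₀ i₁ (suc-injective q₀) (suc-injective q₁) lt)

toℚ-+ : ∀ a b → toℚ (a + b) ≡ toℚ a ℚ.+ toℚ b
toℚ-+ a b = ℚₚ.toℚᵘ-injective (begin
    toℚᵘ (toℚ (a + b))                    ≈⟨ ℚₚ.toℚᵘ-fromℚᵘ (int (a + b)) ⟩
    int (a + b)                           ≈⟨ ℚᵘ.*≡* (cong (ℤ._* ℤ.+ 1) (sym (cong₂ ℤ._+_ (ℤₚ.*-identityʳ (ℤ.+ a)) (ℤₚ.*-identityʳ (ℤ.+ b))))) ⟩
    int a ℚᵘ.+ int b                      ≈⟨ ℚᵘₚ.+-cong (ℚₚ.toℚᵘ-fromℚᵘ (int a)) (ℚₚ.toℚᵘ-fromℚᵘ (int b)) ⟨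
    toℚᵘ (toℚ a) ℚᵘ.+ toℚᵘ (toℚ b)        ≈⟨ ℚₚ.toℚᵘ-homo-+ (toℚ a) (toℚ b) ⟨
    toℚᵘ (toℚ a ℚ.+ toℚ b) ∎)
  where
  open import Relation.Binary.Reasoning.Setoid ℚᵘₚ.≃-setoid
  int : ℕ → ℚᵘ.ℚᵘ
  int n = ℚᵘ.mkℚᵘ (ℤ.+ n) 0

-- Takes the relation of `demazure`, proved in ℕ without subtraction, to the form with differences
-- that `IsKeyFamily` uses.
toℚ-difference : ∀ a b c d → a + b ≡ c + d → toℚ a - toℚ d ≡ toℚ c - toℚ b
toℚ-difference a b c d q = ℚ+.∙-cancelʳ (toℚ b ℚ.+ toℚ d) _ _ (begin
    (toℚ a - toℚ d) ℚ.+ (toℚ b ℚ.+ toℚ d)  ≡⟨ cong ((toℚ a - toℚ d) ℚ.+_) (ℚₚ.+-comm (toℚ b) (toℚ d)) ⟩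
    (toℚ a - toℚ d) ℚ.+ (toℚ d ℚ.+ toℚ b)  ≡⟨ cancel (toℚ a) (toℚ d) (toℚ b) ⟩
    toℚ a ℚ.+ toℚ b                        ≡⟨ toℚ-+ a b ⟨
    toℚ (a + b)                            ≡⟨ cong toℚ q ⟩
    toℚ (c + d)                            ≡⟨ toℚ-+ c d ⟩
    toℚ c ℚ.+ toℚ d                        ≡⟨ cancel (toℚ c) (toℚ b) (toℚ d) ⟨
    (toℚ c - toℚ b) ℚ.+ (toℚ b ℚ.+ toℚ d)  ∎)
  where
  open ≡-Reasoning
  cancel : ∀ x y z → (x - y) ℚ.+ (y ℚ.+ z) ≡ x ℚ.+ z
  cancel x y z = trans (ℚₚ.+-assoc x (ℚ.- y) (y ℚ.+ z)) (cong (x ℚ.+_)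
    (trans (sym (ℚₚ.+-assoc (ℚ.- y) y z)) (trans (cong (ℚ._+ z) (ℚₚ.+-inverseˡ y)) (ℚₚ.+-identityˡ z))))

mulVar-guard : ∀ i f e → mulVar i f e ≡ guard 0ℚ (f (decAt i e)) (at e i)
mulVar-guard i f e with at e i
... | zero  = refl
... | suc _ = refl

mulVar-toℚ : ∀ i (f : Poly) (K : Coeffs) e → K (decAt i e) ≡ toℚ (f (decAt i e)) → mulVar i K e ≡ toℚ (mul i f e)
mulVar-toℚ i f K e q with at e i
... | zero  = refl
... | suc _ = q

incAt : ℕ → List ℕ → List ℕ
incAt i       []      = []
incAt zero    (x ∷ e) = suc x ∷ e
incAt (suc i) (x ∷ e) = x ∷ incAt i e

decAt-incAt : ∀ i e → decAt i (incAt i e) ≡ e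
decAt-incAt zero    []      = refl
decAt-incAt (suc i) []      = refl
decAt-incAt zero    (x ∷ e) = refl
decAt-incAt (suc i) (x ∷ e) = cong (x ∷_) (decAt-incAt i e)

at-incAt : ∀ i e → i < length e → at (incAt i e) i ≡ suc (at e i)
at-incAt zero    (x ∷ e) l       = refl
at-incAt (suc i) (x ∷ e) (s≤s l) = at-incAt i e l

at-incAt-suc : ∀ i e → at (incAt i e) (suc i) ≡ at e (suc i)
at-incAt-suc zero    []      = refl
at-incAt-suc (suc i) []      = refl
at-incAt-suc zero    (x ∷ e) = refl
at-incAt-suc (suc i) (x ∷ e) = at-incAt-suc i e

length-incAt : ∀ i e → length (incAt i e) ≡ length e
length-incAt zero    []      = refl
length-incAt (suc i) []      = refl
length-incAt zero    (x ∷ e) = refl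
length-incAt (suc i) (x ∷ e) = cong suc (length-incAt i e)

-- x_i - x_{i+1} is not a zero divisor.
difference-injective : ∀ {n} (A B : Coeffs) i → suc i < n →
  (∀ e → length e ≡ n → mulVar i A e - mulVar (suc i) A e ≡ mulVar i B e - mulVar (suc i) B e) →
  ∀ e → length e ≡ n → A e ≡ B e
difference-injective {n} A B i i<n eq e q = go (at e (suc i)) e q refl
  where
  first : ∀ (A : Coeffs) e → length e ≡ n → mulVar i A (incAt i e) ≡ A e
  first A e q = trans (mulVar-guard i A (incAt i e)) (cong₂ (guard 0ℚ) (cong A (decAt-incAt i e))
    (at-incAt i e (subst (i <_) (sym q) (<-trans ≤-refl i<n))))
  second : ∀ (A : Coeffs) e → mulVar (suc i) A (incAt i e) ≡ guard 0ℚ (A (decAt (suc i) (incAt i e))) (at e (suc i))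
  second A e = trans (mulVar-guard (suc i) A (incAt i e)) (cong (guard 0ℚ (A (decAt (suc i) (incAt i e)))) (at-incAt-suc i e))
  -- The coefficient of (x_i - x_{i+1}) A at x_i x^e is A e minus, if x_{i+1} divides x^e, a
  -- coefficient whose exponent of x_{i+1} is smaller by one; hence induction on that exponent.
  go : ∀ m e → length e ≡ n → at e (suc i) ≡ m → A e ≡ B e
  go m e q am = trans (sym (first A e q)) (trans (ℚ+.∙-cancelʳ (ℚ.- mulVar (suc i) A (incAt i e)) _ _
      (trans (eq (incAt i e) (trans (length-incAt i e) q)) (cong (λ v → mulVar i B (incAt i e) - v) (same m am))))
    (first B e q))
    where
    same : ∀ m → at e (suc i) ≡ m → mulVar (suc i) B (incAt i e) ≡ mulVar (suc i) A (incAt i e)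
    same zero    am = trans (second B e) (trans (cong (guard 0ℚ _) am) (sym (trans (second A e) (cong (guard 0ℚ _) am))))
    same (suc m) am = trans (second B e) (trans (cong (guard 0ℚ _) am)
      (trans (sym (go m (decAt (suc i) (incAt i e)) (trans (length-decAt (suc i) (incAt i e)) (trans (length-incAt i e) q))
         (trans (at-decAt-≡ (suc i) (incAt i e)) (cong pred (trans (at-incAt-suc i e) am)))))
      (sym (trans (second A e) (cong (guard 0ℚ _) am)))))

module _ (K : List ℕ → Coeffs) (key : IsKeyFamily K) where

  -- If α has an ascent at i, then α = s_i β for the exchanged composition β of smaller `moment`,
  -- and the relation defining K α from K β has only one solution by `difference-injective`. Without
  -- an ascent, α is weakly decreasing and both sides are x^α.
  key-counts : ∀ {n} k (α : Vec ℕ n) → (∀ c → lookup α c < k) → ∀ e → length e ≡ n →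
    K (toList α) e ≡ toℚ (G n k (map suc α) (ids n) e)
  key-counts {n} k α fuel e q = go α (<-wellFounded (moment 0 α)) fuel e q
    where
    go : ∀ α → Acc _<_ (moment 0 α) → (∀ c → lookup α c < k) → ∀ e → length e ≡ n →
      K (toList α) e ≡ toℚ (G n k (map suc α) (ids n) e)
    go α (acc rs) fuel with ascent? α
    ... | inj₂ dec = sorted
      where
      count : ∀ e → length e ≡ n → G n k (map suc α) (ids n) e ≡ monomial (toList α) e
      count e q = trans (G-sorted k (map suc α) (ids n) e
          (λ c → subst (_≤ k) (sym (lookup-map c suc α)) (fuel c))
          (λ c d l → subst₂ _≤_ (sym (lookup-map d suc α)) (sym (lookup-map c suc α)) (s≤s (linked-sorted α dec c d l)))
          (λ c _ → lookup-ids c) q)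
        (cong (λ v → monomial (toList v) e) (lower-suc α))
        where
        lower-suc : ∀ {n} (α : Vec ℕ n) → lower (map suc α) ≡ α
        lower-suc []      = refl
        lower-suc (x ∷ α) = cong (x ∷_) (lower-suc α)
      sorted : ∀ e → length e ≡ n → K (toList α) e ≡ toℚ (G n k (map suc α) (ids n) e)
      sorted e q with proj₁ key (toList α) dec e (trans q (sym (length-toList α))) | Listₚ.≡-dec _≟_ e (toList α)
      ... | one , _ | yes refl = trans (one refl) (cong toℚ (sym (trans (count e q) (monomial-refl e))))
      ... | _ , none | no ne = trans (none ne) (cong toℚ (sym (trans (count e q) (monomial-≢ (toList α) e ne))))
    ... | inj₁ (i , i₀ , i₁ , q₀ , q₁ , lt) = difference-injective _ _ i i<n equation
      where
      open Adjacent i i₀ i₁ q₀ q₁ using (σi₀; σi₁) renaming (i<L to i<n)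
      β = swapV i α
      hs = map suc α
      hs′ = map suc β
      T₂ T : Poly
      T₂ = G n k hs (ids n)
      T  = G n k hs′ (ids n)
      ih : ∀ e → length e ≡ n → K (toList β) e ≡ toℚ (T e)
      ih = go β (rs (moment-swapV 0 i α i₀ i₁ q₀ q₁ lt)) (λ c → subst (_< k) (sym (lookup-swapV i α c)) (fuel _))
      α≡ : swapAt (toList β) i ≡ toList α
      α≡ = trans (sym (toList-swapV i β)) (cong toList (swapV-invol i α))
      descent : at (toList β) (suc i) < at (toList β) i
      descent = subst₂ _<_
        (sym (trans (cong (at (toList β)) (sym q₁)) (trans (at-toList β i₁) (trans (lookup-swapV i α i₁) (cong (lookup α) σi₁)))))
        (sym (trans (cong (at (toList β)) (sym q₀)) (trans (at-toList β i₀) (trans (lookup-swapV i α i₀) (cong (lookup α) σi₀))))) lt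
      equation : ∀ e → length e ≡ n → mulVar i (K (toList α)) e - mulVar (suc i) (K (toList α)) e ≡
        mulVar i (λ e → toℚ (T₂ e)) e - mulVar (suc i) (λ e → toℚ (T₂ e)) e
      equation e q = trans (subst (λ a → mulVar i (K a) e - mulVar (suc i) (K a) e ≡
            mulVar i (K (toList β)) e - mulVar (suc i) (swapPoly i (K (toList β))) e) α≡
          (proj₂ key (toList β) i (subst (suc i <_) (sym (length-toList β)) i<n) descent e (trans q (sym (length-toList β)))))
        (trans (cong₂ _-_
            (mulVar-toℚ i T (K (toList β)) e (ih _ (trans (length-decAt i e) q)))
            (mulVar-toℚ (suc i) (swapped i T) (swapPoly i (K (toList β))) e (ih _ (trans (length-swapAt (decAt (suc i) e) i) (trans (length-decAt (suc i) e) q)))))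
        (trans (toℚ-difference (mul i T e) (mul (suc i) T₂ e) (mul i T₂ e) (mul (suc i) (swapped i T) e) (sym relation))
        (sym (cong₂ _-_ (mulVar-toℚ i T₂ (λ e → toℚ (T₂ e)) e refl) (mulVar-toℚ (suc i) T₂ (λ e → toℚ (T₂ e)) e refl)))))
        where
        relation : mul i T₂ e + mul (suc i) (swapped i T) e ≡ mul i T e + mul (suc i) T₂ e
        relation = subst (λ gs → mul i T₂ e + mul (suc i) (swapped i (G n k gs (ids n))) e ≡ mul i (G n k gs (ids n)) e + mul (suc i) T₂ e)
          (sym (map-swapV suc i α))
          (demazure k i i₀ i₁ q₀ q₁ hs (λ c → subst (_≤ k) (sym (lookup-map c suc α)) (fuel c))
            (λ c → subst (1 ≤_) (sym (lookup-map c suc α)) (s≤s z≤n))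
            (subst₂ _<_ (sym (lookup-map i₀ suc α)) (sym (lookup-map i₁ suc α)) (s≤s lt)) e (subst (suc i <_) (sym q) i<n))

-- Enumerating what the series count

∈-onlyIf : {A P : Set} (d : Dec P) {xs : List A} {x : A} → x ∈ onlyIf [] d xs → P × x ∈ xs
∈-onlyIf (yes p) m = p , m

onlyIf-∈ : {A P : Set} (d : Dec P) {xs : List A} {x : A} → P → x ∈ xs → x ∈ onlyIf [] d xs
onlyIf-∈ (yes _) p m = m
onlyIf-∈ (no ¬p) p m = ⊥-elim (¬p p)

length-onlyIf : {A P : Set} (d : Dec P) {xs : List A} {f : Poly} {e : List ℕ} → length xs ≡ f e → length (onlyIf [] d xs) ≡ χ d f e
length-onlyIf (yes _) q = q
length-onlyIf (no _)  q = refl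

unique-onlyIf : {A P : Set} (d : Dec P) {xs : List A} → Unique xs → Unique (onlyIf [] d xs)
unique-onlyIf (yes _) u = u
unique-onlyIf (no _)  u = []

concat< : {A : Set} → ℕ → (ℕ → List A) → List A
concat< zero    F = []
concat< (suc N) F = concat< N F ++ F N

boxList : {A : Set} {L : ℕ} → ℕ → Vec ℕ L → (Vec ℕ L → List A) → List A
boxList N []           F = F []
boxList N (zero ∷ hs)  F = boxList N hs (λ ws → F (0 ∷ ws))
boxList N (suc h ∷ hs) F = concat< N (λ a → boxList N hs (λ ws → F (a ∷ ws)))

InBox : ∀ {L} → ℕ → Vec ℕ L → Vec ℕ L → Set
InBox N hs ws = ∀ c → (Alive hs c → lookup ws c < N) × (lookup hs c ≡ 0 → lookup ws c ≡ 0)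

module _ {A : Set} where

  length-concat< : ∀ N (F : ℕ → List A) → length (concat< N F) ≡ Σ< N (λ a → length (F a))
  length-concat< zero    F = refl
  length-concat< (suc N) F = trans (length-++ (concat< N F)) (cong (_+ length (F N)) (length-concat< N F))

  length-boxList : ∀ {L} N (hs : Vec ℕ L) (F : Vec ℕ L → List A) → length (boxList N hs F) ≡ Σbox N hs (λ ws → length (F ws))
  length-boxList N []           F = refl
  length-boxList N (zero ∷ hs)  F = length-boxList N hs _
  length-boxList N (suc h ∷ hs) F = trans (length-concat< N _) (Σ<-cong N λ a → length-boxList N hs _)

  ∈-concat< : ∀ N (F : ℕ → List A) {x} → x ∈ concat< N F → ∃[ a ] (a < N × x ∈ F a)
  ∈-concat< (suc N) F m with ∈-++⁻ (concat< N F) m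
  ... | inj₂ m′ = N , ≤-refl , m′
  ... | inj₁ m′ with ∈-concat< N F m′
  ...   | a , a<N , m″ = a , m<n⇒m<1+n a<N , m″

  concat<-∈ : ∀ N (F : ℕ → List A) {x} a → a < N → x ∈ F a → x ∈ concat< N F
  concat<-∈ (suc N) F a a<N m with a ≟ N
  ... | yes refl = ∈-++⁺ʳ (concat< N F) m
  ... | no n = ∈-++⁺ˡ (concat<-∈ N F a (≤∧≢⇒< (≤-pred a<N) n) m)

  ∈-boxList : ∀ {L} N (hs : Vec ℕ L) (F : Vec ℕ L → List A) {x} → x ∈ boxList N hs F → ∃[ ws ] (InBox N hs ws × x ∈ F ws)
  ∈-boxList N []           F m = [] , (λ ()) , m
  ∈-boxList N (zero ∷ hs)  F m with ∈-boxList N hs _ m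
  ... | ws , b , m′ = 0 ∷ ws , (λ { zero → (λ ()) , λ _ → refl ; (suc c) → b c }) , m′
  ∈-boxList N (suc h ∷ hs) F m with ∈-concat< N _ m
  ... | a , a<N , m′ with ∈-boxList N hs _ m′
  ...   | ws , b , m″ = a ∷ ws , (λ { zero → (λ _ → a<N) , λ () ; (suc c) → b c }) , m″

  boxList-∈ : ∀ {L} N (hs : Vec ℕ L) (F : Vec ℕ L → List A) {x} ws → InBox N hs ws → x ∈ F ws → x ∈ boxList N hs F
  boxList-∈ N []           F []       b m = m
  boxList-∈ N (zero ∷ hs)  F (a ∷ ws) b m with proj₂ (b zero) refl
  ... | refl = boxList-∈ N hs _ ws (λ c → b (suc c)) m
  boxList-∈ N (suc h ∷ hs) F (a ∷ ws) b m = concat<-∈ N _ a (proj₁ (b zero) (s≤s z≤n)) (boxList-∈ N hs _ ws (λ c → b (suc c)) m)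

  unique-boxList : ∀ {L} N (hs : Vec ℕ L) (F : Vec ℕ L → List A) → (∀ ws → Unique (F ws)) →
    (∀ ws vs x → InBox N hs ws → InBox N hs vs → x ∈ F ws → x ∈ F vs → ws ≡ vs) → Unique (boxList N hs F)
  unique-boxList N []           F u d = u []
  unique-boxList N (zero ∷ hs)  F u d = unique-boxList N hs _ (λ ws → u (0 ∷ ws)) λ ws vs x b b′ m m′ →
    cong Vec.tail (d (0 ∷ ws) (0 ∷ vs) x (extend₀ b) (extend₀ b′) m m′)
    where
    extend₀ : ∀ {ws} → InBox N hs ws → InBox N (zero ∷ hs) (0 ∷ ws)
    extend₀ b zero    = (λ ()) , λ _ → refl
    extend₀ b (suc c) = b c
  unique-boxList N (suc h ∷ hs) F u d = go N ≤-refl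
    where
    extend₁ : ∀ {a ws} → a < N → InBox N hs ws → InBox N (suc h ∷ hs) (a ∷ ws)
    extend₁ l b zero    = (λ _ → l) , λ ()
    extend₁ l b (suc c) = b c
    inner : ∀ a → a < N → Unique (boxList N hs (λ ws → F (a ∷ ws)))
    inner a l = unique-boxList N hs _ (λ ws → u (a ∷ ws)) λ ws vs x b b′ m m′ →
      cong Vec.tail (d (a ∷ ws) (a ∷ vs) x (extend₁ l b) (extend₁ l b′) m m′)
    go : ∀ M → M ≤ N → Unique (concat< M (λ a → boxList N hs (λ ws → F (a ∷ ws))))
    go zero    l = []
    go (suc M) l = Uniqueₚ.++⁺ (go M (<⇒≤ l)) (inner M l) λ { (m , m′) →
      let a , a<M , m₁ = ∈-concat< M _ m
          ws , b , m₂ = ∈-boxList N hs _ m₁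
          vs , b′ , m₂′ = ∈-boxList N hs _ m′
      in <⇒≢ a<M (cong Vec.head (d (a ∷ ws) (M ∷ vs) _ (extend₁ (<-≤-trans a<M (<⇒≤ l)) b) (extend₁ l b′) m₂ m₂′)) }

one : ℕ → ℕ → ℕ
one a i = onlyIf 0 (a ≟ i) 1

countRow : ∀ {L} → ℕ → Vec ℕ L → Vec ℕ L → ℕ
countRow i []           []       = 0
countRow i (zero ∷ hs)  (a ∷ as) = countRow i hs as
countRow i (suc h ∷ hs) (a ∷ as) = one a i + countRow i hs as

count : ℕ → List ℕ → ℕ
count i []      = 0
count i (a ∷ x) = one a i + count i x

countAll : ℕ → List (List ℕ) → ℕ
countAll i []      = 0
countAll i (x ∷ σ) = count i x + countAll i σ

at-ext : ∀ (e e′ : List ℕ) → length e ≡ length e′ → (∀ i → at e i ≡ at e′ i) → e ≡ e′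
at-ext []      []       q r = refl
at-ext (x ∷ e) (y ∷ e′) q r = cong₂ _∷_ (r 0) (at-ext e e′ (suc-injective q) (λ i → r (suc i)))

at-applyUpTo : ∀ (g : ℕ → ℕ) n i → i < n → at (applyUpTo g n) i ≡ g i
at-applyUpTo g (suc n) zero    l       = refl
at-applyUpTo g (suc n) (suc i) (s≤s l) = at-applyUpTo (λ i → g (suc i)) n i l

at-outside : ∀ e i → length e ≤ i → at e i ≡ 0
at-outside []      i       l       = refl
at-outside (x ∷ e) (suc i) (s≤s l) = at-outside e i l

one-decAt : ∀ a e i m → at e a ≡ suc m → at e i ≡ one a i + at (decAt a e) i
one-decAt a e i m q with a ≟ i
... | yes refl = trans q (cong suc (sym (trans (at-decAt-≡ a e) (cong pred q))))
... | no n = sym (at-decAt-≢ a i e n)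

one-refl : ∀ a → one a a ≡ 1
one-refl a with a ≟ a
... | yes _ = refl
... | no n = ⊥-elim (n refl)

module _ {A : Set} where

  ∈-mulRow : ∀ {L} (hs as : Vec ℕ L) (f : List ℕ → List A) e {x} → x ∈ mulRowWith [] hs as f e →
    ∃[ e′ ] (x ∈ f e′ × length e′ ≡ length e × (∀ i → at e i ≡ countRow i hs as + at e′ i))
  ∈-mulRow []           []       f e m = e , m , refl , λ _ → refl
  ∈-mulRow (zero ∷ hs)  (a ∷ as) f e m = ∈-mulRow hs as f e m
  ∈-mulRow (suc h ∷ hs) (a ∷ as) f e m with at e a in q | m
  ... | suc n | m′ with ∈-mulRow hs as f (decAt a e) m′
  ...   | e′ , m″ , l , c = e′ , m″ , trans l (length-decAt a e) , λ i → trans (one-decAt a e i n q)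
          (trans (cong (one a i +_) (c i)) (sym (+-assoc (one a i) _ _)))

  mulRow-∈ : ∀ {L} (hs as : Vec ℕ L) (f : List ℕ → List A) e e′ {x} → x ∈ f e′ → length e′ ≡ length e →
    (∀ i → at e i ≡ countRow i hs as + at e′ i) → x ∈ mulRowWith [] hs as f e
  mulRow-∈ []           []       f e e′ m l c = subst (λ e → _ ∈ f e) (at-ext e′ e l λ i → sym (c i)) m
  mulRow-∈ (zero ∷ hs)  (a ∷ as) f e e′ m l c = mulRow-∈ hs as f e e′ m l c
  mulRow-∈ (suc h ∷ hs) (a ∷ as) f e e′ {x} m l c = subst (λ n → x ∈ guard [] (mulRowWith [] hs as f (decAt a e)) n) (sym pos)
      (mulRow-∈ hs as f (decAt a e) e′ m (trans l (sym (length-decAt a e))) λ i → +-cancelˡ-≡ (one a i) _ _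
        (trans (sym (one-decAt a e i _ pos)) (trans (c i) (+-assoc (one a i) _ _))))
    where
    pos : at e a ≡ suc (countRow a hs as + at e′ a)
    pos = trans (c a) (cong (λ v → v + countRow a hs as + at e′ a) (one-refl a))

  length-mulRow : ∀ {L} (hs as : Vec ℕ L) (f : List ℕ → List A) (g : Poly) e → (∀ e → length (f e) ≡ g e) →
    length (mulRowWith [] hs as f e) ≡ mulRow hs as g e
  length-mulRow []           []       f g e q = q e
  length-mulRow (zero ∷ hs)  (a ∷ as) f g e q = length-mulRow hs as f g e q
  length-mulRow (suc h ∷ hs) (a ∷ as) f g e q with at e a
  ... | zero  = refl
  ... | suc _ = length-mulRow hs as f g (decAt a e) q

  unique-mulRow : ∀ {L} (hs as : Vec ℕ L) (f : List ℕ → List A) e → (∀ e → Unique (f e)) → Unique (mulRowWith [] hs as f e)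
  unique-mulRow []           []       f e u = u e
  unique-mulRow (zero ∷ hs)  (a ∷ as) f e u = unique-mulRow hs as f e u
  unique-mulRow (suc h ∷ hs) (a ∷ as) f e u with at e a
  ... | zero  = []
  ... | suc _ = unique-mulRow hs as f (decAt a e) u

-- Fillings, given by the labels of their columns above the basement

consRow : ∀ {L} → Vec ℕ L → Vec ℕ L → Vec (List ℕ) L → Vec (List ℕ) L
consRow []           []       []      = []
consRow (zero ∷ hs)  (a ∷ as) (x ∷ σ) = x ∷ consRow hs as σ
consRow (suc h ∷ hs) (a ∷ as) (x ∷ σ) = (a ∷ x) ∷ consRow hs as σ

-- The recursion of `G` with lists in place of numbers: `[]` for 0 and concatenation for sums. So
-- the length is `G` clause by clause, and membership and uniqueness can be followed along the same
-- recursion.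
fills : ∀ {L} → ℕ → ℕ → Vec ℕ L → Vec ℕ L → List ℕ → List (Vec (List ℕ) L)
fills N zero    hs as e = onlyIf [] (valid? hs as) (onlyIf [] (δ₀ e ≟ 1) (Vec.replicate _ [] ∷ []))
fills N (suc k) hs as e = onlyIf [] (valid? hs as) (boxList N (lower hs) λ ws → onlyIf [] (step? hs as ws)
  (mulRowWith [] (lower hs) ws (λ e′ → List.map (consRow (lower hs) ws) (fills N k (lower hs) ws e′)) e))

δ₀-01 : ∀ e → δ₀ e ≡ 0 ⊎ δ₀ e ≡ 1
δ₀-01 []          = inj₂ refl
δ₀-01 (zero ∷ e)  = δ₀-01 e
δ₀-01 (suc x ∷ e) = inj₁ refl

length-fills : ∀ {L} N k (hs as : Vec ℕ L) e → length (fills N k hs as e) ≡ G N k hs as e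
length-fills N zero    hs as e = length-onlyIf (valid? hs as) {f = δ₀} base
  where
  base : length (onlyIf [] (δ₀ e ≟ 1) (Vec.replicate _ [] ∷ [])) ≡ δ₀ e
  base with δ₀ e ≟ 1 | δ₀-01 e
  ... | yes q | _ = sym q
  ... | no _  | inj₁ q = sym q
  ... | no n  | inj₂ q = ⊥-elim (n q)
length-fills N (suc k) hs as e = length-onlyIf (valid? hs as) (trans (length-boxList N (lower hs) _)
  (Σbox-cong N (lower hs) λ ws → length-onlyIf (step? hs as ws) {f = F N k (lower hs) ws}
    (length-mulRow (lower hs) ws _ _ e λ e → trans (length-map _ (fills N k (lower hs) ws e)) (length-fills N k (lower hs) ws e))))

consRow-injective : ∀ {L} (hs as : Vec ℕ L) {σ ρ} → consRow hs as σ ≡ consRow hs as ρ → σ ≡ ρ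
consRow-injective []           []       {[]}    {[]}    q = refl
consRow-injective (zero ∷ hs)  (a ∷ as) {x ∷ σ} {y ∷ ρ} q =
  cong₂ _∷_ (cong Vec.head q) (consRow-injective hs as (cong Vec.tail q))
consRow-injective (suc h ∷ hs) (a ∷ as) {x ∷ σ} {y ∷ ρ} q =
  cong₂ _∷_ (Listₚ.∷-injectiveʳ (cong Vec.head q)) (consRow-injective hs as (cong Vec.tail q))

-- In columns of height 0 `consRow` forgets the entry; there `InBox` prescribes it.
consRow-row : ∀ {L} N (hs : Vec ℕ L) {as bs σ ρ} → InBox N hs as → InBox N hs bs → consRow hs as σ ≡ consRow hs bs ρ → as ≡ bs
consRow-row N []           {[]}     {[]}     {[]}    {[]}    b b′ q = refl
consRow-row N (zero ∷ hs)  {a ∷ as} {c ∷ bs} {x ∷ σ} {y ∷ ρ} b b′ q =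
  cong₂ _∷_ (trans (proj₂ (b zero) refl) (sym (proj₂ (b′ zero) refl)))
    (consRow-row N hs (λ c → b (suc c)) (λ c → b′ (suc c)) (cong Vec.tail q))
consRow-row N (suc h ∷ hs) {a ∷ as} {c ∷ bs} {x ∷ σ} {y ∷ ρ} b b′ q =
  cong₂ _∷_ (Listₚ.∷-injectiveˡ (cong Vec.head q))
    (consRow-row N hs (λ c → b (suc c)) (λ c → b′ (suc c)) (cong Vec.tail q))

unique-fills : ∀ {L} N k (hs as : Vec ℕ L) e → Unique (fills N k hs as e)
unique-fills N zero    hs as e = unique-onlyIf (valid? hs as) (unique-onlyIf (δ₀ e ≟ 1) ([] ∷ []))
unique-fills N (suc k) hs as e = unique-onlyIf (valid? hs as) (unique-boxList N (lower hs) _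
    (λ ws → unique-onlyIf (step? hs as ws) (unique-mulRow (lower hs) ws _ e λ e′ →
      Uniqueₚ.map⁺ (consRow-injective (lower hs) ws) (unique-fills N k (lower hs) ws e′)))
    λ ws vs x b b′ m m′ →
      let _ , m₁ = ∈-onlyIf (step? hs as ws) m
          _ , m₁′ = ∈-onlyIf (step? hs as vs) m′
          e₁ , m₂ , _ = ∈-mulRow (lower hs) ws _ e m₁
          e₂ , m₂′ , _ = ∈-mulRow (lower hs) vs _ e m₁′
          _ , _ , q = ∈-map⁻ (consRow (lower hs) ws) m₂
          _ , _ , q′ = ∈-map⁻ (consRow (lower hs) vs) m₂′
      in consRow-row N (lower hs) b b′ (trans (sym q) q′))

Desc : ℕ → List ℕ → Set
Desc a []      = ⊤
Desc a (b ∷ x) = b ≤ a × Desc b x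

-- The conditions on the columns a ∷ x and, further right, b ∷ y (basement a, b), as they are
-- checked row by row; for a < b they amount to ColumnPair below.
Compatible : ℕ → List ℕ → ℕ → List ℕ → Set
Compatible a []       b y        = a < b
Compatible a (a′ ∷ x) b []       = a ≢ b × (b < a → b < a′)
Compatible a (a′ ∷ x) b (b′ ∷ y) = a ≢ b × (length x ≤ length y → a < b) × (length y < length x → b < a → b < a′) × Compatible a′ x b′ y

record Filled {L : ℕ} (hs as : Vec ℕ L) (σ : Vec (List ℕ) L) : Set where
  field
    shape : ∀ c → length (lookup σ c) ≡ pred (lookup hs c)
    desc  : ∀ c → Alive hs c → Desc (lookup as c) (lookup σ c)
    pair  : ∀ c d → c Fin.< d → Alive hs c → Alive hs d → Compatible (lookup as c) (lookup σ c) (lookup as d) (lookup σ d)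

lookup-consRow-dead : ∀ {L} (hs as : Vec ℕ L) σ c → lookup hs c ≡ 0 → lookup (consRow hs as σ) c ≡ lookup σ c
lookup-consRow-dead (zero ∷ hs)  (a ∷ as) (x ∷ σ) zero    q = refl
lookup-consRow-dead (zero ∷ hs)  (a ∷ as) (x ∷ σ) (suc c) q = lookup-consRow-dead hs as σ c q
lookup-consRow-dead (suc h ∷ hs) (a ∷ as) (x ∷ σ) (suc c) q = lookup-consRow-dead hs as σ c q

lookup-consRow : ∀ {L} (hs as : Vec ℕ L) σ c → Alive hs c → lookup (consRow hs as σ) c ≡ lookup as c ∷ lookup σ c
lookup-consRow (suc h ∷ hs) (a ∷ as) (x ∷ σ) zero    q = refl
lookup-consRow (zero ∷ hs)  (a ∷ as) (x ∷ σ) (suc c) q = lookup-consRow hs as σ c q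
lookup-consRow (suc h ∷ hs) (a ∷ as) (x ∷ σ) (suc c) q = lookup-consRow hs as σ c q

countAll-consRow : ∀ {L} i (hs as : Vec ℕ L) σ → countAll i (toList (consRow hs as σ)) ≡ countRow i hs as + countAll i (toList σ)
countAll-consRow i []           []       []      = refl
countAll-consRow i (zero ∷ hs)  (a ∷ as) (x ∷ σ) = trans (cong (count i x +_) (countAll-consRow i hs as σ))
  (trans (sym (+-assoc (count i x) _ _)) (trans (cong (_+ countAll i (toList σ)) (+-comm (count i x) _)) (+-assoc (countRow i hs as) _ _)))
countAll-consRow i (suc h ∷ hs) (a ∷ as) (x ∷ σ) = trans (cong (one a i + count i x +_) (countAll-consRow i hs as σ))
  (interchange (one a i) (count i x) (countRow i hs as) (countAll i (toList σ)))

length-zero : ∀ (x : List ℕ) → length x ≡ 0 → x ≡ []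
length-zero [] _ = refl

compatible-distinct : ∀ {a x b y} → Compatible a x b y → a ≢ b
compatible-distinct {x = []}                 r = <⇒≢ r
compatible-distinct {x = _ ∷ _} {y = []}     r = proj₁ r
compatible-distinct {x = _ ∷ _} {y = _ ∷ _}  r = proj₁ r

compatible-order : ∀ {a x b y} → Compatible a x b y → length x ≤ length y → a < b
compatible-order {x = []}                 r le = r
compatible-order {x = _ ∷ _} {y = _ ∷ _}  r le = proj₁ (proj₂ r) (≤-pred le)

compatible-step : ∀ {a a′ x b y} → Compatible a (a′ ∷ x) b y → length y ≤ length x → b < a → b < a′
compatible-step {y = []}    r le = proj₂ r
compatible-step {y = _ ∷ _} r le = proj₁ (proj₂ (proj₂ r)) le

module _ {L : ℕ} where

  module _ {hs as ws : Vec ℕ L} {ρ : Vec (List ℕ) L} (f : Filled (lower hs) ws ρ) where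

    open Filled f

    column : ∀ c → Alive hs c → (lookup hs c ≡ 1 × lookup (consRow (lower hs) ws ρ) c ≡ []) ⊎
      (lookup hs c ≡ suc (suc (length (lookup ρ c))) × lookup (consRow (lower hs) ws ρ) c ≡ lookup ws c ∷ lookup ρ c)
    column c al with lookup hs c in q
    ... | suc zero = inj₁ (refl , trans (lookup-consRow-dead (lower hs) ws ρ c low)
          (length-zero (lookup ρ c) (trans (shape c) (cong pred low))))
      where
      low : lookup (lower hs) c ≡ 0
      low = trans (lookup-map c pred hs) (cong pred q)
    ... | suc (suc h) = inj₂ (cong (λ v → suc (suc v)) (sym (trans (shape c) (cong pred low))) ,
          lookup-consRow (lower hs) ws ρ c (subst (1 ≤_) (sym low) (s≤s z≤n)))
      where
      low : lookup (lower hs) c ≡ suc h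
      low = trans (lookup-map c pred hs) (cong pred q)

    -- One unfolding of `Compatible` consists of the validity of the lowest row, the passing
    -- condition towards the next row, and `Compatible` one row higher. So the conditions of the
    -- recursion assemble to those on whole columns.
    cons-filled : Valid hs as → Step hs as ws → Filled hs as (consRow (lower hs) ws ρ)
    cons-filled V (S₁ , S₂) = record { shape = shape′ ; desc = desc′ ; pair = pair′ }
      where
      2≤ : ∀ {c m} → lookup hs c ≡ suc (suc m) → 2 ≤ lookup hs c
      2≤ q = subst (2 ≤_) (sym q) (s≤s (s≤s z≤n))
      shape′ : ∀ c → length (lookup (consRow (lower hs) ws ρ) c) ≡ pred (lookup hs c)
      shape′ c with lookup hs c in q
      ... | zero = trans (cong length (lookup-consRow-dead (lower hs) ws ρ c low)) (trans (shape c) (cong pred low))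
        where
        low : lookup (lower hs) c ≡ 0
        low = trans (lookup-map c pred hs) (cong pred q)
      ... | suc h with column c (subst (1 ≤_) (sym q) (s≤s z≤n))
      ...   | inj₁ (r , s) = trans (cong length s) (suc-injective (trans (sym r) q))
      ...   | inj₂ (r , s) = trans (cong length s) (suc-injective (trans (sym r) q))
      desc′ : ∀ c → Alive hs c → Desc (lookup as c) (lookup (consRow (lower hs) ws ρ) c)
      desc′ c al with column c al
      ... | inj₁ (_ , s) rewrite s = tt
      ... | inj₂ (r , s) rewrite s = S₁ c (2≤ r) , desc c (alive-lower {hs = hs} (2≤ r))
      pair′ : ∀ c d → c Fin.< d → Alive hs c → Alive hs d →
        Compatible (lookup as c) (lookup (consRow (lower hs) ws ρ) c) (lookup as d) (lookup (consRow (lower hs) ws ρ) d)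
      pair′ c d l alc ald with column c alc | column d ald
      ... | inj₁ (r , s) | _ rewrite s = proj₂ (V c d l alc ald) (subst (_≤ lookup hs d) (sym r) ald)
      ... | inj₂ (r , s) | inj₁ (r′ , s′) rewrite s | s′ =
        proj₁ (V c d l alc ald) , S₂ c d l ald (subst₂ _<_ (sym r′) (sym r) (s≤s (s≤s z≤n)))
      ... | inj₂ (r , s) | inj₂ (r′ , s′) rewrite s | s′ =
        proj₁ (V c d l alc ald) ,
        (λ le → proj₂ (V c d l alc ald) (subst₂ _≤_ (sym r) (sym r′) (s≤s (s≤s le)))) ,
        (λ lt → S₂ c d l ald (subst₂ _<_ (sym r′) (sym r) (s≤s (s≤s lt)))) ,
        pair c d l (alive-lower {hs = hs} (2≤ r)) (alive-lower {hs = hs} (2≤ r′))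

  heads : ∀ {L} → Vec ℕ L → Vec (List ℕ) L → Vec ℕ L
  heads []           []            = []
  heads (zero ∷ hs)  (x ∷ σ)       = 0 ∷ heads hs σ
  heads (suc h ∷ hs) ([] ∷ σ)      = 0 ∷ heads hs σ
  heads (suc h ∷ hs) ((a ∷ x) ∷ σ) = a ∷ heads hs σ

  tails : ∀ {L} → Vec ℕ L → Vec (List ℕ) L → Vec (List ℕ) L
  tails []           []            = []
  tails (zero ∷ hs)  (x ∷ σ)       = x ∷ tails hs σ
  tails (suc h ∷ hs) ([] ∷ σ)      = [] ∷ tails hs σ
  tails (suc h ∷ hs) ((a ∷ x) ∷ σ) = x ∷ tails hs σ

  consRow-heads : ∀ {L} (hs : Vec ℕ L) σ → (∀ c → length (lookup σ c) ≡ lookup hs c) →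
    consRow hs (heads hs σ) (tails hs σ) ≡ σ
  consRow-heads []           []            q = refl
  consRow-heads (zero ∷ hs)  (x ∷ σ)       q = cong (x ∷_) (consRow-heads hs σ (λ c → q (suc c)))
  consRow-heads (suc h ∷ hs) ((a ∷ x) ∷ σ) q = cong ((a ∷ x) ∷_) (consRow-heads hs σ (λ c → q (suc c)))
  consRow-heads (suc h ∷ hs) ([] ∷ σ)      q with q zero
  ... | ()

  heads-dead : ∀ {L} (hs : Vec ℕ L) σ c → lookup hs c ≡ 0 → lookup (heads hs σ) c ≡ 0
  heads-dead (zero ∷ hs)  (x ∷ σ)       zero    q = refl
  heads-dead (zero ∷ hs)  (x ∷ σ)       (suc c) q = heads-dead hs σ c q
  heads-dead (suc h ∷ hs) ([] ∷ σ)      (suc c) q = heads-dead hs σ c q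
  heads-dead (suc h ∷ hs) ((a ∷ x) ∷ σ) (suc c) q = heads-dead hs σ c q

  -- The converse of `cons-filled`: the lowest row is split off, and its validity, the step and the
  -- conditions on the rest are read off from `Compatible`.
  module Uncons {hs as : Vec ℕ L} {σ : Vec (List ℕ) L} (f : Filled hs as σ) where
    open Filled f
    low = lower hs
    ws = heads low σ
    ρ = tails low σ

    recons : consRow low ws ρ ≡ σ
    recons = consRow-heads low σ λ c → trans (shape c) (sym (lookup-map c pred hs))

    col : ∀ c → Alive low c → lookup σ c ≡ lookup ws c ∷ lookup ρ c
    col c al = trans (cong (λ σ → lookup σ c) (sym recons)) (lookup-consRow low ws ρ c al)

    col-dead : ∀ c → lookup low c ≡ 0 → lookup σ c ≡ lookup ρ c
    col-dead c q = trans (cong (λ σ → lookup σ c) (sym recons)) (lookup-consRow-dead low ws ρ c q)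

    height : ∀ c → Alive hs c → lookup hs c ≡ suc (length (lookup σ c))
    height c al rewrite shape c with lookup hs c | al
    ... | suc h | _ = refl

    ≤-length : ∀ c d → Alive hs c → Alive hs d → lookup hs c ≤ lookup hs d → length (lookup σ c) ≤ length (lookup σ d)
    ≤-length c d alc ald le = ≤-pred (subst₂ _≤_ (height c alc) (height d ald) le)

    valid : Valid hs as
    valid c d l alc ald = compatible-distinct (pair c d l alc ald) , λ le → compatible-order (pair c d l alc ald) (≤-length c d alc ald le)

    desc-col : ∀ c → Alive low c → lookup ws c ≤ lookup as c × Desc (lookup ws c) (lookup ρ c)
    desc-col c al = subst (Desc (lookup as c)) (col c al) (desc c (<⇒≤ (alive-lower⁻ {hs = hs} al)))

    step : Step hs as ws
    step = (λ c k → proj₁ (desc-col c (alive-lower {hs = hs} k))) , second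
      where
      second : ∀ c d → c Fin.< d → 1 ≤ lookup hs d → lookup hs d < lookup hs c → lookup as d < lookup as c → lookup as d < lookup ws c
      second c d l ald lt q = compatible-step
          (subst (λ x → Compatible (lookup as c) x (lookup as d) (lookup σ d)) (col c al) (pair c d l alc ald))
          (≤-pred (subst (length (lookup σ d) <_) (cong length (col c al)) (≤-pred (subst₂ _<_ (height d ald) (height c alc) lt)))) q
        where
        k : 2 ≤ lookup hs c
        k = ≤-trans (s≤s ald) lt
        alc : Alive hs c
        alc = <⇒≤ k
        al : Alive low c
        al = alive-lower {hs = hs} k

    filled : Filled low ws ρ
    filled = record { shape = shape′ ; desc = λ c al → proj₂ (desc-col c al) ; pair = pair′ }
      where
      shape′ : ∀ c → length (lookup ρ c) ≡ pred (lookup low c)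
      shape′ c with lookup low c in q
      ... | zero = trans (cong length (sym (col-dead c q))) (trans (shape c) (trans (sym (lookup-map c pred hs)) q))
      ... | suc m = suc-injective (trans (cong length (sym (col c (subst (1 ≤_) (sym q) (s≤s z≤n)))))
              (trans (shape c) (trans (sym (lookup-map c pred hs)) q)))
      pair′ : ∀ c d → c Fin.< d → Alive low c → Alive low d → Compatible (lookup ws c) (lookup ρ c) (lookup ws d) (lookup ρ d)
      pair′ c d l alc ald = proj₂ (proj₂ (proj₂ (subst₂ (λ x y → Compatible (lookup as c) x (lookup as d) y) (col c alc) (col d ald)
        (pair c d l (<⇒≤ (alive-lower⁻ {hs = hs} alc)) (<⇒≤ (alive-lower⁻ {hs = hs} ald))))))

  private
    module Alive-zero {hs : Vec ℕ L} (fuel : ∀ c → lookup hs c ≤ 0) where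
      dead : ∀ c → lookup hs c ≡ 0
      dead c = n≤0⇒n≡0 (fuel c)
      absurd : ∀ {A : Set} c → Alive hs c → A
      absurd c al = ⊥-elim (<⇒≱ al (fuel c))

    δ₀-at : ∀ e → δ₀ e ≡ 1 → ∀ i → at e i ≡ 0
    δ₀-at []         q i       = refl
    δ₀-at (zero ∷ e) q zero    = refl
    δ₀-at (zero ∷ e) q (suc i) = δ₀-at e q i

    at-δ₀ : ∀ e → (∀ i → at e i ≡ 0) → δ₀ e ≡ 1
    at-δ₀ []          z = refl
    at-δ₀ (zero ∷ e)  z = at-δ₀ e (λ i → z (suc i))
    at-δ₀ (suc x ∷ e) z with z 0
    ... | ()

    countAll-empty : ∀ L i → countAll i (toList (Vec.replicate L [])) ≡ 0
    countAll-empty zero    i = refl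
    countAll-empty (suc L) i = countAll-empty L i

  fills-sound : ∀ N k (hs as : Vec ℕ L) e {σ} → Bounded k hs → σ ∈ fills N k hs as e →
    Filled hs as σ × (∀ i → at e i ≡ countAll i (toList σ))
  fills-sound N zero hs as e fuel m with ∈-onlyIf (δ₀ e ≟ 1) (proj₂ (∈-onlyIf (valid? hs as) m))
  ... | q , here refl = record
      { shape = λ c → trans (cong length (lookup-replicate c [])) (sym (cong pred (dead c)))
      ; desc = λ c al → absurd c al ; pair = λ c d _ al _ → absurd c al } ,
      λ i → trans (δ₀-at e q i) (sym (countAll-empty L i))
    where open Alive-zero {hs} fuel
  fills-sound N (suc k) hs as e fuel m with ∈-onlyIf (valid? hs as) m
  ... | V , m₁ with ∈-boxList N (lower hs) _ m₁
  ...   | ws , b , m₂ with ∈-onlyIf (step? hs as ws) m₂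
  ...     | S , m₃ with ∈-mulRow (lower hs) ws _ e m₃
  ...       | e′ , m₄ , _ , q with ∈-map⁻ (consRow (lower hs) ws) m₄
  ...         | ρ , m₅ , refl with fills-sound N k (lower hs) ws e′
                    (lower-bounded {hs = hs} fuel) m₅
  ...           | f , q′ = cons-filled f V S ,
      λ i → trans (q i) (trans (cong (countRow i (lower hs) ws +_) (q′ i)) (sym (countAll-consRow i (lower hs) ws ρ)))

  fills-complete : ∀ N k (hs as : Vec ℕ L) e σ → Bounded k hs → (∀ c → Alive hs c → lookup as c < N) →
    length e ≡ N → Filled hs as σ → (∀ i → at e i ≡ countAll i (toList σ)) → σ ∈ fills N k hs as e
  fills-complete N zero hs as e σ fuel bound le f q = onlyIf-∈ (valid? hs as) (λ c _ _ al → absurd c al)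
      (onlyIf-∈ (δ₀ e ≟ 1) (at-δ₀ e λ i → trans (q i) (trans (cong (λ σ → countAll i (toList σ)) σ≡) (countAll-empty L i))) (here σ≡))
    where
    open Alive-zero {hs} fuel
    σ≡ : σ ≡ Vec.replicate L []
    σ≡ = Pointwise-≡⇒≡ (ext λ c → trans (length-zero (lookup σ c) (trans (Filled.shape f c) (cong pred (dead c)))) (sym (lookup-replicate c [])))
  fills-complete N (suc k) hs as e σ fuel bound le f q = onlyIf-∈ (valid? hs as) valid
      (boxList-∈ N low _ ws box (onlyIf-∈ (step? hs as ws) step
        (mulRow-∈ low ws _ e e′ (subst (_∈ List.map (consRow low ws) (fills N k low ws e′)) recons (∈-map⁺ (consRow low ws)
            (fills-complete N k low ws e′ ρ (lower-bounded {hs = hs} fuel)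
              (λ c al → proj₁ (box c) al) le′ filled content)))
          (trans le′ (sym le))
          λ i → trans (total i) (cong (countRow i low ws +_) (sym (content i))))))
    where
    open Uncons f
    box : InBox N low ws
    box c = (λ al → ≤-<-trans (proj₁ (desc-col c al)) (bound c (<⇒≤ (alive-lower⁻ {hs = hs} al)))) , heads-dead low σ c
    total : ∀ i → at e i ≡ countRow i low ws + countAll i (toList ρ)
    total i = trans (q i) (trans (cong (λ σ → countAll i (toList σ)) (sym recons)) (countAll-consRow i low ws ρ))
    -- The content of the remaining rows. Cutting it off at N loses nothing: it is bounded by `e`,
    -- which has length N.
    e′ : List ℕ
    e′ = applyUpTo (λ i → countAll i (toList ρ)) N
    le′ : length e′ ≡ N
    le′ = Listₚ.length-applyUpTo (λ i → countAll i (toList ρ)) N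
    content : ∀ i → at e′ i ≡ countAll i (toList ρ)
    content i with i <? N
    ... | yes l = at-applyUpTo _ N i l
    ... | no n = trans (at-outside e′ i (subst (_≤ i) (sym le′) (≮⇒≥ n)))
            (sym (m+n≡0⇒n≡0 (countRow i low ws) (trans (sym (total i)) (at-outside e i (subst (_≤ i) (sym le) (≮⇒≥ n))))))

-- The defining conditions, for pairs of columns

private
  variable
    A B : Set

nth-map : (f : A → B) (x : List A) (i : ℕ) {b : B} → nth (List.map f x) i ≡ just b → ∃[ a ] (nth x i ≡ just a × b ≡ f a)
nth-map f (a ∷ x) zero    refl = a , refl , refl
nth-map f (a ∷ x) (suc i) q    = nth-map f x i q

nth-map⁺ : (f : A → B) (x : List A) (i : ℕ) {a : A} → nth x i ≡ just a → nth (List.map f x) i ≡ just (f a)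
nth-map⁺ f (a ∷ x) zero    refl = refl
nth-map⁺ f (a ∷ x) (suc i) q    = nth-map⁺ f x i q

All-nth : {P : A → Set} {xs : List A} → All P xs → ∀ i {a} → nth xs i ≡ just a → P a
All-nth (p ∷ ps) zero    refl = p
All-nth (p ∷ ps) (suc i) q    = All-nth ps i q

nth-All : {P : A → Set} (xs : List A) → (∀ i a → nth xs i ≡ just a → P a) → All P xs
nth-All []       f = []
nth-All (x ∷ xs) f = f 0 x refl ∷ nth-All xs λ i → f (suc i)

AllPairs-nth : {P : A → A → Set} {xs : List A} → AllPairs P xs → ∀ i j {a b} → i < j → nth xs i ≡ just a → nth xs j ≡ just b → P a b
AllPairs-nth (p ∷ ps) zero    (suc j) l       refl r = All-nth p j r
AllPairs-nth (p ∷ ps) (suc i) (suc j) (s≤s l) q    r = AllPairs-nth ps i j l q r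

nth-AllPairs : {P : A → A → Set} (xs : List A) → (∀ i j a b → i < j → nth xs i ≡ just a → nth xs j ≡ just b → P a b) → AllPairs P xs
nth-AllPairs []       f = []
nth-AllPairs (x ∷ xs) f = nth-All xs (λ j b q → f 0 (suc j) x b (s≤s z≤n) refl q) ∷
  nth-AllPairs xs λ i j a b l → f (suc i) (suc j) a b (s≤s l)

-- The defining conditions of 𝓛 for two columns x and, further right, y (basement included)

Coinversion : (A → A → Set) → A → A → A → Set
Coinversion _<′_ u v w = (u <′ v × v <′ w) ⊎ (v <′ w × w <′ u) ⊎ (w <′ u × u <′ v)

record ColumnPair {A : Set} (_<′_ : A → A → Set) (x y : List A) : Set where
  field
    same-row : ∀ h {a b} → nth x h ≡ just a → nth y h ≡ just b → a ≢ b
    next-row : ∀ h {a b} → nth x (suc h) ≡ just a → nth y h ≡ just b → a ≢ b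
    type-1   : length y < length x → ∀ h {u v w} → nth x (suc h) ≡ just u → nth y h ≡ just v → nth x h ≡ just w →
               ¬ Coinversion _<′_ u v w
    type-2   : length x ≤ length y → ∀ h {u v w} → nth y (suc h) ≡ just u → nth x (suc h) ≡ just v → nth y h ≡ just w →
               ¬ Coinversion _<′_ u v w

-- The conditions are negative. Carrying them along f therefore takes injectivity and reflection of
-- the order, and carrying them back in `unmap-columnPair` takes monotonicity.
map-columnPair : {_<₁_ : A → A → Set} {_<₂_ : B → B → Set} (f : A → B) {P : A → Set} →
  (∀ {a b} → P a → P b → f a ≡ f b → a ≡ b) → (∀ {a b} → P a → P b → f a <₂ f b → a <₁ b) →
  ∀ {x y} → All P x → All P y → ColumnPair _<₁_ x y → ColumnPair _<₂_ (List.map f x) (List.map f y)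
map-columnPair {_<₁_ = _<₁_} {_<₂_} f {P} inj refl< {x} {y} px py C = record
  { same-row = λ h q r → let a , q′ , ea = nth-map f x h q ; b , r′ , eb = nth-map f y h r in
      λ e → same-row h q′ r′ (inj (All-nth px h q′) (All-nth py h r′) (trans (sym ea) (trans e eb)))
  ; next-row = λ h q r → let a , q′ , ea = nth-map f x (suc h) q ; b , r′ , eb = nth-map f y h r in
      λ e → next-row h q′ r′ (inj (All-nth px (suc h) q′) (All-nth py h r′) (trans (sym ea) (trans e eb)))
  ; type-1 = λ lt h q r s → let u , q′ , eu = nth-map f x (suc h) q ; v , r′ , ev = nth-map f y h r ; w , s′ , ew = nth-map f x h s in
      λ c → type-1 (subst₂ _<_ (length-map f y) (length-map f x) lt) h q′ r′ s′
        (back (All-nth px (suc h) q′) (All-nth py h r′) (All-nth px h s′) eu ev ew c)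
  ; type-2 = λ le h q r s → let u , q′ , eu = nth-map f y (suc h) q ; v , r′ , ev = nth-map f x (suc h) r ; w , s′ , ew = nth-map f y h s in
      λ c → type-2 (subst₂ _≤_ (length-map f x) (length-map f y) le) h q′ r′ s′
        (back (All-nth py (suc h) q′) (All-nth px (suc h) r′) (All-nth py h s′) eu ev ew c)
  }
  where
  open ColumnPair C
  back : ∀ {u v w u′ v′ w′} → P u → P v → P w → u′ ≡ f u → v′ ≡ f v → w′ ≡ f w → Coinversion _<₂_ u′ v′ w′ → Coinversion _<₁_ u v w
  back pu pv pw refl refl refl (inj₁ (a , b))        = inj₁ (refl< pu pv a , refl< pv pw b)
  back pu pv pw refl refl refl (inj₂ (inj₁ (a , b))) = inj₂ (inj₁ (refl< pv pw a , refl< pw pu b))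
  back pu pv pw refl refl refl (inj₂ (inj₂ (a , b))) = inj₂ (inj₂ (refl< pw pu a , refl< pu pv b))

unmap-columnPair : {_<₁_ : A → A → Set} {_<₂_ : B → B → Set} (f : A → B) {P : A → Set} →
  (∀ {a b} → P a → P b → a <₁ b → f a <₂ f b) →
  ∀ {x y} → All P x → All P y → ColumnPair _<₂_ (List.map f x) (List.map f y) → ColumnPair _<₁_ x y
unmap-columnPair {_<₁_ = _<₁_} {_<₂_} f {P} mono {x} {y} px py C = record
  { same-row = λ h q r e → same-row h (nth-map⁺ f x h q) (nth-map⁺ f y h r) (cong f e)
  ; next-row = λ h q r e → next-row h (nth-map⁺ f x (suc h) q) (nth-map⁺ f y h r) (cong f e)
  ; type-1 = λ lt h q r s c → type-1 (subst₂ _<_ (sym (length-map f y)) (sym (length-map f x)) lt) h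
      (nth-map⁺ f x (suc h) q) (nth-map⁺ f y h r) (nth-map⁺ f x h s)
      (forth (All-nth px (suc h) q) (All-nth py h r) (All-nth px h s) c)
  ; type-2 = λ le h q r s c → type-2 (subst₂ _≤_ (sym (length-map f x)) (sym (length-map f y)) le) h
      (nth-map⁺ f y (suc h) q) (nth-map⁺ f x (suc h) r) (nth-map⁺ f y h s)
      (forth (All-nth py (suc h) q) (All-nth px (suc h) r) (All-nth py h s) c)
  }
  where
  open ColumnPair C
  forth : ∀ {u v w} → P u → P v → P w → Coinversion _<₁_ u v w → Coinversion _<₂_ (f u) (f v) (f w)
  forth pu pv pw (inj₁ (a , b))        = inj₁ (mono pu pv a , mono pv pw b)
  forth pu pv pw (inj₂ (inj₁ (a , b))) = inj₂ (inj₁ (mono pv pw a , mono pw pu b))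
  forth pu pv pw (inj₂ (inj₂ (a , b))) = inj₂ (inj₂ (mono pw pu a , mono pu pv b))

-- In weakly decreasing columns u ≤ w, so a co-inversion triple can only have the form u < v < w.
-- Excluding type 1 keeps a taller column beyond b once it is there; excluding type 2 carries the
-- order of the labels from one row to the next.
columnPair⇒compatible : ∀ {a b} x y → Desc a x → Desc b y → (length x ≤ length y → a < b) → ColumnPair _<_ (a ∷ x) (b ∷ y) → Compatible a x b y
columnPair⇒compatible []       y        da db o C = o z≤n
columnPair⇒compatible {a} {b} (a′ ∷ x) [] da db o C = same-row 0 refl refl , step
  where
  open ColumnPair C
  step : b < a → b < a′
  step b<a with <-cmp b a′
  ... | tri< q _ _ = q
  ... | tri≈ _ q _ = ⊥-elim (next-row 0 refl refl (sym q))
  ... | tri> _ _ q = ⊥-elim (type-1 (s≤s (s≤s z≤n)) 0 refl refl refl (inj₁ (q , b<a)))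
columnPair⇒compatible {a} {b} (a′ ∷ x) (b′ ∷ y) (a′≤a , da) (b′≤b , db) o C =
  same-row 0 refl refl , (λ le → o (s≤s le)) , step , columnPair⇒compatible x y da db order (record
    { same-row = λ h → same-row (suc h) ; next-row = λ h → next-row (suc h)
    ; type-1 = λ lt h → type-1 (s≤s lt) (suc h) ; type-2 = λ le h → type-2 (s≤s le) (suc h) })
  where
  open ColumnPair C
  step : length y < length x → b < a → b < a′
  step lt b<a with <-cmp b a′
  ... | tri< q _ _ = q
  ... | tri≈ _ q _ = ⊥-elim (next-row 0 refl refl (sym q))
  ... | tri> _ _ q = ⊥-elim (type-1 (s≤s (s≤s lt)) 0 refl refl refl (inj₁ (q , b<a)))
  order : length x ≤ length y → a′ < b′
  order le with <-cmp a′ b′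
  ... | tri< q _ _ = q
  ... | tri≈ _ q _ = ⊥-elim (same-row 1 refl refl q)
  ... | tri> _ _ q = ⊥-elim (type-2 (s≤s (s≤s le)) 0 refl refl refl (inj₁ (q , ≤-<-trans a′≤a (o (s≤s le)))))

compatible⇒columnPair : ∀ {a b} x y → Desc a x → Desc b y → Compatible a x b y → ColumnPair _<_ (a ∷ x) (b ∷ y)
compatible⇒columnPair {a} {b} [] y da db r = record
  { same-row = λ { zero refl refl → <⇒≢ r ; (suc h) () }
  ; next-row = λ h ()
  ; type-1 = λ { (s≤s ()) }
  ; type-2 = λ _ h _ () }
compatible⇒columnPair {a} {b} (a′ ∷ x) [] (a′≤a , da) db (a≢b , st) = record
  { same-row = λ { zero refl refl → a≢b ; (suc h) _ () }
  ; next-row = λ { zero refl refl → next ; (suc h) _ () }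
  ; type-1 = λ { _ zero refl refl refl c → first c ; _ (suc h) _ () }
  ; type-2 = λ { (s≤s ()) } }
  where
  next : a′ ≢ b
  next q with <-cmp a b
  ... | tri< p _ _ = <⇒≢ (≤-<-trans a′≤a p) q
  ... | tri≈ _ p _ = a≢b p
  ... | tri> _ _ p = <⇒≢ (st p) (sym q)
  first : ¬ Coinversion _<_ a′ b a
  first (inj₁ (p , q))        = <-asym p (st q)
  first (inj₂ (inj₁ (p , q))) = <⇒≱ q a′≤a
  first (inj₂ (inj₂ (p , q))) = <⇒≱ p a′≤a
compatible⇒columnPair {a} {b} (a′ ∷ x) (b′ ∷ y) (a′≤a , da) (b′≤b , db) (a≢b , o , st , r) = record
  { same-row = λ { zero refl refl → a≢b ; (suc h) → T.same-row h }
  ; next-row = λ { zero refl refl → next ; (suc h) → T.next-row h }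
  ; type-1 = λ { lt zero refl refl refl c → first (≤-pred lt) c ; lt (suc h) → T.type-1 (≤-pred lt) h }
  ; type-2 = λ { le zero refl refl refl c → second (≤-pred le) c ; le (suc h) → T.type-2 (≤-pred le) h } }
  where
  module T = ColumnPair (compatible⇒columnPair x y da db r)
  next : a′ ≢ b
  next q with <-cmp a b
  ... | tri< p _ _ = <⇒≢ (≤-<-trans a′≤a p) q
  ... | tri≈ _ p _ = a≢b p
  ... | tri> _ _ p with length x ≤? length y
  ...   | yes le = <-asym p (o le)
  ...   | no nle = <⇒≢ (st (≰⇒> nle) p) (sym q)
  first : suc (length y) < suc (length x) → ¬ Coinversion _<_ a′ b a
  first lt (inj₁ (p , q))        = <-asym p (st (≤-pred lt) q)
  first lt (inj₂ (inj₁ (p , q))) = <⇒≱ q a′≤a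
  first lt (inj₂ (inj₂ (p , q))) = <⇒≱ p a′≤a
  second : suc (length x) ≤ suc (length y) → ¬ Coinversion _<_ b′ a′ b
  second le (inj₁ (p , q))        = <-asym p (compatible-order r (≤-pred le))
  second le (inj₂ (inj₁ (p , q))) = <⇒≱ q b′≤b
  second le (inj₂ (inj₂ (p , q))) = <⇒≱ p b′≤b

DecreasingUp : {r : ℕ} → List (Sym r) → Set
DecreasingUp x = ∀ h {a b} → nth x (suc h) ≡ just a → nth x h ≡ just b → a ≼ b

boxLabel-nth : (τ : List (List A)) → ∀ c h {a} → boxLabel τ c h ≡ just a → ∃[ x ] (nth τ c ≡ just x × nth x h ≡ just a)
boxLabel-nth τ c h q with nth τ c
... | just x = x , refl , q

nth-boxLabel : (τ : List (List A)) → ∀ c h {a x} → nth τ c ≡ just x → nth x h ≡ just a → boxLabel τ c h ≡ just a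
nth-boxLabel τ c h q r rewrite q = r

module _ {r : ℕ} where

  Columns : List (List (Sym r)) → Set
  Columns τ = All DecreasingUp τ × AllPairs (ColumnPair _≺_) τ

  -- at μ i counts the boxes of column i above the basement.
  module _ (μ : List ℕ) (τ : List (List (Sym r))) (heights : ∀ c {x} → nth τ c ≡ just x → length x ≡ suc (at μ c)) where

    conditions⇒columns : NonAttacking τ → WeaklyDecreasingUp τ → NoCoinversionTriples μ τ → Columns τ
    conditions⇒columns na wd nc =
      nth-All τ (λ c x q h r s → wd c h _ _ (nth-boxLabel τ c (suc h) q r) (nth-boxLabel τ c h q s)) ,
      nth-AllPairs τ λ c d x y c<d qx qy → record
        { same-row = λ h qa qb → na c h d h _ _ (nth-boxLabel τ c h qx qa) (nth-boxLabel τ d h qy qb) (inj₁ (refl , <⇒≢ c<d))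
        ; next-row = λ h qa qb e → na d h c (suc h) _ _ (nth-boxLabel τ d h qy qb) (nth-boxLabel τ c (suc h) qx qa) (inj₂ (refl , c<d)) (sym e)
        ; type-1 = λ lt h qu qv qw → nc c d h _ _ _ (nth-boxLabel τ c (suc h) qx qu) (nth-boxLabel τ c h qx qw)
            (inj₁ (c<d , ≤-pred (subst₂ _<_ (heights d qy) (heights c qx) lt) , nth-boxLabel τ d h qy qv))
        ; type-2 = λ le h qu qv qw → nc d c h _ _ _ (nth-boxLabel τ d (suc h) qy qu) (nth-boxLabel τ d h qy qw)
            (inj₂ (c<d , ≤-pred (subst₂ _≤_ (heights c qx) (heights d qy) le) , nth-boxLabel τ c (suc h) qx qv))
        }

    columns⇒conditions : Columns τ → NonAttacking τ × WeaklyDecreasingUp τ × NoCoinversionTriples μ τ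
    columns⇒conditions (dec , pairs) = na , wd , nc
      where
      pair : ∀ {c d x y} → c < d → nth τ c ≡ just x → nth τ d ≡ just y → ColumnPair _≺_ x y
      pair l q s = AllPairs-nth pairs _ _ l q s
      na : NonAttacking τ
      na c h c′ h′ a b qa qb att with boxLabel-nth τ c h qa | boxLabel-nth τ c′ h′ qb
      na c h c′ h′ a b qa qb (inj₁ (refl , n)) | x , qx , ra | y , qy , rb with <-cmp c c′
      ... | tri< l _ _ = ColumnPair.same-row (pair l qx qy) h ra rb
      ... | tri≈ _ q _ = ⊥-elim (n q)
      ... | tri> _ _ l = λ e → ColumnPair.same-row (pair l qy qx) h rb ra (sym e)
      na c h c′ h′ a b qa qb (inj₂ (refl , l)) | x , qx , ra | y , qy , rb =
        λ e → ColumnPair.next-row (pair l qy qx) h rb ra (sym e)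
      wd : WeaklyDecreasingUp τ
      wd c h a b qa qb with boxLabel-nth τ c (suc h) qa | boxLabel-nth τ c h qb
      ... | x , qx , ra | y , qy , rb with trans (sym qx) qy
      ...   | refl = All-nth dec c qx h ra rb
      nc : NoCoinversionTriples μ τ
      nc i i′ h u v w qu qw (inj₁ (l , lt , qv)) with boxLabel-nth τ i (suc h) qu | boxLabel-nth τ i h qw | boxLabel-nth τ i′ h qv
      ... | x , qx , ru | x′ , qx′ , rw | y , qy , rv with trans (sym qx) qx′
      ...   | refl = ColumnPair.type-1 (pair l qx qy) (subst₂ _<_ (sym (heights i′ qy)) (sym (heights i qx)) (s≤s lt)) h ru rv rw
      nc i i′ h u v w qu qw (inj₂ (l , le , qv)) with boxLabel-nth τ i (suc h) qu | boxLabel-nth τ i h qw | boxLabel-nth τ i′ (suc h) qv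
      ... | x , qx , ru | x′ , qx′ , rw | y , qy , rv with trans (sym qx) qx′
      ...   | refl = ColumnPair.type-2 (pair l qy qx) (subst₂ _≤_ (sym (heights i′ qy)) (sym (heights i qx)) (s≤s le)) h ru rv rw

-- Blocks of variables and the order of the symbols

concatFin-suc : ∀ {A : Set} r (f : Fin (suc r) → List A) → concatFin (suc r) f ≡ f zero ++ concatFin r (f ∘ suc)
concatFin-suc r f = cong (λ xs → f zero ++ concat xs) (trans (map-tabulate suc f) (sym (map-tabulate id (f ∘ suc))))

concatFin-cong : ∀ {A : Set} r {f g : Fin r → List A} → (∀ j → f j ≡ g j) → concatFin r f ≡ concatFin r g
concatFin-cong r q = cong concat (map-cong q (allFin r))

map-concatFin : ∀ {A B : Set} (h : A → B) r (f : Fin r → List A) → List.map h (concatFin r f) ≡ concatFin r (λ j → List.map h (f j))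
map-concatFin h r f = trans (sym (Listₚ.concat-map (List.map f (allFin r)))) (cong concat (sym (map-∘ (allFin r))))

total : ∀ r → (Fin r → ℕ) → ℕ
total zero    n = 0
total (suc r) n = n zero + total r (n ∘ suc)

-- The variables x_{j,1}, …, x_{j,n_j} occupy the positions off j, …, off j + n_j - 1.
off : ∀ r → (Fin r → ℕ) → Fin r → ℕ
off (suc r) n zero    = 0
off (suc r) n (suc j) = n zero + off r (n ∘ suc) j

length-concatFin : ∀ {A : Set} r (n : Fin r → ℕ) (f : Fin r → List A) → (∀ j → length (f j) ≡ n j) → length (concatFin r f) ≡ total r n
length-concatFin zero    n f q = refl
length-concatFin (suc r) n f q = trans (cong length (concatFin-suc r f)) (trans (length-++ (f zero))
  (cong₂ _+_ (q zero) (length-concatFin r (n ∘ suc) (f ∘ suc) (q ∘ suc))))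

at-++ˡ : ∀ xs ys k → k < length xs → at (xs ++ ys) k ≡ at xs k
at-++ˡ (x ∷ xs) ys zero    l       = refl
at-++ˡ (x ∷ xs) ys (suc k) (s≤s l) = at-++ˡ xs ys k l

at-++ʳ : ∀ xs ys k → at (xs ++ ys) (length xs + k) ≡ at ys k
at-++ʳ []       ys k = refl
at-++ʳ (x ∷ xs) ys k = at-++ʳ xs ys k

at-concatFin : ∀ r (n : Fin r → ℕ) (f : Fin r → List ℕ) → (∀ j → length (f j) ≡ n j) → ∀ j k → k < n j →
  at (concatFin r f) (off r n j + k) ≡ at (f j) k
at-concatFin (suc r) n f q zero    k l = trans (cong (λ xs → at xs k) (concatFin-suc r f))
  (at-++ˡ (f zero) _ k (subst (k <_) (sym (q zero)) l))
at-concatFin (suc r) n f q (suc j) k l = trans (cong₂ at (concatFin-suc r f)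
    (trans (+-assoc (n zero) _ k) (cong (_+ (off r (n ∘ suc) j + k)) (sym (q zero)))))
  (trans (at-++ʳ (f zero) _ (off r (n ∘ suc) j + k)) (at-concatFin r (n ∘ suc) (f ∘ suc) (q ∘ suc) j k l))

at-map-upTo : ∀ (g : ℕ → ℕ) n k → k < n → at (List.map g (upTo n)) k ≡ g k
at-map-upTo g n k l = trans (cong (λ xs → at xs k) (map-applyUpTo id g n)) (at-applyUpTo g n k l)

off-< : ∀ r n j j′ → toℕ j < toℕ j′ → off r n j + n j ≤ off r n j′
off-< (suc r) n zero    (suc j′) l       = m≤m+n (n zero) _
off-< (suc r) n (suc j) (suc j′) (s≤s l) = ≤-trans (≤-reflexive (+-assoc (n zero) _ _)) (+-monoʳ-≤ (n zero) (off-< r (n ∘ suc) j j′ l))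

off-total : ∀ r n j → off r n j + n j ≤ total r n
off-total (suc r) n zero    = m≤m+n (n zero) _
off-total (suc r) n (suc j) = ≤-trans (≤-reflexive (+-assoc (n zero) _ _)) (+-monoʳ-≤ (n zero) (off-total r (n ∘ suc) j))

off-lex : ∀ r n j j′ {k k′} → toℕ j < toℕ j′ → k < n j → off r n j + k < off r n j′ + k′
off-lex r n j j′ l k = <-≤-trans (+-monoʳ-< (off r n j) k) (≤-trans (off-< r n j j′ l) (m≤m+n _ _))

-- The label k_j whose variable x_{j,k} occupies position i
labelAt : ∀ r → (Fin r → ℕ) → ℕ → Maybe (Label r)
labelAt zero    n i = nothing
labelAt (suc r) n i with i <? n zero
... | yes _ = just (suc i , zero)
... | no _  = Maybe.map (λ (k , j) → k , suc j) (labelAt r (n ∘ suc) (i ∸ n zero))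

labelAt-off : ∀ r n j k → k < n j → labelAt r n (off r n j + k) ≡ just (suc k , j)
labelAt-off (suc r) n zero    k l with k <? n zero
... | yes _ = refl
... | no nl = ⊥-elim (nl l)
labelAt-off (suc r) n (suc j) k l with n zero + off r (n ∘ suc) j + k <? n zero
... | yes q = ⊥-elim (<⇒≱ q (≤-trans (m≤m+n (n zero) _) (≤-reflexive (sym (+-assoc (n zero) _ k)))))
... | no _ rewrite +-assoc (n zero) (off r (n ∘ suc) j) k | m+n∸m≡n (n zero) (off r (n ∘ suc) j + k)
             | labelAt-off r (n ∘ suc) j k l = refl

position : ∀ r n i → i < total r n → ∃[ j ] ∃[ k ] (k < n j × i ≡ off r n j + k)
position (suc r) n i l with i <? n zero
... | yes q = zero , i , q , refl
... | no nq with position r (n ∘ suc) (i ∸ n zero) (+-cancelˡ-< (n zero) _ _ (subst (_< n zero + total r (n ∘ suc)) (sym (m+[n∸m]≡n (≮⇒≥ nq))) l))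
...   | j , k , lt , q = suc j , k , lt , trans (sym (m+[n∸m]≡n (≮⇒≥ nq))) (trans (cong (n zero +_) q) (sym (+-assoc (n zero) _ k)))

module Position (r : ℕ) (n ℓ : Fin r → ℕ) (ℓ≤n : ∀ j → ℓ j ≤ n j) where

  -- Block j of γ begins with its zeros, so its nonempty columns hold the last ℓ j positions, and
  -- ω_j + c is sent to the one numbered c. Labels count from 1 and positions from 0, hence `k ∸ 1`.
  inBlock : Sym r → ℕ
  inBlock (lab k j) = k ∸ 1
  inBlock (om j c)  = (n j ∸ ℓ j) + c

  φ : Sym r → ℕ
  φ s = off r n (index s) + inBlock s

  -- Within these bounds the labels of a block come before its basement symbols, as `≺` demands, and
  -- `φ` embeds the order. A larger label would meet a basement position or leave the block.
  Relevant : Sym r → Set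
  Relevant (lab k j) = 1 ≤ k × k ≤ n j ∸ ℓ j
  Relevant (om j c)  = c < ℓ j

  inBlock-< : ∀ s → Relevant s → inBlock s < n (index s)
  inBlock-< (lab (suc k) j) (_ , q) = ≤-trans q (m∸n≤m (n j) (ℓ j))
  inBlock-< (om j c) q = subst (n j ∸ ℓ j + c <_) (m∸n+n≡m (ℓ≤n j)) (+-monoʳ-< (n j ∸ ℓ j) q)

  φ-mono : ∀ {a b} → Relevant a → Relevant b → a ≺ b → φ a < φ b
  φ-mono {a} {b} ra rb (idx< q) = off-lex r n (index a) (index b) q (inBlock-< a ra)
  φ-mono {lab (suc k) j} {lab (suc k′) .j} ra rb (ll q) = +-monoʳ-< (off r n j) (≤-pred q)
  φ-mono {lab (suc k) j} ra rb lo = +-monoʳ-< (off r n j) (≤-trans (proj₂ ra) (m≤m+n _ _))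
  φ-mono {om j c} ra rb (oo q) = +-monoʳ-< (off r n j) (+-monoʳ-< (n j ∸ ℓ j) q)

  same-block : ∀ a b → Relevant a → Relevant b → index a ≡ index b → inBlock a < inBlock b → a ≺ b
  same-block (lab (suc k) j) (lab (suc k′) .j) ra rb refl q = ll (s≤s q)
  same-block (lab k j) (om .j c) ra rb refl q = lo
  same-block (om j c) (lab (suc k) .j) ra rb refl q = ⊥-elim (<-asym q (≤-trans (proj₂ rb) (m≤m+n _ _)))
  same-block (om j c) (om .j c′) ra rb refl q = oo (+-cancelˡ-< (n j ∸ ℓ j) _ _ q)

  φ-reflects : ∀ {a b} → Relevant a → Relevant b → φ a < φ b → a ≺ b
  φ-reflects {a} {b} ra rb q with <-cmp (toℕ (index a)) (toℕ (index b))
  ... | tri< l _ _ = idx< l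
  ... | tri> _ _ l = ⊥-elim (<-asym q (off-lex r n (index b) (index a) l (inBlock-< b rb)))
  ... | tri≈ _ e _ = same-block a b ra rb j≡ (+-cancelˡ-< (off r n (index b)) _ _ (subst (λ j → off r n j + inBlock a < φ b) j≡ q))
    where
    j≡ : index a ≡ index b
    j≡ = Finₚ.toℕ-injective e

  ≺-total : ∀ a b → Relevant a → Relevant b → a ≺ b ⊎ a ≡ b ⊎ b ≺ a
  ≺-total a b ra rb with <-cmp (φ a) (φ b)
  ... | tri< l _ _ = inj₁ (φ-reflects ra rb l)
  ... | tri> _ _ l = inj₂ (inj₂ (φ-reflects rb ra l))
  ... | tri≈ _ e _ = inj₂ (inj₁ (equal e))
    where
    equal : φ a ≡ φ b → a ≡ b
    equal e with <-cmp (toℕ (index a)) (toℕ (index b))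
    ... | tri< l _ _ = ⊥-elim (<⇒≢ (off-lex r n (index a) (index b) l (inBlock-< a ra)) e)
    ... | tri> _ _ l = ⊥-elim (<⇒≢ (off-lex r n (index b) (index a) l (inBlock-< b rb)) (sym e))
    ... | tri≈ _ q _ = go a b ra rb (Finₚ.toℕ-injective q)
            (+-cancelˡ-≡ (off r n (index b)) _ _ (trans (cong (λ j → off r n j + inBlock a) (sym (Finₚ.toℕ-injective q))) e))
      where
      go : ∀ a b → Relevant a → Relevant b → index a ≡ index b → inBlock a ≡ inBlock b → a ≡ b
      go (lab (suc k) j) (lab (suc k′) .j) ra rb refl q = cong (λ k → lab (suc k) j) q
      go (lab (suc k) j) (om .j c) ra rb refl q = ⊥-elim (<⇒≢ (≤-trans (proj₂ ra) (m≤m+n _ c)) q)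
      go (om j c) (lab (suc k) .j) ra rb refl q = ⊥-elim (<⇒≢ (≤-trans (proj₂ rb) (m≤m+n _ c)) (sym q))
      go (om j c) (om .j c′) ra rb refl q = cong (om j) (+-cancelˡ-≡ (n j ∸ ℓ j) _ _ q)

  φ-injective : ∀ {a b} → Relevant a → Relevant b → φ a ≡ φ b → a ≡ b
  φ-injective {a} {b} ra rb e with ≺-total a b ra rb
  ... | inj₁ l        = ⊥-elim (<⇒≢ (φ-mono ra rb l) e)
  ... | inj₂ (inj₁ q) = q
  ... | inj₂ (inj₂ l) = ⊥-elim (<⇒≢ (φ-mono rb ra l) (sym e))

-- Removing and restoring empty columns

select : {A : Set} → List ℕ → List A → List A
select []          xs       = []
select (g ∷ γ)     []       = []
select (zero ∷ γ)  (x ∷ xs) = select γ xs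
select (suc g ∷ γ) (x ∷ xs) = x ∷ select γ xs

-- The inverse of `select γ` on columns of heights γ. The clause with too few columns is a default
-- value, excluded by the hypothesis on lengths wherever an inverse is claimed.
pad : {A : Set} → List ℕ → List (List A) → List (List A)
pad []          σ       = []
pad (zero ∷ γ)  σ       = [] ∷ pad γ σ
pad (suc g ∷ γ) []      = [] ∷ pad γ []
pad (suc g ∷ γ) (x ∷ σ) = x ∷ pad γ σ

module _ {A : Set} where

  select-++ : ∀ γ γ′ (xs ys : List A) → length γ ≡ length xs → select (γ ++ γ′) (xs ++ ys) ≡ select γ xs ++ select γ′ ys
  select-++ []          γ′ []       ys q = refl
  select-++ (zero ∷ γ)  γ′ (x ∷ xs) ys q = select-++ γ γ′ xs ys (suc-injective q)
  select-++ (suc g ∷ γ) γ′ (x ∷ xs) ys q = cong (x ∷_) (select-++ γ γ′ xs ys (suc-injective q))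

  select-zeros : ∀ m (xs : List A) → select (List.replicate m 0) xs ≡ []
  select-zeros zero    xs       = refl
  select-zeros (suc m) []       = refl
  select-zeros (suc m) (x ∷ xs) = select-zeros m xs

  select-positive : ∀ γ (xs : List A) → All (1 ≤_) γ → length γ ≡ length xs → select γ xs ≡ xs
  select-positive []          []       ps       q = refl
  select-positive (suc g ∷ γ) (x ∷ xs) (p ∷ ps) q = cong (x ∷_) (select-positive γ xs ps (suc-injective q))

  select-concatFin : ∀ r (f : Fin r → List ℕ) (g : Fin r → List A) → (∀ j → length (f j) ≡ length (g j)) →
    select (concatFin r f) (concatFin r g) ≡ concatFin r (λ j → select (f j) (g j))
  select-concatFin zero    f g q = refl
  select-concatFin (suc r) f g q = trans (cong₂ select (concatFin-suc r f) (concatFin-suc r g))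
    (trans (select-++ (f zero) _ (g zero) _ (q zero)) (trans (cong (select (f zero) (g zero) ++_)
      (select-concatFin r (f ∘ suc) (g ∘ suc) (q ∘ suc))) (sym (concatFin-suc r (λ j → select (f j) (g j))))))

  All-select : ∀ {P : A → Set} γ {xs} → All P xs → All P (select γ xs)
  All-select []          ps       = []
  All-select (g ∷ γ)     []       = []
  All-select (zero ∷ γ)  (p ∷ ps) = All-select γ ps
  All-select (suc g ∷ γ) (p ∷ ps) = p ∷ All-select γ ps

  AllPairs-select : ∀ {P : A → A → Set} γ {xs} → AllPairs P xs → AllPairs P (select γ xs)
  AllPairs-select []          ps       = []
  AllPairs-select (g ∷ γ)     []       = []
  AllPairs-select (zero ∷ γ)  (p ∷ ps) = AllPairs-select γ ps
  AllPairs-select (suc g ∷ γ) (p ∷ ps) = All-select γ p ∷ AllPairs-select γ ps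

  pad-select : ∀ γ (S : List (List A)) → List.map length S ≡ γ → pad γ (select γ S) ≡ S
  pad-select .[]               []            refl = refl
  pad-select .(0 ∷ _)          ([] ∷ S)      refl = cong ([] ∷_) (pad-select _ S refl)
  pad-select .(suc _ ∷ _)      ((a ∷ x) ∷ S) refl = cong ((a ∷ x) ∷_) (pad-select _ S refl)

  select-pad : ∀ γ (σ : List (List A)) → List.map length σ ≡ select γ γ → select γ (pad γ σ) ≡ σ
  select-pad []          []      q = refl
  select-pad (zero ∷ γ)  σ       q = select-pad γ σ q
  select-pad (suc g ∷ γ) (x ∷ σ) q = cong (x ∷_) (select-pad γ σ (Listₚ.∷-injectiveʳ q))

  length-pad : ∀ γ (σ : List (List A)) → List.map length σ ≡ select γ γ → List.map length (pad γ σ) ≡ γ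
  length-pad []          []      q = refl
  length-pad (zero ∷ γ)  σ       q = cong (0 ∷_) (length-pad γ σ q)
  length-pad (suc g ∷ γ) (x ∷ σ) q = cong₂ _∷_ (Listₚ.∷-injectiveˡ q) (length-pad γ σ (Listₚ.∷-injectiveʳ q))

map-select : ∀ {A B : Set} (f : A → B) γ xs → List.map f (select γ xs) ≡ select γ (List.map f xs)
map-select f []          xs       = refl
map-select f (g ∷ γ)     []       = refl
map-select f (zero ∷ γ)  (x ∷ xs) = map-select f γ xs
map-select f (suc g ∷ γ) (x ∷ xs) = cong (f x ∷_) (map-select f γ xs)

select-zip : ∀ {A B C : Set} (f : A → B → C) γ xs ys → length xs ≡ length ys →
  select γ (List.zipWith f xs ys) ≡ List.zipWith f (select γ xs) (select γ ys)
select-zip f []          xs       ys       q = refl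
select-zip f (g ∷ γ)     []       []       q = refl
select-zip f (zero ∷ γ)  (x ∷ xs) (y ∷ ys) q = select-zip f γ xs ys (suc-injective q)
select-zip f (suc g ∷ γ) (x ∷ xs) (y ∷ ys) q = cong (f x y ∷_) (select-zip f γ xs ys (suc-injective q))

countAll-select : ∀ i γ S → List.map length S ≡ γ → countAll i (select γ S) ≡ countAll i S
countAll-select i .[]          []            refl = refl
countAll-select i .(0 ∷ _)     ([] ∷ S)      refl = countAll-select i _ S refl
countAll-select i .(suc _ ∷ _) ((a ∷ x) ∷ S) refl = cong (count i (a ∷ x) +_) (countAll-select i _ S refl)

DescL : List ℕ → Set
DescL []      = ⊤
DescL (a ∷ x) = Desc a x

CompatibleL : List ℕ → List ℕ → Set
CompatibleL []      _       = ⊤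
CompatibleL (_ ∷ _) []      = ⊤
CompatibleL (a ∷ x) (b ∷ y) = Compatible a x b y

-- The order of the basement labels, which `ColumnPair` does not contain and from which the
-- induction in `columnPair⇒compatible` starts.
HeadLt : List ℕ → List ℕ → Set
HeadLt []      _       = ⊤
HeadLt (_ ∷ _) []      = ⊤
HeadLt (a ∷ x) (b ∷ y) = a < b

compatible-right-empty : ∀ {a x b} → a < b → Compatible a x b []
compatible-right-empty {x = []}    l = l
compatible-right-empty {x = _ ∷ _} l = <⇒≢ l , λ q → ⊥-elim (<-asym l q)

All-DescL-unselect : ∀ γ B S → List.map length S ≡ γ → length B ≡ length S → All DescL (select γ (List.zipWith _∷_ B S)) →
  All DescL (List.zipWith _∷_ B S)
All-DescL-unselect .[]          []      []            refl _ ps       = []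
All-DescL-unselect .(0 ∷ _)     (b ∷ B) ([] ∷ S)      refl q ps       = tt ∷ All-DescL-unselect _ B S refl (suc-injective q) ps
All-DescL-unselect .(suc _ ∷ _) (b ∷ B) ((a ∷ x) ∷ S) refl q (p ∷ ps) = p ∷ All-DescL-unselect _ B S refl (suc-injective q) ps

All-compatible-unselect : ∀ γ a x B S → All (a <_) B → List.map length S ≡ γ → length B ≡ length S →
  All (CompatibleL (a ∷ x)) (select γ (List.zipWith _∷_ B S)) → All (CompatibleL (a ∷ x)) (List.zipWith _∷_ B S)
All-compatible-unselect .[]          a x []      []            ls       refl q ps       = []
All-compatible-unselect .(0 ∷ _)     a x (b ∷ B) ([] ∷ S)      (l ∷ ls) refl q ps       =
  compatible-right-empty {x = x} l ∷ All-compatible-unselect _ a x B S ls refl (suc-injective q) ps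
All-compatible-unselect .(suc _ ∷ _) a x (b ∷ B) ((c ∷ y) ∷ S) (l ∷ ls) refl q (p ∷ ps) =
  p ∷ All-compatible-unselect _ a x B S ls refl (suc-injective q) ps

left-empty : ∀ a B (S : List (List ℕ)) → All (a <_) B → All (CompatibleL (a ∷ [])) (List.zipWith _∷_ B S)
left-empty a []      S       ls       = []
left-empty a (b ∷ B) []      ls       = []
left-empty a (b ∷ B) (x ∷ S) (l ∷ ls) = l ∷ left-empty a B S ls

-- Over an increasing basement an empty column is compatible with every other one: with a column to
-- its right by the order of the basement, with a column to its left because that column starts
-- smaller and the passing condition is vacuous.
AllPairs-compatible-unselect : ∀ γ B S → AllPairs _<_ B → List.map length S ≡ γ → length B ≡ length S →
  AllPairs CompatibleL (select γ (List.zipWith _∷_ B S)) → AllPairs CompatibleL (List.zipWith _∷_ B S)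
AllPairs-compatible-unselect .[]          []      []            ls       refl _ ps       = []
AllPairs-compatible-unselect .(0 ∷ _)     (b ∷ B) ([] ∷ S)      (l ∷ ls) refl q ps       =
  left-empty b B S l ∷ AllPairs-compatible-unselect _ B S ls refl (suc-injective q) ps
AllPairs-compatible-unselect .(suc _ ∷ _) (b ∷ B) ((a ∷ x) ∷ S) (l ∷ ls) refl q (p ∷ ps) =
  All-compatible-unselect _ b (a ∷ x) B S l refl (suc-injective q) p ∷ AllPairs-compatible-unselect _ B S ls refl (suc-injective q) ps

AllPairs-HeadLt : ∀ B S → AllPairs _<_ B → AllPairs HeadLt (List.zipWith _∷_ B S)
AllPairs-HeadLt []      S       ls       = []
AllPairs-HeadLt (b ∷ B) []      ls       = []
AllPairs-HeadLt (b ∷ B) (x ∷ S) (l ∷ ls) = go B S l ∷ AllPairs-HeadLt B S ls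
  where
  go : ∀ B S → All (b <_) B → All (HeadLt (b ∷ x)) (List.zipWith _∷_ B S)
  go []      S       ls       = []
  go (c ∷ B) []      ls       = []
  go (c ∷ B) (y ∷ S) (l ∷ ls) = l ∷ go B S ls

-- Positions of the basement

range : ℕ → ℕ → List ℕ
range s zero    = []
range s (suc n) = s ∷ range (suc s) n

length-range : ∀ s n → length (range s n) ≡ n
length-range s zero    = refl
length-range s (suc n) = cong suc (length-range (suc s) n)

range-++ : ∀ s a b → range s (a + b) ≡ range s a ++ range (s + a) b
range-++ s zero    b = cong (λ t → range t b) (sym (+-identityʳ s))
range-++ s (suc a) b = cong (s ∷_) (trans (range-++ (suc s) a b) (cong (λ t → range (suc s) a ++ range t b) (sym (+-suc s a))))

range-above : ∀ m s n → m < s → All (m <_) (range s n)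
range-above m s zero    l = []
range-above m s (suc n) l = l ∷ range-above m (suc s) n (m<n⇒m<1+n l)

range-increasing : ∀ s n → AllPairs _<_ (range s n)
range-increasing s zero    = []
range-increasing s (suc n) = range-above s (suc s) n ≤-refl ∷ range-increasing (suc s) n

map-upTo-range : ∀ s n → List.map (s +_) (upTo n) ≡ range s n
map-upTo-range s n = trans (Listₚ.map-applyUpTo id (s +_) n) (go s n (s +_) λ k → refl)
  where
  go : ∀ s n (f : ℕ → ℕ) → (∀ k → f k ≡ s + k) → applyUpTo f n ≡ range s n
  go s zero    f q = refl
  go s (suc n) f q = cong₂ _∷_ (trans (q 0) (+-identityʳ s)) (go (suc s) n (f ∘ suc) λ k → trans (q (suc k)) (+-suc s k))

range-concatFin : ∀ r (n : Fin r → ℕ) s → concatFin r (λ j → range (s + off r n j) (n j)) ≡ range s (total r n)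
range-concatFin zero    n s = refl
range-concatFin (suc r) n s = trans (concatFin-suc r _) (trans (cong₂ _++_ (cong (λ t → range t (n zero)) (+-identityʳ s))
    (trans (concatFin-cong r λ j → cong (λ t → range t (n (suc j))) (sym (+-assoc s (n zero) _))) (range-concatFin r (n ∘ suc) (s + n zero))))
  (sym (range-++ s (n zero) (total r (n ∘ suc)))))

-- Counting labels and positions

oneLabel : ∀ {r} → Label r → ℕ → Fin r → ℕ
oneLabel (k′ , j′) k j = onlyIf 0 ((k′ ≟ k) ×-dec (j′ Fin.≟ j)) 1

countLabels : ∀ {r} → ℕ → Fin r → List (Label r) → ℕ
countLabels k j []      = 0
countLabels k j (p ∷ x) = oneLabel p k j + countLabels k j x

countLabel-∷ : ∀ {r} k (j : Fin r) x σ → countLabel k j (x ∷ σ) ≡ countLabels k j x + countLabel k j σ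
countLabel-∷ k j []              σ = refl
countLabel-∷ k j ((k′ , j′) ∷ x) σ with k′ ≟ k | j′ Fin.≟ j
... | yes _ | yes _ = cong suc (countLabel-∷ k j x σ)
... | yes _ | no _  = countLabel-∷ k j x σ
... | no _  | yes _ = countLabel-∷ k j x σ
... | no _  | no _  = countLabel-∷ k j x σ

oneLabel-refl : ∀ {r} k (j : Fin r) → oneLabel (k , j) k j ≡ 1
oneLabel-refl k j with k ≟ k | j Fin.≟ j
... | yes _ | yes _ = refl
... | no n  | _     = ⊥-elim (n refl)
... | yes _ | no n  = ⊥-elim (n refl)

oneLabel-≢ : ∀ {r} p k (j : Fin r) → p ≢ (k , j) → oneLabel p k j ≡ 0
oneLabel-≢ (k′ , j′) k j n with k′ ≟ k | j′ Fin.≟ j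
... | yes refl | yes refl = ⊥-elim (n refl)
... | yes _    | no _     = refl
... | no _     | _        = refl

countLabels-positive : ∀ {r} (x : List (Label r)) → All (λ (k , j) → 1 ≤ countLabels k j x) x
countLabels-positive []            = []
countLabels-positive ((k , j) ∷ x) = ≤-trans (≤-reflexive (sym (oneLabel-refl k j))) (m≤m+n _ _) ∷
  All.map (λ q → ≤-trans q (m≤n+m _ _)) (countLabels-positive x)

countLabel-positive : ∀ {r} (σ : Filling r) → All (All (λ (k , j) → 1 ≤ countLabel k j σ)) σ
countLabel-positive []      = []
countLabel-positive (x ∷ σ) =
  All.map (λ { {k , j} q → subst (1 ≤_) (sym (countLabel-∷ k j x σ)) (≤-trans q (m≤m+n _ _)) }) (countLabels-positive x) ∷
  All.map (All.map (λ { {k , j} q → subst (1 ≤_) (sym (countLabel-∷ k j x σ)) (≤-trans q (m≤n+m _ _)) })) (countLabel-positive σ)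

count-positive : ∀ x → All (λ i → 1 ≤ count i x) x
count-positive []      = []
count-positive (a ∷ x) = ≤-trans (≤-reflexive (sym (one-refl a))) (m≤m+n _ _) ∷
  All.map (λ q → ≤-trans q (m≤n+m _ _)) (count-positive x)

countAll-positive : ∀ σ → All (All (λ i → 1 ≤ countAll i σ)) σ
countAll-positive []      = []
countAll-positive (x ∷ σ) = All.map (λ q → ≤-trans q (m≤m+n _ _)) (count-positive x) ∷
  All.map (All.map (λ q → ≤-trans q (m≤n+m _ _))) (countAll-positive σ)

one-≢ : ∀ {a i} → a ≢ i → one a i ≡ 0
one-≢ {a} {i} n with a ≟ i
... | yes q = ⊥-elim (n q)
... | no _ = refl

countAll-zero : ∀ i σ → All (All (_≢ i)) σ → countAll i σ ≡ 0
countAll-zero i []      []       = refl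
countAll-zero i (x ∷ σ) (p ∷ ps) = cong₂ _+_ (go x p) (countAll-zero i σ ps)
  where
  go : ∀ x → All (_≢ i) x → count i x ≡ 0
  go []      []       = refl
  go (a ∷ x) (n ∷ ns) = cong₂ _+_ (one-≢ n) (go x ns)

module _ {r : ℕ} (f : Label r → ℕ) (i k : ℕ) (j : Fin r) (P : Label r → Set)
    (same : f (k , j) ≡ i) (differ : ∀ {p} → P p → f p ≡ i → p ≡ (k , j)) where

  private
    one-label : ∀ p → P p → one (f p) i ≡ oneLabel p k j
    one-label p Pp with f p ≟ i
    ... | no n = sym (oneLabel-≢ p k j λ { refl → n same })
    ... | yes q with differ Pp q
    ...   | refl = sym (oneLabel-refl k j)

    count-label : ∀ x → All P x → count i (List.map f x) ≡ countLabels k j x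
    count-label []      []       = refl
    count-label (p ∷ x) (q ∷ qs) = cong₂ _+_ (one-label p q) (count-label x qs)

  countAll-label : ∀ σ → All (All P) σ → countAll i (List.map (List.map f) σ) ≡ countLabel k j σ
  countAll-label []      []       = refl
  countAll-label (x ∷ σ) (p ∷ ps) = trans (cong₂ _+_ (count-label x p) (countAll-label σ ps)) (sym (countLabel-∷ k j x σ))

countLabel-zero : ∀ {r} k (j : Fin r) σ → All (All (_≢ (k , j))) σ → countLabel k j σ ≡ 0
countLabel-zero k j []      []       = refl
countLabel-zero k j (x ∷ σ) (p ∷ ps) = trans (countLabel-∷ k j x σ) (cong₂ _+_ (go x p) (countLabel-zero k j σ ps))
  where
  go : ∀ x → All (_≢ (k , j)) x → countLabels k j x ≡ 0
  go []      []       = refl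
  go (q ∷ x) (n ∷ ns) = cong₂ _+_ (oneLabel-≢ q k j n) (go x ns)

at-positive : ∀ e i → 1 ≤ at e i → i < length e
at-positive (x ∷ e) zero    q = s≤s z≤n
at-positive (x ∷ e) (suc i) q = s≤s (at-positive e i q)

-- Columns with their basement, in terms of symbols and of positions

columnsFrom : ℕ → ∀ {n} → Vec (List ℕ) n → List (List ℕ)
columnsFrom s {n} S = List.zipWith _∷_ (range s n) (toList S)

nth-columns : ∀ s {n} (S : Vec (List ℕ) n) c → nth (columnsFrom s S) (toℕ c) ≡ just ((s + toℕ c) ∷ lookup S c)
nth-columns s (x ∷ S) zero    = cong (λ a → just (a ∷ x)) (sym (+-identityʳ s))
nth-columns s (x ∷ S) (suc c) = trans (nth-columns (suc s) S c) (cong (λ a → just (a ∷ lookup S c)) (sym (+-suc s (toℕ c))))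

columns-nth : ∀ s {n} (S : Vec (List ℕ) n) i {z} → nth (columnsFrom s S) i ≡ just z → ∃[ c ] (toℕ {n} c ≡ i × z ≡ (s + i) ∷ lookup S c)
columns-nth s (x ∷ S) zero    refl = zero , refl , cong (_∷ x) (sym (+-identityʳ s))
columns-nth s (x ∷ S) (suc i) q with columns-nth (suc s) S i q
... | c , refl , refl = suc c , refl , cong (_∷ lookup S c) (sym (+-suc s i))

module _ {n : ℕ} (α : Vec ℕ n) (S : Vec (List ℕ) n) where

  private
    hs : Vec ℕ n
    hs = map suc α
    alive : ∀ c → 1 ≤ lookup hs c
    alive c = subst (1 ≤_) (sym (lookup-map c suc α)) (s≤s z≤n)

  filled⇒columns : Filled hs (ids n) S →
    List.map length (toList S) ≡ toList α × All DescL (columnsFrom 0 S) × AllPairs CompatibleL (columnsFrom 0 S)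
  filled⇒columns f = lengths α S (λ c → trans (shape c) (cong pred (lookup-map c suc α))) ,
      nth-All _ (λ i z q → let c , e , zq = columns-nth 0 S i q in subst DescL (sym zq)
        (subst (λ a → Desc a (lookup S c)) (trans (lookup-ids c) e) (desc c (alive c)))) ,
      nth-AllPairs _ (λ i j z w l q q′ → let c , e , zq = columns-nth 0 S i q ; d , e′ , wq = columns-nth 0 S j q′ in
        subst₂ CompatibleL (sym zq) (sym wq) (subst₂ (λ a b → Compatible a (lookup S c) b (lookup S d)) (trans (lookup-ids c) e) (trans (lookup-ids d) e′)
          (pair c d (subst₂ _<_ (sym e) (sym e′) l) (alive c) (alive d))))
    where
    open Filled f
    lengths : ∀ {n} (α : Vec ℕ n) (S : Vec (List ℕ) n) → (∀ c → length (lookup S c) ≡ lookup α c) → List.map length (toList S) ≡ toList α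
    lengths []      []      q = refl
    lengths (a ∷ α) (x ∷ S) q = cong₂ _∷_ (q zero) (lengths α S (λ c → q (suc c)))

  columns⇒filled : List.map length (toList S) ≡ toList α → All DescL (columnsFrom 0 S) → AllPairs CompatibleL (columnsFrom 0 S) →
    Filled hs (ids n) S
  columns⇒filled q ds ps = record
    { shape = λ c → trans (lengths α S q c) (cong pred (sym (lookup-map c suc α)))
    ; desc = λ c _ → subst (λ a → Desc a (lookup S c)) (sym (lookup-ids c)) (All-nth ds (toℕ c) (nth-columns 0 S c))
    ; pair = λ c d l _ _ → subst₂ (λ a b → Compatible a (lookup S c) b (lookup S d)) (sym (lookup-ids c)) (sym (lookup-ids d))
        (AllPairs-nth ps (toℕ c) (toℕ d) l (nth-columns 0 S c) (nth-columns 0 S d)) }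
    where
    lengths : ∀ {n} (α : Vec ℕ n) (S : Vec (List ℕ) n) → List.map length (toList S) ≡ toList α → ∀ c → length (lookup S c) ≡ lookup α c
    lengths (a ∷ α) (x ∷ S) q zero    = ∷-injectiveˡ q
    lengths (a ∷ α) (x ∷ S) q (suc c) = lengths α S (∷-injectiveʳ q) c

module _ {r : ℕ} (n ℓ : Fin r → ℕ) (ℓ≤n : ∀ j → ℓ j ≤ n j) where

  open Position r n ℓ ℓ≤n

  decreasing⇒desc : ∀ a x → All Relevant (a ∷ x) → DecreasingUp (a ∷ x) → Desc (φ a) (List.map φ x)
  decreasing⇒desc a []      ps dec = tt
  decreasing⇒desc a (b ∷ x) (p ∷ q ∷ ps) dec = le (dec 0 refl refl) , decreasing⇒desc b x (q ∷ ps) (λ h → dec (suc h))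
    where
    le : b ≼ a → φ b ≤ φ a
    le (inj₁ l)    = <⇒≤ (φ-mono q p l)
    le (inj₂ refl) = ≤-refl

  desc⇒decreasing : ∀ a x → All Relevant (a ∷ x) → Desc (φ a) (List.map φ x) → DecreasingUp (a ∷ x)
  desc⇒decreasing a (b ∷ x) (p ∷ q ∷ ps) (le , d) (suc h) u v = desc⇒decreasing b x (q ∷ ps) d h u v
  desc⇒decreasing a (b ∷ x) (p ∷ q ∷ ps) (le , d) zero refl refl with φ b ≟ φ a
  ... | yes e = inj₂ (φ-injective q p e)
  ... | no ne = inj₁ (φ-reflects q p (≤∧≢⇒< le ne))

  module _ (τ : List (List (Sym r))) (relevant : All (All Relevant) τ)
      (heads : AllPairs HeadLt (List.map (List.map φ) τ)) where

    columns⇒positions : Columns τ → All DescL (List.map (List.map φ) τ) × AllPairs CompatibleL (List.map (List.map φ) τ)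
    columns⇒positions (dec , pairs) = nth-All _ descs , nth-AllPairs _ λ i j z w l q q′ →
        let x , qx , ex = nth-map (List.map φ) τ i q
            y , qy , ey = nth-map (List.map φ) τ j q′
        in subst₂ CompatibleL (sym ex) (sym ey) (go x y (All-nth relevant i qx) (All-nth relevant j qy) (All-nth dec i qx) (All-nth dec j qy)
             (subst₂ HeadLt ex ey (AllPairs-nth heads i j l q q′)) (AllPairs-nth pairs i j l qx qy))
      where
      descs : ∀ i z → nth (List.map (List.map φ) τ) i ≡ just z → DescL z
      descs i z q with nth-map (List.map φ) τ i q
      ... | []    , qx , refl = tt
      ... | a ∷ x , qx , refl = decreasing⇒desc a x (All-nth relevant i qx) (All-nth dec i qx)
      go : ∀ x y → All Relevant x → All Relevant y → DecreasingUp x → DecreasingUp y → HeadLt (List.map φ x) (List.map φ y) →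
        ColumnPair _≺_ x y → CompatibleL (List.map φ x) (List.map φ y)
      go []      y       rx ry dx dy l C = tt
      go (a ∷ x) []      rx ry dx dy l C = tt
      go (a ∷ x) (b ∷ y) rx ry dx dy l C = columnPair⇒compatible (List.map φ x) (List.map φ y)
        (decreasing⇒desc a x rx dx) (decreasing⇒desc b y ry dy) (λ _ → l)
        (map-columnPair φ φ-injective φ-reflects rx ry C)

    positions⇒columns : All DescL (List.map (List.map φ) τ) → AllPairs CompatibleL (List.map (List.map φ) τ) → Columns τ
    positions⇒columns ds ps = nth-All τ (λ i x q → dec x (All-nth relevant i q) (All-nth ds i (nth-map⁺ (List.map φ) τ i q))) ,
        nth-AllPairs τ λ i j x y l q q′ → go x y (All-nth relevant i q) (All-nth relevant j q′)
          (All-nth ds i (nth-map⁺ (List.map φ) τ i q)) (All-nth ds j (nth-map⁺ (List.map φ) τ j q′))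
          (AllPairs-nth ps i j l (nth-map⁺ (List.map φ) τ i q) (nth-map⁺ (List.map φ) τ j q′))
      where
      dec : ∀ x → All Relevant x → DescL (List.map φ x) → DecreasingUp x
      dec []      rx d h ()
      dec (a ∷ x) rx d = desc⇒decreasing a x rx d
      go : ∀ x y → All Relevant x → All Relevant y → DescL (List.map φ x) → DescL (List.map φ y) → CompatibleL (List.map φ x) (List.map φ y) →
        ColumnPair _≺_ x y
      go []      y       rx ry dx dy rl = record { same-row = λ _ () ; next-row = λ _ () ; type-1 = λ () ; type-2 = λ _ _ _ () }
      go (a ∷ x) []      rx ry dx dy rl = record { same-row = λ _ _ () ; next-row = λ _ _ () ; type-1 = λ _ _ _ () ; type-2 = λ () }
      go (a ∷ x) (b ∷ y) rx ry dx dy rl = unmap-columnPair φ φ-mono rx ry (compatible⇒columnPair (List.map φ x) (List.map φ y) dx dy rl)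

toList-inj : ∀ {A : Set} {n} (u v : Vec A n) → toList u ≡ toList v → u ≡ v
toList-inj u v q = trans (sym (cast-is-id refl u)) (toList-injective refl u v q)

fromList-length : ∀ {A : Set} {n} (xs : List A) → length xs ≡ n → ∃[ v ] (toList {n = n} v ≡ xs)
fromList-length xs refl = fromList xs , toList∘fromList xs

lookup-≤-sum : ∀ {n} (v : Vec ℕ n) c → lookup v c ≤ Vec.sum v
lookup-≤-sum (x ∷ v) zero    = m≤m+n x _
lookup-≤-sum (x ∷ v) (suc c) = ≤-trans (lookup-≤-sum v c) (m≤n+m _ x)

unique-map-on : {A B : Set} (f : A → B) (xs : List A) → (∀ x y → x ∈ xs → y ∈ xs → f x ≡ f y → x ≡ y) →
  Unique xs → Unique (List.map f xs)
unique-map-on f []       inj []       = []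
unique-map-on f (x ∷ xs) inj (p ∷ ps) =
  Allₚ.map⁺ (All.tabulate λ {y} m q → All.lookup p m (inj x y (here refl) (there m) q)) ∷
  unique-map-on f xs (λ y z m m′ → inj y z (there m) (there m′)) ps

map-zipWith-∷ : ∀ {A B : Set} (f : A → B) xs yss → List.map (List.map f) (List.zipWith _∷_ xs yss) ≡
  List.zipWith _∷_ (List.map f xs) (List.map (List.map f) yss)
map-zipWith-∷ f []       yss        = refl
map-zipWith-∷ f (x ∷ xs) []         = refl
map-zipWith-∷ f (x ∷ xs) (ys ∷ yss) = cong ((f x ∷ List.map f ys) ∷_) (map-zipWith-∷ f xs yss)

All-zipWith-∷ : ∀ {A : Set} {P : A → Set} xs yss → All P xs → All (All P) yss → All (All P) (List.zipWith _∷_ xs yss)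
All-zipWith-∷ []       yss        ps       qs       = []
All-zipWith-∷ (x ∷ xs) []         ps       qs       = []
All-zipWith-∷ (x ∷ xs) (ys ∷ yss) (p ∷ ps) (q ∷ qs) = (p ∷ q) ∷ All-zipWith-∷ xs yss ps qs

All-concatFin : ∀ {A : Set} {P : A → Set} r {f : Fin r → List A} → (∀ j → All P (f j)) → All P (concatFin r f)
All-concatFin r ps = Allₚ.concat⁺ (Allₚ.map⁺ (All.universal (λ j → ps j) (allFin r)))

-- The bijection between enumerated fillings and the fillings of given weight

module Fillings (r : ℕ) (lam : Fin r → List ℕ) (partition : ∀ j → IsPartition (lam j)) (m : Fin r → List ℕ)
    (n : Fin r → ℕ) (large : ∀ j → length (m j) + length (lam j) ≤ n j) where

  ℓ : Fin r → ℕ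
  ℓ j = length (lam j)

  ℓ≤n : ∀ j → ℓ j ≤ n j
  ℓ≤n j = m+n≤o⇒n≤o (length (m j)) (large j)

  open Position r n ℓ ℓ≤n

  γ e : List ℕ
  γ = gamma r lam n
  e = expo r m n

  μ : List ℕ
  μ = shapeOf r lam

  length-block : ∀ j → length (replicate (n j ∸ ℓ j) 0 ++ reverse (lam j)) ≡ n j
  length-block j = trans (length-++ (replicate (n j ∸ ℓ j) 0))
    (trans (cong₂ _+_ (length-replicate (n j ∸ ℓ j)) (length-reverse (lam j))) (m∸n+n≡m (ℓ≤n j)))

  length-γ : length γ ≡ total r n
  length-γ = length-concatFin r n _ length-block

  length-e : length e ≡ total r n
  length-e = length-concatFin r n _ λ j → trans (length-map _ (upTo (n j))) (length-upTo (n j))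

  at-e : ∀ j k → k < n j → at e (off r n j + k) ≡ at (m j) k
  at-e j k l = trans (at-concatFin r n _ (λ j → trans (length-map _ (upTo (n j))) (length-upTo (n j))) j k l)
    (at-map-upTo (at (m j)) (n j) k l)

  positive-block : ∀ j → All (1 ≤_) (reverse (lam j))
  positive-block j = All.tabulate λ i∈ → All.lookup (proj₂ (partition j)) (Anyₚ.reverse⁻ i∈)

  select-γ : select γ γ ≡ μ
  select-γ = trans (select-concatFin r _ _ (λ j → refl)) (concatFin-cong r λ j →
    trans (select-++ (replicate (n j ∸ ℓ j) 0) _ (replicate (n j ∸ ℓ j) 0) _ refl)
      (cong₂ _++_ (select-zeros (n j ∸ ℓ j) (replicate (n j ∸ ℓ j) 0)) (select-positive (reverse (lam j)) _ (positive-block j) refl)))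

  -- In block j the positions that survive are the last ℓ j ones, and these are where `φ` puts ω_j,
  -- ω_j + 1, and so on.
  select-basement : select γ (range 0 (length γ)) ≡ List.map φ (basement r lam)
  select-basement = begin
      select γ (range 0 (length γ))
    ≡⟨ cong (λ t → select γ (range 0 t)) length-γ ⟩
      select γ (range 0 (total r n))
    ≡⟨ cong (select γ) (sym (range-concatFin r n 0)) ⟩
      select γ (concatFin r (λ j → range (off r n j) (n j)))
    ≡⟨ select-concatFin r _ _ (λ j → trans (length-block j) (sym (length-range (off r n j) (n j)))) ⟩
      concatFin r (λ j → select (replicate (n j ∸ ℓ j) 0 ++ reverse (lam j)) (range (off r n j) (n j)))
    ≡⟨ concatFin-cong r block ⟩
      concatFin r (λ j → List.map φ (List.map (om j) (upTo (ℓ j))))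
    ≡⟨ sym (map-concatFin φ r _) ⟩
      List.map φ (basement r lam) ∎
    where
    open ≡-Reasoning
    block : ∀ j → select (replicate (n j ∸ ℓ j) 0 ++ reverse (lam j)) (range (off r n j) (n j)) ≡ List.map φ (List.map (om j) (upTo (ℓ j)))
    block j = begin
        select (replicate a 0 ++ reverse (lam j)) (range s (n j))
      ≡⟨ cong (select (replicate a 0 ++ reverse (lam j))) (trans (cong (range s) (sym (m∸n+n≡m (ℓ≤n j)))) (range-++ s a (ℓ j))) ⟩
        select (replicate a 0 ++ reverse (lam j)) (range s a ++ range (s + a) (ℓ j))
      ≡⟨ select-++ (replicate a 0) _ (range s a) _ (trans (length-replicate a) (sym (length-range s a))) ⟩
        select (replicate a 0) (range s a) ++ select (reverse (lam j)) (range (s + a) (ℓ j))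
      ≡⟨ cong₂ _++_ (select-zeros a (range s a))
           (select-positive (reverse (lam j)) _ (positive-block j) (trans (length-reverse (lam j)) (sym (length-range (s + a) (ℓ j))))) ⟩
        range (s + a) (ℓ j)
      ≡⟨ sym (map-upTo-range (s + a) (ℓ j)) ⟩
        List.map ((s + a) +_) (upTo (ℓ j))
      ≡⟨ map-cong (λ c → +-assoc s a c) (upTo (ℓ j)) ⟩
        List.map (φ ∘ om j) (upTo (ℓ j))
      ≡⟨ map-∘ (upTo (ℓ j)) ⟩
        List.map φ (List.map (om j) (upTo (ℓ j))) ∎
      where
      a = n j ∸ ℓ j
      s = off r n j

  place : Label r → ℕ
  place (k , j) = φ (lab k j)

  -- The labels that can occur in a filling of weight x^m
  Small : Label r → Set
  Small (k , j) = 1 ≤ k × k ≤ length (m j)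

  -- This is the use of n j ≥ length (m j) + ℓ j: the labels permitted by the weight end before the
  -- basement positions of their block.
  small-≤ : ∀ {k j} → Small (k , j) → k ≤ n j ∸ ℓ j
  small-≤ {k} {j} (_ , q) = ≤-trans q (m+n≤o⇒m≤o∸n (length (m j)) (large j))

  small-relevant : ∀ {k j} → Small (k , j) → Relevant (lab k j)
  small-relevant s = proj₁ s , small-≤ s

  place-total : ∀ {p} → Small p → place p < total r n
  place-total {k , j} s = <-≤-trans (+-monoʳ-< (off r n j) (inBlock-< (lab k j) (small-relevant s))) (off-total r n j)

  Labelled : ℕ → Set
  Labelled i = ∃[ p ] (labelAt r n i ≡ just p × place p ≡ i × Small p)

  labelled : ∀ i → 1 ≤ at e i → Labelled i
  labelled i pos with position r n i (subst (i <_) length-e (at-positive e i pos))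
  ... | j , k , l , refl = (suc k , j) , labelAt-off r n j k l , refl , s≤s z≤n , at-positive (m j) k (subst (1 ≤_) (at-e j k l) pos)

  labels : List (List ℕ) → Filling r
  labels = List.map (mapMaybe (labelAt r n))

  places : Filling r → List (List ℕ)
  places = List.map (List.map place)

  places-labels : ∀ T → All (All Labelled) T → places (labels T) ≡ T × All (All Small) (labels T)
  places-labels []      []       = refl , []
  places-labels (x ∷ T) (p ∷ ps) = cong₂ _∷_ (proj₁ (go x p)) (proj₁ (places-labels T ps)) , proj₂ (go x p) ∷ proj₂ (places-labels T ps)
    where
    go : ∀ x → All Labelled x → List.map place (mapMaybe (labelAt r n) x) ≡ x × All Small (mapMaybe (labelAt r n) x)
    go []      []                     = refl , []
    go (i ∷ x) ((p , q , eq , s) ∷ ps) rewrite q = cong₂ _∷_ eq (proj₁ (go x ps)) , s ∷ proj₂ (go x ps)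

  labels-places : ∀ σ → All (All Small) σ → labels (places σ) ≡ σ
  labels-places []      []       = refl
  labels-places (x ∷ σ) (p ∷ ps) = cong₂ _∷_ (go x p) (labels-places σ ps)
    where
    go : ∀ x → All Small x → mapMaybe (labelAt r n) (List.map place x) ≡ x
    go []                []       = refl
    go ((suc k , j) ∷ x) (s ∷ ps) rewrite labelAt-off r n j k (≤-trans (small-≤ s) (m∸n≤m (n j) (ℓ j))) = cong ((suc k , j) ∷_) (go x ps)
    go ((zero , j) ∷ x)  ((() , _) ∷ ps)

  τ : Filling r → List (List (Sym r))
  τ σ = extend (basement r lam) σ

  module _ (σ : Filling r) (small : All (All Small) σ) where

    relevant : All (All Relevant) (τ σ)
    relevant = All-zipWith-∷ (basement r lam) _
      (All-concatFin r λ j → Allₚ.map⁺ (Allₚ.applyUpTo⁺₁ id (ℓ j) λ l → l))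
      (Allₚ.map⁺ (All.map (λ ps → Allₚ.map⁺ (All.map small-relevant ps)) small))

    positions : List.map (List.map φ) (τ σ) ≡ List.zipWith _∷_ (List.map φ (basement r lam)) (places σ)
    positions = trans (map-zipWith-∷ φ (basement r lam) _) (cong (List.zipWith _∷_ (List.map φ (basement r lam)))
      (trans (sym (map-∘ σ)) (map-cong (λ x → sym (map-∘ x)) σ)))

    module _ (S : Vec (List ℕ) (length γ)) (lengths : List.map length (toList S) ≡ γ) (selected : select γ (toList S) ≡ places σ) where

      private
        length-S : length (range 0 (length γ)) ≡ length (toList S)
        length-S = trans (length-range 0 (length γ)) (trans (cong length (sym lengths)) (length-map length (toList S)))

      select-columns : select γ (columnsFrom 0 S) ≡ List.map (List.map φ) (τ σ)
      select-columns = trans (select-zip _∷_ γ (range 0 (length γ)) (toList S) length-S)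
        (trans (cong₂ (List.zipWith _∷_) select-basement selected) (sym positions))

      heads-lt : AllPairs HeadLt (List.map (List.map φ) (τ σ))
      heads-lt = subst (AllPairs HeadLt) select-columns
        (AllPairs-select γ (AllPairs-HeadLt (range 0 (length γ)) (toList S) (range-increasing 0 (length γ))))

      to-columns : All DescL (columnsFrom 0 S) → AllPairs CompatibleL (columnsFrom 0 S) → Columns (τ σ)
      to-columns ds ps = positions⇒columns n ℓ ℓ≤n (τ σ) relevant heads-lt
        (subst (All DescL) select-columns (All-select γ ds)) (subst (AllPairs CompatibleL) select-columns (AllPairs-select γ ps))

      from-columns : Columns (τ σ) → All DescL (columnsFrom 0 S) × AllPairs CompatibleL (columnsFrom 0 S)
      from-columns C =
        let ds , ps = columns⇒positions n ℓ ℓ≤n (τ σ) relevant heads-lt C in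
        All-DescL-unselect γ (range 0 (length γ)) (toList S) lengths length-S (subst (All DescL) (sym select-columns) ds) ,
        AllPairs-compatible-unselect γ (range 0 (length γ)) (toList S) (range-increasing 0 (length γ)) lengths length-S
          (subst (AllPairs CompatibleL) (sym select-columns) ps)

  heights : ∀ σ → List.map length σ ≡ μ → ∀ c {x} → nth (τ σ) c ≡ just x → length x ≡ suc (at μ c)
  heights σ q c = subst (λ μ → ∀ {x} → nth (τ σ) c ≡ just x → length x ≡ suc (at μ c)) q (go (basement r lam) σ c)
    where
    go : ∀ B σ c {x} → nth (extend B σ) c ≡ just x → length x ≡ suc (at (List.map length σ) c)
    go (b ∷ B) (y ∷ σ) zero    refl = cong suc (length-map _ y)
    go (b ∷ B) (y ∷ σ) (suc c) q    = go B σ c q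

  count-places : ∀ σ → All (All Small) σ → ∀ j k → k < n j → countAll (off r n j + k) (places σ) ≡ countLabel (suc k) j σ
  count-places σ small j k l = countAll-label place (off r n j + k) (suc k) j Small refl differ σ small
    where
    differ : ∀ {p} → Small p → place p ≡ off r n j + k → p ≡ (suc k , j)
    differ {zero , j′} (() , _) q
    differ {suc k′ , j′} s q with labelAt-off r n j′ k′ (≤-trans (small-≤ s) (m∸n≤m (n j′) (ℓ j′))) | labelAt-off r n j k l
    ... | u | v = just-injective (trans (sym u) (trans (cong (labelAt r n) q) v))

  -- A label that occurs in σ has a positive exponent in m, and m j has no positive entry beyond its
  -- length.
  weight⇒small : ∀ σ → All (All (λ p → 1 ≤ proj₁ p)) σ → HasWeight σ m → All (All Small) σ
  weight⇒small σ pos w = All.zipWith (λ (p , q) → All.zipWith (λ { {p} (u , v) → small p u v }) (p , q)) (pos , countLabel-positive σ)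
    where
    small : ∀ p → 1 ≤ proj₁ p → 1 ≤ countLabel (proj₁ p) (proj₂ p) σ → Small p
    small (suc k , j) u v = u , at-positive (m j) k (subst (1 ≤_) (w j k) v)

  α : Vec ℕ (length γ)
  α = fromList γ

  -- A bound for the heights, basement included, as the recursion of `fills` demands; the sum of γ
  -- stands in for its maximum.
  rows : ℕ
  rows = suc (Vec.sum α)

  α-bound : ∀ c → lookup α c < rows
  α-bound c = s≤s (lookup-≤-sum α c)

  Fills : List (Vec (List ℕ) (length γ))
  Fills = fills (length γ) rows (map suc α) (ids (length γ)) e

  toFilling : Vec (List ℕ) (length γ) → Filling r
  toFilling S = labels (select γ (toList S))

  length-e-γ : length e ≡ length γ
  length-e-γ = trans length-e (sym length-γ)

  fuel : ∀ c → lookup (map suc α) c ≤ rows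
  fuel c = subst (_≤ rows) (sym (lookup-map c suc α)) (α-bound c)

  module Sound (S : Vec (List ℕ) (length γ)) (S∈ : S ∈ Fills) where

    private
      sound = fills-sound (length γ) rows (map suc α) (ids (length γ)) e fuel S∈
      columns = filled⇒columns α S (proj₁ sound)

    content : ∀ i → at e i ≡ countAll i (toList S)
    content = proj₂ sound

    lengths : List.map length (toList S) ≡ γ
    lengths = trans (proj₁ columns) (toList∘fromList γ)

    all-labelled : All (All Labelled) (select γ (toList S))
    all-labelled = All-select γ (All.map (All.map λ {i} q → labelled i (subst (1 ≤_) (sym (content i)) q)) (countAll-positive (toList S)))

    σ : Filling r
    σ = toFilling S

    places-σ : places σ ≡ select γ (toList S)
    places-σ = proj₁ (places-labels _ all-labelled)

    small : All (All Small) σ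
    small = proj₂ (places-labels _ all-labelled)

    recover : pad γ (places σ) ≡ toList S
    recover = trans (cong (pad γ) places-σ) (pad-select γ (toList S) lengths)

    shape : List.map length σ ≡ μ
    shape = trans (sym (trans (sym (map-∘ σ)) (map-cong (length-map place) σ)))
      (trans (cong (List.map length) places-σ) (trans (map-select length γ (toList S)) (trans (cong (select γ) lengths) select-γ)))

    inL : InL r lam σ
    inL = shape , All.map (All.map proj₁) small ,
      columns⇒conditions μ (τ σ) (heights σ shape) (to-columns σ small S lengths (sym places-σ) (proj₁ (proj₂ columns)) (proj₂ (proj₂ columns)))

    hasWeight : HasWeight σ m
    hasWeight j k with k <? n j
    ... | yes l = trans (sym (count-places σ small j k l)) (trans (cong (countAll (off r n j + k)) places-σ)
            (trans (countAll-select (off r n j + k) γ (toList S) lengths) (trans (sym (content (off r n j + k))) (at-e j k l))))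
    -- Beyond the n j variables both sides vanish: the labels of σ and the entries of m j stop at
    -- length (m j), which is at most n j.
    ... | no nl = trans (countLabel-zero (suc k) j σ (All.map (All.map λ { s refl → nl (≤-trans (proj₂ s) (m+n≤o⇒m≤o (length (m j)) (large j))) }) small))
            (sym (at-outside (m j) k (≤-trans (m+n≤o⇒m≤o (length (m j)) (large j)) (≮⇒≥ nl))))

  module Complete (σ : Filling r) (inL : InL r lam σ) (w : HasWeight σ m) where

    small : All (All Small) σ
    small = weight⇒small σ (proj₁ (proj₂ inL)) w

    lengths-places : List.map length (places σ) ≡ select γ γ
    lengths-places = trans (trans (sym (map-∘ σ)) (map-cong (length-map place) σ)) (trans (proj₁ inL) (sym select-γ))

    lengths-pad : List.map length (pad γ (places σ)) ≡ γ
    lengths-pad = length-pad γ (places σ) lengths-places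

    private
      vector = fromList-length {n = length γ} (pad γ (places σ)) (trans (sym (length-map length (pad γ (places σ)))) (cong length lengths-pad))

    S : Vec (List ℕ) (length γ)
    S = proj₁ vector

    lengths : List.map length (toList S) ≡ γ
    lengths = trans (cong (List.map length) (proj₂ vector)) lengths-pad

    selected : select γ (toList S) ≡ places σ
    selected = trans (cong (select γ) (proj₂ vector)) (select-pad γ (places σ) lengths-places)

    toFilling-S : toFilling S ≡ σ
    toFilling-S = trans (cong labels selected) (labels-places σ small)

    content : ∀ i → at e i ≡ countAll i (toList S)
    content i = trans (go (i <? total r n)) (trans (cong (countAll i) (sym selected)) (countAll-select i γ (toList S) lengths))
      where
      go : Dec (i < total r n) → at e i ≡ countAll i (places σ)
      go (yes l) with position r n i l
      ... | j , k , k<n , refl = trans (at-e j k k<n) (trans (sym (w j k)) (sym (count-places σ small j k k<n)))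
      go (no nl) = trans (at-outside e i (≤-trans (≤-reflexive length-e) (≮⇒≥ nl)))
        (sym (countAll-zero i (places σ) (Allₚ.map⁺ (All.map (λ ps → Allₚ.map⁺ (All.map (λ s q → nl (subst (_< total r n) q (place-total s))) ps)) small))))

    member : S ∈ Fills
    member = fills-complete (length γ) rows (map suc α) (ids (length γ)) e S fuel
        (λ c _ → subst (_< length γ) (sym (lookup-ids c)) (Finₚ.toℕ<n c)) length-e-γ
        (columns⇒filled α S (trans lengths (sym (toList∘fromList γ))) (proj₁ conditions) (proj₂ conditions)) content
      where
      conditions : All DescL (columnsFrom 0 S) × AllPairs CompatibleL (columnsFrom 0 S)
      conditions = from-columns σ small S lengths selected
        (let _ , _ , na , wd , nc = inL in conditions⇒columns μ (τ σ) (heights σ (proj₁ inL)) na wd nc)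

  list : List (Filling r)
  list = List.map toFilling Fills

  unique : Unique list
  -- The columns can be recovered from the filling by `places` and `pad`, so `toFilling` is
  -- injective on `Fills`.
  unique = unique-map-on toFilling Fills (λ S S′ S∈ S′∈ q → toList-inj S S′
      (trans (sym (Sound.recover S S∈)) (trans (cong (λ σ → pad γ (places σ)) q) (Sound.recover S′ S′∈))))
    (unique-fills (length γ) rows (map suc α) (ids (length γ)) e)

  spec : ∀ σ → (σ ∈ list) ⇔ (InL r lam σ × HasWeight σ m)
  spec σ = mk⇔ to λ (inL , w) → subst (_∈ list) (Complete.toFilling-S σ inL w) (∈-map⁺ toFilling (Complete.member σ inL w))
    where
    to : σ ∈ list → InL r lam σ × HasWeight σ m
    to σ∈ with ∈-map⁻ toFilling σ∈
    ... | S , S∈ , refl = Sound.inL S S∈ , Sound.hasWeight S S∈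

  length-list : (K : List ℕ → Coeffs) → IsKeyFamily K → K γ e ≡ toℚ (length list)
  length-list K key = trans (cong (λ g → K g e) (sym (toList∘fromList γ)))
    (trans (key-counts K key rows α α-bound e length-e-γ)
    (cong toℚ (sym (trans (length-map toFilling Fills) (length-fills (length γ) rows (map suc α) (ids (length γ)) e)))))

≤-total-sum : ∀ r (n : Fin r → ℕ) j → n j ≤ total r n
≤-total-sum r n j = ≤-trans (m≤n+m (n j) (off r n j)) (off-total r n j)

mainTheorem1 : (K : List ℕ → Coeffs) → IsKeyFamily K →
    (r : ℕ) (lam : Fin r → List ℕ) → (∀ j → IsPartition (lam j)) →
    (m : Fin r → List ℕ) →
    ∃[ ls ] ( Unique ls
    × (∀ (σ : Filling r) → (σ ∈ ls) ⇔ (InL r lam σ × HasWeight σ m))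
    × ∃[ N ] (∀ (n : Fin r → ℕ) → (∀ j → N ≤ n j) →
    K (gamma r lam n) (expo r m n) ≡ toℚ (length ls)) )
mainTheorem1 K key r lam partition m =
    list N′ bound , unique N′ bound , spec N′ bound , N , λ n large →
      let large′ = λ j → ≤-trans (bound j) (large j) in
      -- The specification of the list does not mention n. Two lists for different n thus have the
      -- same elements without repetition, hence the same length, and the coefficient is stable.
      trans (length-list n large′ K key) (cong toℚ (↭-length (∼bag⇒↭ (unique∧set⇒bag (unique n large′) (unique N′ bound) λ {σ} →
        mk⇔ (λ σ∈ → Equivalence.from (spec N′ bound σ) (Equivalence.to (spec n large′ σ) σ∈))
            (λ σ∈ → Equivalence.from (spec n large′ σ) (Equivalence.to (spec N′ bound σ) σ∈))))))
  where
  open Fillings r lam partition m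
  -- The sum over all blocks serves as a common bound for each of them.
  N : ℕ
  N = total r (λ j → length (m j) + length (lam j))
  N′ : Fin r → ℕ
  N′ _ = N
  bound : ∀ j → length (m j) + length (lam j) ≤ N
  bound = ≤-total-sum r (λ j → length (m j) + length (lam j))
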